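{- Let $\rho = \frac{1}{1000}$. For every $\epsilon > 0$ there exists $n_0(\epsilon)$ such that for all $n \geq n_0(\epsilon)$ the following holds. Let $G$ be a graph on $n$ vertices with at least $n^{2 - \rho}$ edges. If $\mathsf{sp}(G) \leq n^{1 + \rho}$, then $G$ contains an induced subgraph $H$ on at least $n^{1 - 4\rho}$ vertices with edge density at least $1 - \epsilon$.
   Context: Graphs are finite, simple and undirected. For a graph $G$ with $m$ edges, $\mathsf{mc}(G)$ is the largest number of edges in a bipartite subgraph of $G$, and the surplus is $\mathsf{sp}(G) = \mathsf{mc}(G) - \frac{m}{2}$. The edge density of a graph with $n$ vertices and $m$ edges is $p = \frac{2m}{n^2}$. -}

module Defs where

open import Data.Nat using (ℕ; zero; suc; _+_; _⊔_)
open import Data.Bool using (Bool; true; false; _∧_; _xor_; if_then_else_)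
open import Data.Fin using (Fin; zero; suc; _<?_)
open import Data.List using (List; []; _∷_; map; foldr; concatMap)
open import Relation.Nullary using (does)
open import Relation.Binary.PropositionalEquality using (_≡_)
import Data.Vec.Functional as VF

record Graph (n : ℕ) : Set where
  field
    adj    : Fin n → Fin n → Bool
    sym    : ∀ i j → adj i j ≡ adj j i
    irrefl : ∀ i → adj i i ≡ false
open Graph public

sumFin : ∀ {n} → (Fin n → ℕ) → ℕ
sumFin {zero}  f = 0
sumFin {suc n} f = f zero + sumFin (λ i → f (suc i))

size : ∀ {n} → (Fin n → Bool) → ℕ
size S = sumFin (λ i → if S i then 1 else 0)

edgesIn : ∀ {n} → Graph n → (Fin n → Bool) → ℕ
edgesIn G S = sumFin (λ i → sumFin (λ j →
  if does (i <? j) ∧ S i ∧ S j ∧ adj G i j then 1 else 0))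

edges : ∀ {n} → Graph n → ℕ
edges G = edgesIn G (λ _ → true)

cut : ∀ {n} → Graph n → (Fin n → Bool) → ℕ
cut G c = sumFin (λ i → sumFin (λ j →
  if does (i <? j) ∧ adj G i j ∧ (c i xor c j) then 1 else 0))

colourings : (n : ℕ) → List (Fin n → Bool)
colourings zero    = (λ ()) ∷ []
colourings (suc n) =
  concatMap (λ c → (true VF.∷ c) ∷ (false VF.∷ c) ∷ []) (colourings n)

mc : ∀ {n} → Graph n → ℕ
mc G = foldr _⊔_ 0 (map (cut G) (colourings _))

{-# OPTIONS --safe #-}
module Submission where

-- A small surplus s means that x^T A x ≥ -O(s) for all x in the cube [-1,1]^n.  Hence
-- A + λI is positive semidefinite after deleting a few vertices: otherwise one could go
-- on extracting vectors x with x^T A x < -λ|x|² until many vertices carry unit weight,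
-- and a truncated random sign combination of these vectors would violate the bound on
-- the cube.
--
-- Write M = A + λI as a Gram matrix of vectors b_x.  Since A is a 0/1 matrix, M ∘ M
-- (the entrywise square) equals M up to a multiple of I.  Let f(N) be the trace of M
-- truncated to its eigenvalues above n/N, divided by n.  By Schur's product theorem the
-- truncation Φ satisfies Φ ∘ Φ ⪯ M ∘ M, and Φ ∘ Φ lives in about (N f(N))² dimensions,
-- so essentially f(N)² ≤ f(N²).  As f ≤ λ = n^{o(1)}, iterating gives f(N) = O(N^{1/8}).
--
-- Now let U maximise |U| p(U)^K, where p(U) is the density of G[U].  By maximality U has
-- large minimum degree and the neighbourhoods in U are not much denser than U.  The
-- difference v_x of the means of the b_y over the neighbourhood of x and over U then is
-- short, while ⟨b_x, v_x⟩ ≈ 1 - p(U).  Since b_x has truncated squared norm about f(N),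
-- Cauchy-Schwarz bounds 1 - p(U).  With K = 2 this yields a set of constant density, and
-- inside it a large constant K yields density 1 - ε.
--
-- Everything is done over ℚ: a symmetric rational matrix is either a Gram matrix of
-- rational vectors or has a negative vector (Lagrange reduction), and the truncation to
-- large eigenvalues is replaced by the matrix polynomial 1 - (1 - M/κ)^(2^i).

-- All quantities are measured in powers of T, the integer part of n^(1/1000): the density is at
-- least 1/T and the surplus is O(nT). Rounding a random combination to the cube of height T costs
-- surplus times T^2, that is O(nT^3). With λ = T^5 only O(n/T^2) vertices are deleted, too few to
-- destroy a density of 1/T. Two extremal rounds are forced: at density 1/T the choice of a large K
-- could shrink the set by T^K, which exceeds the permitted T^4. K = 2 costs only O(T^2), and once
-- the density is constant a large K costs only a constant. The exponent 1/8 balances two losses.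
-- For density q one takes N with N^(7/8) of order 1/q, so that the truncation is harmless; the
-- neighbourhood excess is about q^(1/2), and Cauchy-Schwarz would bound a constant by f(N) q^(1/2)
-- = O(q^(-1/7+1/2)), which fails for small q. Any exponent below 1/3 would win here. The costliest
-- demand is 8λ^19 = 8T^95 on the size of U, which n ≥ T^100 meets.

module Proof where

  open import Defs renaming (sym to adj-sym; irrefl to adj-irrefl)
  open import Data.Nat as ℕ using (ℕ; zero; suc)
  import Data.Nat.Properties as ℕₚ
  open import Data.Integer as ℤ using (ℤ)
  import Data.Integer.Properties as ℤₚ
  open import Data.Rational using (ℚ; mkℚ; 0ℚ; 1ℚ; ½; _+_; _*_; _-_; -_; _≤_; _<_; _/_; 1/_; toℚᵘ)
  open import Data.Rational.Properties
  import Data.Rational.Unnormalised as ℚᵘ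
  import Data.Rational.Unnormalised.Properties as ℚᵘₚ
  open import Data.Fin using (Fin; zero; suc)
  import Data.Fin as Fin
  import Data.Fin.Properties as Finₚ
  open import Data.Bool using (Bool; true; false; _∧_; _xor_; not; if_then_else_)
  import Data.Bool.Properties as Boolₚ
  open import Data.List using (List; []; _∷_; map; foldr; _++_; length; lookup; replicate)
  import Data.List.Membership.Propositional as Mem
  import Data.List.Membership.Propositional.Properties as Memₚ
  import Data.List.Relation.Unary.Any
  open import Data.List.Relation.Unary.Any using (here; there)
  import Data.Vec.Functional as VF
  open import Data.Maybe using (Maybe; just; nothing)
  open import Data.Product using (∃-syntax; _×_; _,_; proj₁; proj₂)
  open import Data.Sum using (_⊎_; inj₁; inj₂)
  open import Data.Empty using (⊥; ⊥-elim)
  open import Data.Unit using (tt)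
  open import Function using (_∘_)
  open import Level using (0ℓ)
  import Relation.Binary
  open import Relation.Nullary using (¬_; Dec; yes; no; does)
  open import Relation.Binary.PropositionalEquality using (_≡_; _≢_; refl; sym; trans; cong; cong₂; subst; subst₂; _≗_)
  open import Tactic.RingSolver using (solve-∀)
  open import Tactic.RingSolver.Core.AlmostCommutativeRing using (AlmostCommutativeRing; fromCommutativeRing)
  open import Data.Nat.Tactic.RingSolver renaming (solve-∀ to ℕ-solve-∀) using ()

  0≟_ : ∀ x → Maybe (0ℚ ≡ x)
  0≟ x with 0ℚ ≟ x
  ... | yes p = just p
  ... | no  _ = nothing

  ℚ-ring : AlmostCommutativeRing 0ℓ 0ℓ
  ℚ-ring = fromCommutativeRing +-*-commutativeRing 0≟_

  -- Ordered field arithmetic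

  ≤-by : ∀ {a b} c → a + c ≡ b → 0ℚ ≤ c → a ≤ b
  ≤-by {a} {b} c eq 0≤c = subst₂ _≤_ (+-identityʳ a) eq (+-monoʳ-≤ a 0≤c)

  0≤-diff : ∀ {a b} → a ≤ b → 0ℚ ≤ b - a
  0≤-diff {a} {b} a≤b = subst (_≤ b - a) (+-inverseʳ a) (+-monoˡ-≤ (- a) a≤b)

  ≤-from-diff : ∀ {a b} → 0ℚ ≤ b - a → a ≤ b
  ≤-from-diff {a} {b} h = ≤-by (b - a) (lem a b) h
    where lem : ∀ a b → a + (b - a) ≡ b
          lem = solve-∀ ℚ-ring

  0≤+ : ∀ {a b} → 0ℚ ≤ a → 0ℚ ≤ b → 0ℚ ≤ a + b
  0≤+ ha hb = +-mono-≤ ha hb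

  *-monoˡ : ∀ {a b} c → 0ℚ ≤ c → a ≤ b → c * a ≤ c * b
  *-monoˡ c hc = *-monoˡ-≤-nonNeg c {{Data.Rational.nonNegative hc}}

  *-monoʳ : ∀ {a b} c → 0ℚ ≤ c → a ≤ b → a * c ≤ b * c
  *-monoʳ c hc = *-monoʳ-≤-nonNeg c {{Data.Rational.nonNegative hc}}

  0≤* : ∀ {a b} → 0ℚ ≤ a → 0ℚ ≤ b → 0ℚ ≤ a * b
  0≤* {a} {b} ha hb = subst (_≤ a * b) (*-zeroʳ a) (*-monoˡ a ha hb)

  *-mono : ∀ {a b c d} → 0ℚ ≤ c → 0ℚ ≤ b → a ≤ b → c ≤ d → a * c ≤ b * d
  *-mono {a} {b} {c} {d} hc hb a≤b c≤d = ≤-trans (*-monoʳ c hc a≤b) (*-monoˡ b hb c≤d)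

  0<* : ∀ {a b} → 0ℚ < a → 0ℚ < b → 0ℚ < a * b
  0<* {a} {b} ha hb =
    positive⁻¹ (a * b) {{pos*pos⇒pos a {{Data.Rational.positive ha}} b {{Data.Rational.positive hb}}}}

  0≤sq : ∀ a → 0ℚ ≤ a * a
  0≤sq a with ≤-total 0ℚ a
  ... | inj₁ h = 0≤* h h
  ... | inj₂ h = subst (0ℚ ≤_) (lem a) (0≤* (neg-antimono-≤ h) (neg-antimono-≤ h))
    where lem : ∀ a → (- a) * (- a) ≡ a * a
          lem = solve-∀ ℚ-ring

  0≤1 : 0ℚ ≤ 1ℚ
  0≤1 = 0≤sq 1ℚ

  0<1 : 0ℚ < 1ℚ
  0<1 = positive⁻¹ 1ℚ

  0≤½ : 0ℚ ≤ ½
  0≤½ = nonNegative⁻¹ ½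

  2ℚ : ℚ
  2ℚ = ℤ.+ 2 / 1

  0≤2 : 0ℚ ≤ 2ℚ
  0≤2 = nonNegative⁻¹ 2ℚ

  cancel-≤ : ∀ {a b} c → 0ℚ < c → c * a ≤ c * b → a ≤ b
  cancel-≤ c hc = *-cancelˡ-≤-pos c {{Data.Rational.positive hc}}

  ≤⊎> : ∀ a b → (a ≤ b) ⊎ (b < a)
  ≤⊎> a b with a ≤? b
  ... | yes p = inj₁ p
  ... | no  p = inj₂ (≰⇒> p)

  <⇒¬≤ : ∀ {a b} → a < b → ¬ (b ≤ a)
  <⇒¬≤ a<b b≤a = <-irrefl refl (<-≤-trans a<b b≤a)

  0<-≤ : ∀ {a b} → 0ℚ < a → a ≤ b → 0ℚ < b
  0<-≤ = <-≤-trans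

  -- With the junk value inv a = 0 for a ≤ 0.
  inv : ℚ → ℚ
  inv a with ≤⊎> a 0ℚ
  ... | inj₁ _ = 0ℚ
  ... | inj₂ h = (1/ a) {{pos⇒nonZero a {{Data.Rational.positive h}}}}

  inv-* : ∀ {a} → 0ℚ < a → a * inv a ≡ 1ℚ
  inv-* {a} h with ≤⊎> a 0ℚ
  ... | inj₁ h′ = ⊥-elim (<⇒¬≤ h h′)
  ... | inj₂ h′ = *-inverseʳ a {{pos⇒nonZero a {{Data.Rational.positive h′}}}}

  0≤inv : ∀ a → 0ℚ ≤ inv a
  0≤inv a with ≤⊎> a 0ℚ
  ... | inj₁ _ = ≤-refl
  ... | inj₂ h = nonNegative⁻¹ r {{pos⇒nonNeg r {{1/pos⇒pos a {{Data.Rational.positive h}}}}}}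
    where r = (1/ a) {{pos⇒nonZero a {{Data.Rational.positive h}}}}

  0<inv : ∀ {a} → 0ℚ < a → 0ℚ < inv a
  0<inv {a} h with ≤⊎> (inv a) 0ℚ
  ... | inj₂ p = p
  ... | inj₁ p = ⊥-elim (<⇒¬≤ 0<1 (subst₂ _≤_ (inv-* h) (*-zeroʳ a) (*-monoˡ a (<⇒≤ h) p)))

  ≤-sq : ∀ {a b} → 0ℚ ≤ b → a * a ≤ b * b → a ≤ b
  ≤-sq {a} {b} hb h with ≤⊎> a b
  ... | inj₁ p = p
  ... | inj₂ p = ⊥-elim (<⇒¬≤ lt h)
    where
      ha : 0ℚ < a
      ha = ≤-<-trans hb p
      lt : b * b < a * a
      lt = ≤-<-trans (*-monoʳ b hb (<⇒≤ p)) (*-monoʳ-<-pos a {{Data.Rational.positive ha}} p)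

  2ab≤ : ∀ a b → a * b + a * b ≤ a * a + b * b
  2ab≤ a b = ≤-by ((a - b) * (a - b)) (lem a b) (0≤sq (a - b))
    where lem : ∀ a b → a * b + a * b + (a - b) * (a - b) ≡ a * a + b * b
          lem = solve-∀ ℚ-ring

  infixr 9 _↑_
  _↑_ : ℚ → ℕ → ℚ
  a ↑ zero  = 1ℚ
  a ↑ suc k = a * a ↑ k

  0≤↑ : ∀ {a} k → 0ℚ ≤ a → 0ℚ ≤ a ↑ k
  0≤↑ zero    h = 0≤1
  0≤↑ (suc k) h = 0≤* h (0≤↑ k h)

  0<↑ : ∀ {a} k → 0ℚ < a → 0ℚ < a ↑ k
  0<↑ zero    h = 0<1
  0<↑ (suc k) h = 0<* h (0<↑ k h)

  ↑-mono : ∀ {a b} k → 0ℚ ≤ a → a ≤ b → a ↑ k ≤ b ↑ k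
  ↑-mono zero    ha h = ≤-refl
  ↑-mono (suc k) ha h = *-mono (0≤↑ k ha) (≤-trans ha h) h (↑-mono k ha h)

  ↑-+ : ∀ a j k → a ↑ (j ℕ.+ k) ≡ a ↑ j * a ↑ k
  ↑-+ a zero    k = sym (*-identityˡ _)
  ↑-+ a (suc j) k = trans (cong (a *_) (↑-+ a j k)) (sym (*-assoc a _ _))

  ↑-*-dist : ∀ a b k → (a * b) ↑ k ≡ a ↑ k * b ↑ k
  ↑-*-dist a b zero    = refl
  ↑-*-dist a b (suc k) = trans (cong (a * b *_) (↑-*-dist a b k)) (lem a b (a ↑ k) (b ↑ k))
    where lem : ∀ a b x y → a * b * (x * y) ≡ a * x * (b * y)
          lem = solve-∀ ℚ-ring

  ↑-↑ : ∀ a j k → (a ↑ j) ↑ k ≡ a ↑ (k ℕ.* j)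
  ↑-↑ a j zero    = refl
  ↑-↑ a j (suc k) = trans (cong (a ↑ j *_) (↑-↑ a j k)) (sym (↑-+ a j (k ℕ.* j)))

  ↑-cancel-≤ : ∀ {a b} k → 0ℚ ≤ b → a ↑ suc k ≤ b ↑ suc k → a ≤ b
  ↑-cancel-≤ {a} {b} k hb h with ≤⊎> a b
  ... | inj₁ p = p
  ... | inj₂ p = ⊥-elim (<⇒¬≤ lt h)
    where
      ha : 0ℚ < a
      ha = ≤-<-trans hb p
      lt : b ↑ suc k < a ↑ suc k
      lt = ≤-<-trans (*-monoˡ b hb (↑-mono k hb (<⇒≤ p)))
                     (*-monoˡ-<-pos (a ↑ k) {{Data.Rational.positive (0<↑ k ha)}} p)

  1≤↑ : ∀ {a} k → 1ℚ ≤ a → 1ℚ ≤ a ↑ k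
  1≤↑ zero    h = ≤-refl
  1≤↑ {a} (suc k) h = subst (_≤ a * a ↑ k) (*-identityˡ 1ℚ) (*-mono 0≤1 (≤-trans 0≤1 h) h (1≤↑ k h))

  ↑-mono-exp : ∀ {a j k} → 1ℚ ≤ a → j ℕ.≤ k → a ↑ j ≤ a ↑ k
  ↑-mono-exp {k = k} h ℕ.z≤n     = 1≤↑ k h
  ↑-mono-exp {a} h (ℕ.s≤s j≤k) = *-monoˡ a (≤-trans 0≤1 h) (↑-mono-exp h j≤k)

  1↑ : ∀ k → 1ℚ ↑ k ≡ 1ℚ
  1↑ zero    = refl
  1↑ (suc k) = trans (*-identityˡ _) (1↑ k)

  -- Natural numbers inside ℚ

  ι : ℕ → ℚ
  ι zero    = 0ℚ
  ι (suc n) = 1ℚ + ι n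

  0≤ι : ∀ n → 0ℚ ≤ ι n
  0≤ι zero    = ≤-refl
  0≤ι (suc n) = 0≤+ 0≤1 (0≤ι n)

  0<ι : ∀ {n} → 0 ℕ.< n → 0ℚ < ι n
  0<ι {suc n} _ = 0<-≤ 0<1 (≤-by (ι n) refl (0≤ι n))

  ι-+ : ∀ m n → ι (m ℕ.+ n) ≡ ι m + ι n
  ι-+ zero    n = sym (+-identityˡ _)
  ι-+ (suc m) n = trans (cong (1ℚ +_) (ι-+ m n)) (sym (+-assoc 1ℚ (ι m) (ι n)))

  ι-* : ∀ m n → ι (m ℕ.* n) ≡ ι m * ι n
  ι-* zero    n = sym (*-zeroˡ (ι n))
  ι-* (suc m) n = trans (ι-+ n (m ℕ.* n)) (trans (cong (ι n +_) (ι-* m n)) (lem (ι m) (ι n)))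
    where lem : ∀ a b → b + a * b ≡ (1ℚ + a) * b
          lem = solve-∀ ℚ-ring

  ι-^ : ∀ m k → ι (m ℕ.^ k) ≡ ι m ↑ k
  ι-^ m zero    = refl
  ι-^ m (suc k) = trans (ι-* m (m ℕ.^ k)) (cong (ι m *_) (ι-^ m k))

  ι-mono : ∀ {m n} → m ℕ.≤ n → ι m ≤ ι n
  ι-mono {n = n} ℕ.z≤n = 0≤ι n
  ι-mono (ℕ.s≤s h)     = +-monoʳ-≤ 1ℚ (ι-mono h)

  ι-mono-< : ∀ {m n} → m ℕ.< n → ι m < ι n
  ι-mono-< {m} {n} h = <-≤-trans lt (ι-mono h)
    where lt : ι m < 1ℚ + ι m
          lt = subst (_< 1ℚ + ι m) (+-identityˡ _) (+-monoˡ-< (ι m) 0<1)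

  ι-cancel-≤ : ∀ {m n} → ι m ≤ ι n → m ℕ.≤ n
  ι-cancel-≤ {m} {n} h with m ℕ.≤? n
  ... | yes p = p
  ... | no  p = ⊥-elim (<⇒¬≤ (ι-mono-< (ℕₚ.≰⇒> p)) h)

  ι≡/1 : ∀ n → ι n ≡ ℤ.+ n / 1
  ι≡/1 zero    = refl
  ι≡/1 (suc n) = trans (cong (1ℚ +_) (ι≡/1 n)) (toℚᵘ-injective eq)
    where
      open ℚᵘₚ.≃-Reasoning
      eq : toℚᵘ (1ℚ + ℤ.+ n / 1) ℚᵘ.≃ toℚᵘ (ℤ.+ (suc n) / 1)
      eq = begin
        toℚᵘ (1ℚ + ℤ.+ n / 1)               ≈⟨ toℚᵘ-homo-+ 1ℚ (ℤ.+ n / 1) ⟩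
        ℚᵘ.1ℚᵘ ℚᵘ.+ toℚᵘ (ℤ.+ n / 1)        ≈⟨ ℚᵘₚ.+-congʳ ℚᵘ.1ℚᵘ (toℚᵘ-fromℚᵘ (ℚᵘ.mkℚᵘ (ℤ.+ n) 0)) ⟩
        ℚᵘ.1ℚᵘ ℚᵘ.+ ℚᵘ.mkℚᵘ (ℤ.+ n) 0       ≈⟨ ℚᵘ.*≡* (cong (λ z → (ℤ.+ 1 ℤ.+ z) ℤ.* ℤ.+ 1) (ℤₚ.*-identityʳ (ℤ.+ n))) ⟩
        ℚᵘ.mkℚᵘ (ℤ.+ (suc n)) 0             ≈⟨ toℚᵘ-fromℚᵘ (ℚᵘ.mkℚᵘ (ℤ.+ (suc n)) 0) ⟨
        toℚᵘ (ℤ.+ (suc n) / 1)              ∎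

  -- Finite sums

  ∑ : ∀ {n} → (Fin n → ℚ) → ℚ
  ∑ {zero}  f = 0ℚ
  ∑ {suc n} f = f zero + ∑ (λ i → f (suc i))

  ∑-cong : ∀ {n} {f g : Fin n → ℚ} → f ≗ g → ∑ f ≡ ∑ g
  ∑-cong {zero}  h = refl
  ∑-cong {suc n} h = cong₂ _+_ (h zero) (∑-cong (λ i → h (suc i)))

  ∑-0 : ∀ n → ∑ {n} (λ _ → 0ℚ) ≡ 0ℚ
  ∑-0 zero    = refl
  ∑-0 (suc n) = trans (+-identityˡ _) (∑-0 n)

  ∑-zero : ∀ {n} {f : Fin n → ℚ} → (∀ i → f i ≡ 0ℚ) → ∑ f ≡ 0ℚ
  ∑-zero {n} h = trans (∑-cong h) (∑-0 n)

  ∑-+ : ∀ {n} (f g : Fin n → ℚ) → ∑ (λ i → f i + g i) ≡ ∑ f + ∑ g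
  ∑-+ {zero}  f g = refl
  ∑-+ {suc n} f g = trans (cong (λ z → f zero + g zero + z) (∑-+ (f ∘ suc) (g ∘ suc))) (lem (f zero) (g zero) _ _)
    where lem : ∀ a b c d → a + b + (c + d) ≡ a + c + (b + d)
          lem = solve-∀ ℚ-ring

  ∑-*ˡ : ∀ {n} c (f : Fin n → ℚ) → ∑ (λ i → c * f i) ≡ c * ∑ f
  ∑-*ˡ {zero}  c f = sym (*-zeroʳ c)
  ∑-*ˡ {suc n} c f = trans (cong (c * f zero +_) (∑-*ˡ c (f ∘ suc))) (sym (*-distribˡ-+ c _ _))

  ∑-*ʳ : ∀ {n} c (f : Fin n → ℚ) → ∑ (λ i → f i * c) ≡ ∑ f * c
  ∑-*ʳ c f = trans (∑-cong (λ i → *-comm (f i) c)) (trans (∑-*ˡ c f) (*-comm c (∑ f)))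

  ∑-neg : ∀ {n} (f : Fin n → ℚ) → ∑ (λ i → - f i) ≡ - ∑ f
  ∑-neg {zero}  f = refl
  ∑-neg {suc n} f = trans (cong (- f zero +_) (∑-neg (f ∘ suc))) (sym (neg-distrib-+ (f zero) _))

  ∑-- : ∀ {n} (f g : Fin n → ℚ) → ∑ (λ i → f i - g i) ≡ ∑ f - ∑ g
  ∑-- f g = trans (∑-+ f (λ i → - g i)) (cong (_+_ (∑ f)) (∑-neg g))

  ∑-swap : ∀ {m n} (f : Fin m → Fin n → ℚ) → ∑ (λ i → ∑ (λ j → f i j)) ≡ ∑ (λ j → ∑ (λ i → f i j))
  ∑-swap {zero}  {n} f = sym (∑-0 n)
  ∑-swap {suc m} {n} f = trans (cong (∑ (f zero) +_) (∑-swap (f ∘ suc))) (sym (∑-+ (f zero) _))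

  ∑-mono : ∀ {n} {f g : Fin n → ℚ} → (∀ i → f i ≤ g i) → ∑ f ≤ ∑ g
  ∑-mono {zero}  h = ≤-refl
  ∑-mono {suc n} h = +-mono-≤ (h zero) (∑-mono (λ i → h (suc i)))

  0≤∑ : ∀ {n} {f : Fin n → ℚ} → (∀ i → 0ℚ ≤ f i) → 0ℚ ≤ ∑ f
  0≤∑ {n} {f} h = subst (_≤ ∑ f) (∑-0 n) (∑-mono h)

  ∑-const : ∀ n c → ∑ {n} (λ _ → c) ≡ ι n * c
  ∑-const zero    c = sym (*-zeroˡ c)
  ∑-const (suc n) c = trans (cong (c +_) (∑-const n c)) (lem c (ι n))
    where lem : ∀ c a → c + a * c ≡ (1ℚ + a) * c
          lem = solve-∀ ℚ-ring

  ≤∑ : ∀ {n} {f : Fin n → ℚ} → (∀ i → 0ℚ ≤ f i) → ∀ i → f i ≤ ∑ f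
  ≤∑ {f = f} h zero    = ≤-by (∑ (f ∘ suc)) refl (0≤∑ (λ j → h (suc j)))
  ≤∑ {f = f} h (suc i) = ≤-trans (≤∑ (λ j → h (suc j)) i) (≤-by (f zero) (+-comm _ (f zero)) (h zero))

  δ : ∀ {n} → Fin n → Fin n → ℚ
  δ zero    zero    = 1ℚ
  δ zero    (suc j) = 0ℚ
  δ (suc i) zero    = 0ℚ
  δ (suc i) (suc j) = δ i j

  δ-sym : ∀ {n} (i j : Fin n) → δ i j ≡ δ j i
  δ-sym zero    zero    = refl
  δ-sym zero    (suc j) = refl
  δ-sym (suc i) zero    = refl
  δ-sym (suc i) (suc j) = δ-sym i j

  δ-refl : ∀ {n} (i : Fin n) → δ i i ≡ 1ℚ
  δ-refl zero    = refl
  δ-refl (suc i) = δ-refl i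

  ∑-δ : ∀ {n} (i : Fin n) (f : Fin n → ℚ) → ∑ (λ j → δ i j * f j) ≡ f i
  ∑-δ zero    f = trans (cong₂ _+_ (*-identityˡ (f zero)) (∑-zero (λ j → *-zeroˡ (f (suc j))))) (+-identityʳ _)
  ∑-δ (suc i) f = trans (cong₂ _+_ (*-zeroˡ (f zero)) (∑-δ i (f ∘ suc))) (+-identityˡ _)

  -- Vectors, matrices and positive semidefiniteness

  Vec : ℕ → Set
  Vec n = Fin n → ℚ

  Mat : ℕ → ℕ → Set
  Mat m n = Fin m → Fin n → ℚ

  dot : ∀ {n} → Vec n → Vec n → ℚ
  dot u v = ∑ (λ i → u i * v i)

  infixr 8 _∙_
  _∙_ : ∀ {m n} → Mat m n → Vec n → Vec m
  (A ∙ v) x = ∑ (λ y → A x y * v y)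

  infixl 8 _·_
  _·_ : ∀ {l m n} → Mat l m → Mat m n → Mat l n
  (A · B) x z = ∑ (λ y → A x y * B y z)

  _ᵀ : ∀ {m n} → Mat m n → Mat n m
  (A ᵀ) x y = A y x

  ⟪_,_⟫ : ∀ {m n} → Mat m n → Mat m n → ℚ
  ⟪ A , B ⟫ = ∑ (λ x → dot (A x) (B x))

  qf : ∀ {n} → Mat n n → Vec n → ℚ
  qf A v = dot v (A ∙ v)

  Sym PSD : ∀ {n} → Mat n n → Set
  Sym A = ∀ x y → A x y ≡ A y x
  PSD A = ∀ v → 0ℚ ≤ qf A v

  lin : ∀ {n} → ℚ → Vec n → ℚ → Vec n → Vec n
  lin s u t v i = s * u i + t * v i

  dot-cong : ∀ {n} {u u′ v v′ : Vec n} → u ≗ u′ → v ≗ v′ → dot u v ≡ dot u′ v′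
  dot-cong hu hv = ∑-cong (λ i → cong₂ _*_ (hu i) (hv i))

  dot-comm : ∀ {n} (u v : Vec n) → dot u v ≡ dot v u
  dot-comm u v = ∑-cong (λ i → *-comm (u i) (v i))

  dot-linʳ : ∀ {n} (w : Vec n) s u t v → dot w (lin s u t v) ≡ s * dot w u + t * dot w v
  dot-linʳ w s u t v =
    trans (∑-cong (λ i → lem (w i) s (u i) t (v i)))
    (trans (∑-+ (λ i → s * (w i * u i)) (λ i → t * (w i * v i)))
           (cong₂ _+_ (∑-*ˡ s (λ i → w i * u i)) (∑-*ˡ t (λ i → w i * v i))))
    where lem : ∀ w s u t v → w * (s * u + t * v) ≡ s * (w * u) + t * (w * v)
          lem = solve-∀ ℚ-ring

  dot-linˡ : ∀ {n} s u t v (w : Vec n) → dot (lin s u t v) w ≡ s * dot u w + t * dot v w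
  dot-linˡ s u t v w =
    trans (dot-comm (lin s u t v) w) (trans (dot-linʳ w s u t v)
      (cong₂ (λ a b → s * a + t * b) (dot-comm w u) (dot-comm w v)))

  dot-δ : ∀ {n} (i : Fin n) (v : Vec n) → dot (δ i) v ≡ v i
  dot-δ i v = ∑-δ i v

  0≤dot : ∀ {n} (v : Vec n) → 0ℚ ≤ dot v v
  0≤dot v = 0≤∑ (λ i → 0≤sq (v i))

  ∙-cong : ∀ {m n} (A : Mat m n) {u v : Vec n} → u ≗ v → A ∙ u ≗ A ∙ v
  ∙-cong A h x = ∑-cong (λ y → cong (A x y *_) (h y))

  ∙-congˡ : ∀ {m n} {A B : Mat m n} → (∀ x y → A x y ≡ B x y) → (v : Vec n) → A ∙ v ≗ B ∙ v
  ∙-congˡ h v x = ∑-cong (λ y → cong (_* v y) (h x y))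

  ∙-lin : ∀ {m n} (A : Mat m n) s u t v → A ∙ lin s u t v ≗ lin s (A ∙ u) t (A ∙ v)
  ∙-lin A s u t v x = dot-linʳ (A x) s u t v

  ∙-δ : ∀ {m n} (A : Mat m n) j x → (A ∙ δ j) x ≡ A x j
  ∙-δ A j x = trans (dot-comm (A x) (δ j)) (∑-δ j (A x))

  dot-∑ʳ : ∀ {m n} (u : Vec n) (f : Fin n → Fin m → ℚ) →
           dot u (λ x → ∑ (f x)) ≡ ∑ (λ y → dot u (λ x → f x y))
  dot-∑ʳ u f = trans (∑-cong (λ x → sym (∑-*ˡ (u x) (f x)))) (∑-swap (λ x y → u x * f x y))

  dot-adjoint : ∀ {m n} (u : Vec m) (A : Mat m n) (v : Vec n) → dot u (A ∙ v) ≡ dot ((A ᵀ) ∙ u) v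
  dot-adjoint u A v =
    trans (dot-∑ʳ u (λ x y → A x y * v y))
          (∑-cong (λ y → trans (∑-cong (λ x → lem (u x) (A x y) (v y))) (∑-*ʳ (v y) (λ x → A x y * u x))))
    where lem : ∀ u a v → u * (a * v) ≡ a * u * v
          lem = solve-∀ ℚ-ring

  dot-adj : ∀ {n} {A : Mat n n} → Sym A → ∀ u v → dot u (A ∙ v) ≡ dot (A ∙ u) v
  dot-adj {A = A} s u v =
    trans (dot-adjoint u A v) (dot-cong {v = v} (λ x → ∙-congˡ (λ a b → s b a) u x) (λ _ → refl))

  ·-∙ : ∀ {l m n} (A : Mat l m) (B : Mat m n) v → (A · B) ∙ v ≗ A ∙ (B ∙ v)
  ·-∙ A B v x =
    trans (∑-cong (λ z → trans (sym (∑-*ʳ (v z) (λ y → A x y * B y z)))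
                               (∑-cong (λ y → *-assoc (A x y) (B y z) (v z)))))
    (sym (dot-∑ʳ (A x) (λ y z → B y z * v z)))

  qf-cong : ∀ {n} {A B : Mat n n} → (∀ x y → A x y ≡ B x y) → ∀ v → qf A v ≡ qf B v
  qf-cong h v = dot-cong {u = v} (λ _ → refl) (∙-congˡ h v)

  PSD-cong : ∀ {n} {A B : Mat n n} → (∀ x y → A x y ≡ B x y) → PSD A → PSD B
  PSD-cong h p v = subst (0ℚ ≤_) (qf-cong h v) (p v)

  qf-δ : ∀ {n} (A : Mat n n) x → qf A (δ x) ≡ A x x
  qf-δ A x = trans (dot-δ x (A ∙ δ x)) (∙-δ A x x)

  qf-scale : ∀ {n} (A : Mat n n) c v → qf A (λ x → c * v x) ≡ c * c * qf A v
  qf-scale A c v = trans (∑-cong (λ x → trans (cong (c * v x *_) (trans (∑-cong (λ w → lem (A x w) c (v w))) (∑-*ˡ c (λ w → A x w * v w)))) (lem₂ c (v x) ((A ∙ v) x)))) (∑-*ˡ (c * c) (λ x → v x * (A ∙ v) x))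
    where lem : ∀ a i y → a * (i * y) ≡ i * (a * y)
          lem = solve-∀ ℚ-ring
          lem₂ : ∀ i y b → i * y * (i * b) ≡ i * i * (y * b)
          lem₂ = solve-∀ ℚ-ring

  -- The pair (c, -b) gives c (ac - b²) ≥ 0, which settles c > 0. Otherwise c = 0, and the pair (b,
  -- -(a + 1)) gives -(a + 2) b² ≥ 0, so b = 0. Both Cauchy-Schwarz inequalities below, for
  -- semidefinite forms and for `dot`, are instances.
  quad-disc : ∀ {a b c} → (∀ s t → 0ℚ ≤ s * s * a + 2ℚ * (s * t * b) + t * t * c) → b * b ≤ a * c
  quad-disc {a} {b} {c} h with ≤⊎> c 0ℚ
  ... | inj₂ c>0 = cancel-≤ c c>0 (≤-from-diff (subst (0ℚ ≤_) (lem a b c) (h c (- b))))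
    where lem : ∀ a b c → c * c * a + 2ℚ * (c * (- b) * b) + (- b) * (- b) * c ≡ c * (a * c) - c * (b * b)
          lem = solve-∀ ℚ-ring
  ... | inj₁ c≤0 = ≤-trans b²≤0 (0≤* 0≤a 0≤c)
    where
      0≤a : 0ℚ ≤ a
      0≤a = subst (0ℚ ≤_) (lem a b c) (h 1ℚ 0ℚ)
        where lem : ∀ a b c → 1ℚ * 1ℚ * a + 2ℚ * (1ℚ * 0ℚ * b) + 0ℚ * 0ℚ * c ≡ a
              lem = solve-∀ ℚ-ring
      0≤c : 0ℚ ≤ c
      0≤c = subst (0ℚ ≤_) (lem a b c) (h 0ℚ 1ℚ)
        where lem : ∀ a b c → 0ℚ * 0ℚ * a + 2ℚ * (0ℚ * 1ℚ * b) + 1ℚ * 1ℚ * c ≡ c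
              lem = solve-∀ ℚ-ring
      c≡0 : c ≡ 0ℚ
      c≡0 = ≤-antisym c≤0 0≤c
      b²≤0 : b * b ≤ 0ℚ
      b²≤0 = ≤-by (b * b + a * (b * b) + (b * b * a + 2ℚ * (b * - (a + 1ℚ) * b) + - (a + 1ℚ) * - (a + 1ℚ) * 0ℚ))
                  (lem a b)
                  (0≤+ (0≤+ (0≤sq b) (0≤* 0≤a (0≤sq b)))
                       (subst (λ z → 0ℚ ≤ b * b * a + 2ℚ * (b * - (a + 1ℚ) * b) + - (a + 1ℚ) * - (a + 1ℚ) * z)
                              c≡0 (h b (- (a + 1ℚ)))))
        where lem : ∀ a b → b * b + (b * b + a * (b * b) + (b * b * a + 2ℚ * (b * - (a + 1ℚ) * b) + - (a + 1ℚ) * - (a + 1ℚ) * 0ℚ)) ≡ 0ℚ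
              lem = solve-∀ ℚ-ring

  qf-lin : ∀ {n} {A : Mat n n} → Sym A → ∀ s u t v →
           qf A (lin s u t v) ≡ s * s * qf A u + 2ℚ * (s * t * dot u (A ∙ v)) + t * t * qf A v
  qf-lin {A = A} sA s u t v =
    trans (dot-cong {u = lin s u t v} (λ _ → refl) (∙-lin A s u t v))
    (trans (dot-linˡ s u t v (lin s (A ∙ u) t (A ∙ v)))
    (trans (cong₂ (λ a b → s * a + t * b) (dot-linʳ u s (A ∙ u) t (A ∙ v)) (dot-linʳ v s (A ∙ u) t (A ∙ v)))
    (trans (cong (λ z → s * (s * qf A u + t * dot u (A ∙ v)) + t * (s * z + t * qf A v)) vu)
           (lem s t (qf A u) (dot u (A ∙ v)) (qf A v)))))
    where
      vu : dot v (A ∙ u) ≡ dot u (A ∙ v)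
      vu = trans (dot-adj sA v u) (dot-comm (A ∙ v) u)
      lem : ∀ s t a b c → s * (s * a + t * b) + t * (s * b + t * c) ≡ s * s * a + 2ℚ * (s * t * b) + t * t * c
      lem = solve-∀ ℚ-ring

  PSD-CS : ∀ {n} {A : Mat n n} → Sym A → PSD A → ∀ u v →
           dot u (A ∙ v) * dot u (A ∙ v) ≤ qf A u * qf A v
  PSD-CS sA pA u v = quad-disc (λ s t → subst (0ℚ ≤_) (qf-lin sA s u t v) (pA (lin s u t v)))

  dot-CS : ∀ {n} (u v : Vec n) → dot u v * dot u v ≤ dot u u * dot v v
  dot-CS u v = quad-disc (λ s t → subst (0ℚ ≤_) (lem s t) (0≤dot (lin s u t v)))
    where
      lem′ : ∀ s t a b c → s * (s * a + t * b) + t * (s * b + t * c) ≡ s * s * a + 2ℚ * (s * t * b) + t * t * c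
      lem′ = solve-∀ ℚ-ring
      lem : ∀ s t → dot (lin s u t v) (lin s u t v) ≡ s * s * dot u u + 2ℚ * (s * t * dot u v) + t * t * dot v v
      lem s t = trans (dot-linˡ s u t v (lin s u t v))
        (trans (cong₂ (λ a b → s * a + t * b) (dot-linʳ u s u t v) (dot-linʳ v s u t v))
        (trans (cong (λ z → s * (s * dot u u + t * dot u v) + t * (s * z + t * dot v v)) (dot-comm v u))
               (lem′ s t (dot u u) (dot u v) (dot v v))))

  -- Rational Lagrange reduction: a symmetric matrix is a Gram matrix or has a negative vector

  gram : ∀ {n} → List (Vec n) → Mat n n
  gram []       x y = 0ℚ
  gram (l ∷ ls) x y = l x * l y + gram ls x y

  scale : ∀ {n} → Vec n → List ℚ → List (Vec n)
  scale l = map (λ s i → s * l i)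

  sumsq : List ℚ → ℚ
  sumsq []       = 0ℚ
  sumsq (s ∷ ss) = s * s + sumsq ss

  gram-scale : ∀ {n} (l : Vec n) ss x y → gram (scale l ss) x y ≡ sumsq ss * (l x * l y)
  gram-scale l []       x y = sym (*-zeroˡ (l x * l y))
  gram-scale l (s ∷ ss) x y = trans (cong (s * l x * (s * l y) +_) (gram-scale l ss x y)) (lem s (l x) (l y) (sumsq ss))
    where lem : ∀ s a b z → s * a * (s * b) + z * (a * b) ≡ (s * s + z) * (a * b)
          lem = solve-∀ ℚ-ring

  gram-++ : ∀ {n} (ks ls : List (Vec n)) x y → gram (ks ++ ls) x y ≡ gram ks x y + gram ls x y
  gram-++ []       ls x y = sym (+-identityˡ _)
  gram-++ (k ∷ ks) ls x y = trans (cong (k x * k y +_) (gram-++ ks ls x y)) (sym (+-assoc (k x * k y) (gram ks x y) (gram ls x y)))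

  sumsq-replicate : ∀ k s → sumsq (replicate k s) ≡ ι k * (s * s)
  sumsq-replicate zero    s = sym (*-zeroˡ (s * s))
  sumsq-replicate (suc k) s = trans (cong (s * s +_) (sumsq-replicate k s)) (lem (ι k) (s * s))
    where lem : ∀ a b → b + a * b ≡ (1ℚ + a) * b
          lem = solve-∀ ℚ-ring

  positive-fraction : ∀ c → 0ℚ < c → ∃[ N ] ∃[ D ] (0ℚ < ι D × ι D * c ≡ ι N)
  positive-fraction c@(mkℚ (ℤ.+ N) d _) _ = N , suc d , 0<ι {suc d} (ℕ.s≤s ℕ.z≤n) ,
    trans (cong (_* c) (ι≡/1 (suc d))) (trans (toℚᵘ-injective eq) (sym (ι≡/1 N)))
    where
      open ℚᵘₚ.≃-Reasoning
      eq : toℚᵘ (ℤ.+ suc d / 1 * c) ℚᵘ.≃ toℚᵘ (ℤ.+ N / 1)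
      eq = begin
        toℚᵘ (ℤ.+ suc d / 1 * c)                  ≈⟨ toℚᵘ-homo-* (ℤ.+ suc d / 1) c ⟩
        toℚᵘ (ℤ.+ suc d / 1) ℚᵘ.* toℚᵘ c          ≈⟨ ℚᵘₚ.*-congʳ {toℚᵘ c} (toℚᵘ-fromℚᵘ (ℚᵘ.mkℚᵘ (ℤ.+ suc d) 0)) ⟩
        ℚᵘ.mkℚᵘ (ℤ.+ suc d) 0 ℚᵘ.* toℚᵘ c         ≈⟨ ℚᵘ.*≡* (cross N d) ⟩
        ℚᵘ.mkℚᵘ (ℤ.+ N) 0                         ≈⟨ toℚᵘ-fromℚᵘ (ℚᵘ.mkℚᵘ (ℤ.+ N) 0) ⟨
        toℚᵘ (ℤ.+ N / 1)                          ∎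
        where
          cross : ∀ N d → (ℤ.+ suc d ℤ.* ℤ.+ N) ℤ.* ℤ.+ 1 ≡ ℤ.+ N ℤ.* ℤ.+ (1 ℕ.* suc d)
          cross N d = trans (ℤₚ.*-identityʳ _) (trans (ℤₚ.*-comm (ℤ.+ suc d) (ℤ.+ N))
                        (cong (λ z → ℤ.+ N ℤ.* ℤ.+ z) (sym (ℕₚ.*-identityˡ (suc d)))))
  positive-fraction (mkℚ ℤ.-[1+ N ] d _) (Data.Rational.*<* ())

  -- If c = N/D, then c is the sum of ND copies of (1/D)². This replaces the square root of a pivot,
  -- which need not be rational.
  sum-of-squares : ∀ c → 0ℚ < c → ∃[ ss ] (sumsq ss ≡ c)
  sum-of-squares c c>0 with positive-fraction c c>0
  ... | N , D , D>0 , Dc≡N = replicate (N ℕ.* D) (inv (ι D)) ,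
    trans (sumsq-replicate (N ℕ.* D) (inv (ι D)))
    (trans (cong (_* (inv (ι D) * inv (ι D))) (trans (ι-* N D) (cong (_* ι D) (sym Dc≡N))))
    (trans (lem (ι D) c (inv (ι D)))
           (trans (cong (λ z → c * (z * z)) (inv-* D>0)) (lem′ c))))
    where
      lem : ∀ d c i → d * c * d * (i * i) ≡ c * ((d * i) * (d * i))
      lem = solve-∀ ℚ-ring
      lem′ : ∀ c → c * (1ℚ * 1ℚ) ≡ c
      lem′ = solve-∀ ℚ-ring

  qf-suc : ∀ {n} (M : Mat (suc n) (suc n)) → Sym M → ∀ v →
    qf M v ≡ M zero zero * (v zero * v zero) + 2ℚ * (v zero * dot (M zero ∘ suc) (v ∘ suc))
             + qf (λ i j → M (suc i) (suc j)) (v ∘ suc)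
  qf-suc M sM v =
    trans (cong (v zero * (M zero zero * v zero + dot r w) +_)
            (trans (∑-cong (λ i → lem₁ (w i) (M (suc i) zero) (v zero) ((M₁ ∙ w) i)))
            (trans (∑-+ (λ i → v zero * (M (suc i) zero * w i)) (λ i → w i * (M₁ ∙ w) i))
                   (cong (_+ qf M₁ w) (trans (∑-*ˡ (v zero) (λ i → M (suc i) zero * w i))
                      (cong (v zero *_) (∑-cong (λ i → cong (_* w i) (sM (suc i) zero)))))))))
          (lem₂ (v zero) (M zero zero) (dot r w) (qf M₁ w))
    where
      r w : Vec _
      r = M zero ∘ suc
      w = v ∘ suc
      M₁ = λ i j → M (suc i) (suc j)
      lem₁ : ∀ w m v z → w * (m * v + z) ≡ v * (m * w) + w * z
      lem₁ = solve-∀ ℚ-ring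
      lem₂ : ∀ v a d q → v * (a * v + d) + (v * d + q) ≡ a * (v * v) + 2ℚ * (v * d) + q
      lem₂ = solve-∀ ℚ-ring

  -- The list may be longer than the dimension, because one pivot contributes several multiples of
  -- the same row.
  GramOrNegative : ∀ {n} → Mat n n → Set
  GramOrNegative M = (∃[ L ] (∀ x y → gram L x y ≡ M x y)) ⊎ (∃[ v ] (qf M v < 0ℚ))

  extend : ∀ {n} → ℚ → Vec n → Vec (suc n)
  extend a v zero    = a
  extend a v (suc i) = v i

  gram-extend : ∀ {n} (L : List (Vec n)) i j → gram (map (extend 0ℚ) L) (suc i) (suc j) ≡ gram L i j
  gram-extend []      i j = refl
  gram-extend (l ∷ L) i j = cong (l i * l j +_) (gram-extend L i j)

  gram-extend-0ˡ : ∀ {n} (L : List (Vec n)) j → gram (map (extend 0ℚ) L) zero j ≡ 0ℚ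
  gram-extend-0ˡ []      j = refl
  gram-extend-0ˡ (l ∷ L) j = trans (cong₂ _+_ (*-zeroˡ (extend 0ℚ l j)) (gram-extend-0ˡ L j)) (+-identityˡ _)

  gram-sym : ∀ {n} (L : List (Vec n)) → Sym (gram L)
  gram-sym []      x y = refl
  gram-sym (l ∷ L) x y = cong₂ _+_ (*-comm (l x) (l y)) (gram-sym L x y)

  gram-diag : ∀ {n} (L : List (Vec n)) v → 0ℚ ≤ gram L v v
  gram-diag []      v = ≤-refl
  gram-diag (l ∷ L) v = 0≤+ (0≤sq (l v)) (gram-diag L v)

  0<sq : ∀ b → b ≢ 0ℚ → 0ℚ < b * b
  0<sq b b≢0 with <-cmp b 0ℚ
  ... | Relation.Binary.tri≈ _ b≡0 _ = ⊥-elim (b≢0 b≡0)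
  ... | Relation.Binary.tri> _ _ b>0 = 0<* b>0 b>0
  ... | Relation.Binary.tri< b<0 _ _ = subst (0ℚ <_) (lem b) (0<* (neg-antimono-< b<0) (neg-antimono-< b<0))
    where lem : ∀ b → - b * - b ≡ b * b
          lem = solve-∀ ℚ-ring

  module _ {n} (M : Mat (suc n) (suc n)) (sM : Sym M)
           (rec : (N : Mat n n) → Sym N → GramOrNegative N) where

    private
      a : ℚ
      a = M zero zero
      r : Vec n
      r = M zero ∘ suc
      M₁ : Mat n n
      M₁ i j = M (suc i) (suc j)

    reduce-zero : a ≡ 0ℚ → (∀ j → r j ≡ 0ℚ) → GramOrNegative M
    reduce-zero a≡0 r≡0 with rec M₁ (λ i j → sM (suc i) (suc j))
    ... | inj₁ (L , eq) = inj₁ (map (extend 0ℚ) L , eq′)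
      where
        eq′ : ∀ x y → gram (map (extend 0ℚ) L) x y ≡ M x y
        eq′ zero    zero    = trans (gram-extend-0ˡ L zero) (sym a≡0)
        eq′ zero    (suc j) = trans (gram-extend-0ˡ L (suc j)) (sym (r≡0 j))
        eq′ (suc i) zero    = trans (gram-sym (map (extend 0ℚ) L) (suc i) zero)
                                (trans (gram-extend-0ˡ L (suc i)) (sym (trans (sM (suc i) zero) (r≡0 i))))
        eq′ (suc i) (suc j) = trans (gram-extend L i j) (eq i j)
    ... | inj₂ (w , neg) = inj₂ (extend 0ℚ w , subst (_< 0ℚ) (sym (trans (qf-suc M sM (extend 0ℚ w)) (lem a (dot r w) (qf M₁ w)))) neg)
      where lem : ∀ a d q → a * (0ℚ * 0ℚ) + 2ℚ * (0ℚ * d) + q ≡ q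
            lem = solve-∀ ℚ-ring

    -- With a zero pivot the form is linear in the first coordinate. Against the vector b e_j, b = r
    -- j, its slope is 2b², so the value -(c² + 1) outweighs the diagonal term b²c. Completing the
    -- square in 2c² - c + 2 leaves the constant 7/4.
    reduce-isotropic : a ≡ 0ℚ → ∀ j → r j ≢ 0ℚ → GramOrNegative M
    reduce-isotropic a≡0 j rj≢0 = inj₂ (v , subst (_< 0ℚ) (sym val) neg)
      where
        b c θ : ℚ
        b = r j
        c = M₁ j j
        θ = ℤ.+ 7 / 4
        v : Vec (suc n)
        v = extend (- (c * c + 1ℚ)) (λ i → b * δ j i)
        d≡ : dot r (λ i → b * δ j i) ≡ b * b
        d≡ = trans (∑-cong (λ i → lem (r i) b (δ j i))) (trans (∑-*ˡ b (λ i → δ j i * r i)) (cong (b *_) (∑-δ j r)))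
          where lem : ∀ r b d → r * (b * d) ≡ b * (d * r)
                lem = solve-∀ ℚ-ring
        q≡ : qf M₁ (λ i → b * δ j i) ≡ b * b * c
        q≡ = trans (dot-cong {u = λ i → b * δ j i} (λ _ → refl)
                     (λ x → trans (∑-cong (λ y → lem (M₁ x y) b (δ j y))) (trans (∑-*ˡ b (λ y → δ j y * M₁ x y)) (cong (b *_) (∑-δ j (M₁ x))))))
             (trans (∑-cong (λ x → lem′ b (δ j x) (M₁ x j))) (trans (∑-*ˡ (b * b) (λ x → δ j x * M₁ x j)) (cong (b * b *_) (∑-δ j (λ x → M₁ x j)))))
          where lem : ∀ r b d → r * (b * d) ≡ b * (d * r)
                lem = solve-∀ ℚ-ring
                lem′ : ∀ b d m → b * d * (b * m) ≡ b * b * (d * m)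
                lem′ = solve-∀ ℚ-ring
        val : qf M v ≡ - (b * b * (θ + (c * c + (c - ½) * (c - ½))))
        val = trans (qf-suc M sM v) (trans (cong₂ (λ x y → a * (- (c * c + 1ℚ) * - (c * c + 1ℚ)) + 2ℚ * (- (c * c + 1ℚ) * x) + y) d≡ q≡)
                (trans (cong (λ z → z * (- (c * c + 1ℚ) * - (c * c + 1ℚ)) + 2ℚ * (- (c * c + 1ℚ) * (b * b)) + b * b * c) a≡0) (lem b c)))
          where lem : ∀ b c → 0ℚ * (- (c * c + 1ℚ) * - (c * c + 1ℚ)) + 2ℚ * (- (c * c + 1ℚ) * (b * b)) + b * b * c
                              ≡ - (b * b * (θ + (c * c + (c - ½) * (c - ½))))
                lem = solve-∀ ℚ-ring
        neg : - (b * b * (θ + (c * c + (c - ½) * (c - ½)))) < 0ℚ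
        neg = neg-antimono-< (0<* (0<sq b rj≢0) (<-≤-trans (positive⁻¹ θ)
                (≤-by (c * c + (c - ½) * (c - ½)) refl (0≤+ (0≤sq c) (0≤sq (c - ½))))))

    private
      -- The Schur complement of the pivot.
      N : Mat n n
      N i j = M₁ i j - inv a * (r i * r j)

    reduce-pivot-gram : 0ℚ < a → ∀ L → (∀ i j → gram L i j ≡ N i j) → ∀ ss → sumsq ss ≡ inv a →
      ∀ x y → gram (scale (M zero) ss ++ map (extend 0ℚ) L) x y ≡ M x y
    reduce-pivot-gram a>0 L eq ss ss≡ = eq′
      where
        E : Mat (suc n) (suc n)
        E = gram (map (extend 0ℚ) L)
        lem : ∀ x y → gram (scale (M zero) ss ++ map (extend 0ℚ) L) x y ≡ inv a * (M zero x * M zero y) + E x y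
        lem x y = trans (gram-++ (scale (M zero) ss) (map (extend 0ℚ) L) x y)
                    (cong (_+ E x y) (trans (gram-scale (M zero) ss x y) (cong (_* (M zero x * M zero y)) ss≡)))
        row : ∀ y → inv a * (a * M zero y) + E zero y ≡ M zero y
        row y = trans (cong (inv a * (a * M zero y) +_) (gram-extend-0ˡ L y))
                 (trans (lem′ a (inv a) (M zero y)) (trans (cong (_* M zero y) (inv-* a>0)) (*-identityˡ (M zero y))))
          where lem′ : ∀ a i m → i * (a * m) + 0ℚ ≡ a * i * m
                lem′ = solve-∀ ℚ-ring
        eq′ : ∀ x y → gram (scale (M zero) ss ++ map (extend 0ℚ) L) x y ≡ M x y
        eq′ zero    y       = trans (lem zero y) (row y)
        eq′ (suc i) zero    = trans (gram-sym (scale (M zero) ss ++ map (extend 0ℚ) L) (suc i) zero)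
                                (trans (lem zero (suc i)) (trans (row (suc i)) (sM zero (suc i))))
        eq′ (suc i) (suc j) = trans (lem (suc i) (suc j)) (trans (cong (inv a * (r i * r j) +_) (trans (gram-extend L i j) (eq i j)))
                                (lem′ (inv a * (r i * r j)) (M₁ i j)))
          where lem′ : ∀ x m → x + (m - x) ≡ m
                lem′ = solve-∀ ℚ-ring

    -- For given `w` the form is minimal at the first coordinate -⟨r, w⟩/a, and its minimum is the
    -- Schur complement at `w`; so a negative vector lifts.
    reduce-pivot-negative : 0ℚ < a → ∀ w → qf M (extend (- (dot r w * inv a)) w) ≡ qf N w
    reduce-pivot-negative a>0 w = trans (qf-suc M sM v) (trans (lem a (inv a) d (qf M₁ w))
        (trans (cong (λ z → z * (d * inv a * d) + - (2ℚ * (d * inv a * d)) + qf M₁ w) (inv-* a>0)) (trans (lem₂ (inv a) d (qf M₁ w)) (sym qN))))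
      where
        d : ℚ
        d = dot r w
        v : Vec (suc n)
        v = extend (- (d * inv a)) w
        lem : ∀ a i d q → a * (- (d * i) * - (d * i)) + 2ℚ * (- (d * i) * d) + q ≡ a * i * (d * i * d) + - (2ℚ * (d * i * d)) + q
        lem = solve-∀ ℚ-ring
        lem₂ : ∀ i d q → 1ℚ * (d * i * d) + - (2ℚ * (d * i * d)) + q ≡ q - i * (d * d)
        lem₂ = solve-∀ ℚ-ring
        lem₃ : ∀ m i x y w → (m - i * (x * y)) * w ≡ m * w - i * x * (y * w)
        lem₃ = solve-∀ ℚ-ring
        lem₄ : ∀ w m i r d → w * (m - i * r * d) ≡ w * m - i * d * (r * w)
        lem₄ = solve-∀ ℚ-ring
        qN : qf N w ≡ qf M₁ w - inv a * (d * d)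
        qN = trans (dot-cong {u = w} (λ _ → refl) (λ x → trans (∑-cong (λ y → lem₃ (M₁ x y) (inv a) (r x) (r y) (w y)))
                      (trans (∑-- (λ y → M₁ x y * w y) (λ y → inv a * r x * (r y * w y)))
                             (cong (_-_ ((M₁ ∙ w) x)) (∑-*ˡ (inv a * r x) (λ y → r y * w y))))))
               (trans (∑-cong (λ x → lem₄ (w x) ((M₁ ∙ w) x) (inv a) (r x) d))
               (trans (∑-- (λ x → w x * (M₁ ∙ w) x) (λ x → inv a * d * (r x * w x)))
                      (trans (cong (_-_ (qf M₁ w)) (∑-*ˡ (inv a * d) (λ x → r x * w x))) (cong (_-_ (qf M₁ w)) (*-assoc (inv a) d d)))))

    reduce-pivot : 0ℚ < a → GramOrNegative M
    reduce-pivot a>0 = finish (rec N (λ i j → cong₂ (λ x y → x - inv a * y) (sM (suc i) (suc j)) (*-comm (r i) (r j))))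
      where
        ss : ∃[ ss ] (sumsq ss ≡ inv a)
        ss = sum-of-squares (inv a) (0<inv a>0)
        finish : GramOrNegative N → GramOrNegative M
        finish (inj₁ (L , eq))  = inj₁ (scale (M zero) (proj₁ ss) ++ map (extend 0ℚ) L , reduce-pivot-gram a>0 L eq (proj₁ ss) (proj₂ ss))
        finish (inj₂ (w , neg)) = inj₂ (extend (- (dot r w * inv a)) w , subst (_< 0ℚ) (sym (reduce-pivot-negative a>0 w)) neg)

  gram-or-negative : ∀ {n} (M : Mat n n) → Sym M → GramOrNegative M
  gram-or-negative {zero}  M sM = inj₁ ([] , λ ())
  gram-or-negative {suc n} M sM with <-cmp (M zero zero) 0ℚ
  ... | Relation.Binary.tri< a<0 _ _ = inj₂ (δ zero , subst (_< 0ℚ) (sym (qf-δ M zero)) a<0)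
  ... | Relation.Binary.tri> _ _ a>0 = reduce-pivot M sM gram-or-negative a>0
  ... | Relation.Binary.tri≈ _ a≡0 _ with Finₚ.all? (λ j → M zero (suc j) ≟ 0ℚ)
  ...   | yes r≡0 = reduce-zero M sM gram-or-negative a≡0 r≡0
  ...   | no  r≢0 with Finₚ.¬∀⟶∃¬ n (λ j → M zero (suc j) ≡ 0ℚ) (λ j → M zero (suc j) ≟ 0ℚ) r≢0
  ...     | j , rj≢0 = reduce-isotropic M sM gram-or-negative a≡0 j rj≢0

  -- Schur's product theorem and the trace pairing

  PSD⇒gram : ∀ {n} {A : Mat n n} → Sym A → PSD A → ∃[ L ] (∀ x y → gram L x y ≡ A x y)
  PSD⇒gram {A = A} sA pA with gram-or-negative A sA
  ... | inj₁ g         = g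
  ... | inj₂ (v , neg) = ⊥-elim (<⇒¬≤ neg (pA v))

  -- Multiplying B entrywise by a rank one matrix l lᵀ amounts to evaluating its form at the
  -- rescaled vector l x * v x; a Gram matrix is a sum of such terms.
  Schur-gram : ∀ {n} (L : List (Vec n)) {B : Mat n n} → PSD B → PSD (λ x y → gram L x y * B x y)
  Schur-gram []      {B} pB v = ≤-reflexive (sym (∑-zero (λ x →
    trans (cong (v x *_) (∑-zero (λ y → trans (cong (_* v y) (*-zeroˡ (B x y))) (*-zeroˡ (v y))))) (*-zeroʳ (v x)))))
  Schur-gram (l ∷ L) {B} pB v = subst (0ℚ ≤_) (sym eq) (0≤+ (pB (λ x → l x * v x)) (Schur-gram L pB v))
    where
      lem : ∀ lx ly g b v → (lx * ly + g) * b * v ≡ lx * (b * (ly * v)) + g * b * v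
      lem = solve-∀ ℚ-ring
      lem₂ : ∀ v l a b → v * (l * a + b) ≡ l * v * a + v * b
      lem₂ = solve-∀ ℚ-ring
      eq : qf (λ x y → (l x * l y + gram L x y) * B x y) v ≡ qf B (λ x → l x * v x) + qf (λ x y → gram L x y * B x y) v
      eq = trans (∑-cong (λ x → trans (cong (v x *_)
             (trans (∑-cong (λ y → lem (l x) (l y) (gram L x y) (B x y) (v y)))
             (trans (∑-+ (λ y → l x * (B x y * (l y * v y))) (λ y → gram L x y * B x y * v y))
                    (cong (_+ ∑ (λ y → gram L x y * B x y * v y)) (∑-*ˡ (l x) (λ y → B x y * (l y * v y)))))))
             (lem₂ (v x) (l x) (∑ (λ y → B x y * (l y * v y))) (∑ (λ y → gram L x y * B x y * v y)))))
           (∑-+ (λ x → l x * v x * (B ∙ (λ z → l z * v z)) x) (λ x → v x * ∑ (λ y → gram L x y * B x y * v y)))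

  Schur : ∀ {n} {A B : Mat n n} → Sym A → PSD A → PSD B → PSD (λ x y → A x y * B x y)
  Schur {B = B} sA pA pB with PSD⇒gram sA pA
  ... | L , eq = PSD-cong (λ x y → cong (_* B x y) (eq x y)) (Schur-gram L pB)

  -- The pairing is the Schur product evaluated at the all-ones vector. It turns every semidefinite
  -- inequality below into an inequality of traces.
  0≤⟪⟫ : ∀ {n} {A B : Mat n n} → Sym A → PSD A → PSD B → 0ℚ ≤ ⟪ A , B ⟫
  0≤⟪⟫ {A = A} {B} sA pA pB = subst (0ℚ ≤_) eq (Schur sA pA pB (λ _ → 1ℚ))
    where
      eq : qf (λ x y → A x y * B x y) (λ _ → 1ℚ) ≡ ⟪ A , B ⟫
      eq = ∑-cong (λ x → trans (*-identityˡ _) (∑-cong (λ y → *-identityʳ (A x y * B x y))))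

  -- Spectral truncation without a spectrum: if P has eigenvalues q ∈ [0,1] then
  -- K i and R i have eigenvalues 1 - (1-q)^(2^i) and (1-q)^(2^i)

  -1ℚ : ℚ
  -1ℚ = - 1ℚ

  identity : ∀ {n} → Mat n n
  identity = δ

  identity-∙ : ∀ {n} (v : Vec n) → identity ∙ v ≗ v
  identity-∙ v x = ∑-δ x v

  ·-sym : ∀ {n} {A : Mat n n} → Sym A → Sym (A · A)
  ·-sym {A = A} s x z = ∑-cong (λ y → trans (*-comm (A x y) (A y z)) (cong₂ _*_ (s y z) (s x y)))

  module Truncation {n} (P : Mat n n) (sP : Sym P) (pP : PSD P) (P≤1 : ∀ v → qf P v ≤ dot v v) where

    K : ℕ → Mat n n
    K zero    = P
    K (suc i) x y = 2ℚ * K i x y - (K i · K i) x y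

    R : ℕ → Mat n n
    R i x y = δ x y - K i x y

    K-suc : ∀ i v → K (suc i) ∙ v ≗ lin 2ℚ (K i ∙ v) -1ℚ (K i ∙ (K i ∙ v))
    K-suc i v x =
      trans (∑-cong (λ y → lem (K i x y) ((K i · K i) x y) (v y)))
      (trans (∑-+ (λ y → 2ℚ * (K i x y * v y)) (λ y → -1ℚ * ((K i · K i) x y * v y)))
             (cong₂ _+_ (∑-*ˡ 2ℚ (λ y → K i x y * v y))
                        (trans (∑-*ˡ -1ℚ (λ y → (K i · K i) x y * v y)) (cong (-1ℚ *_) (·-∙ (K i) (K i) v x)))))
      where lem : ∀ a b v → (2ℚ * a - b) * v ≡ 2ℚ * (a * v) + -1ℚ * (b * v)
            lem = solve-∀ ℚ-ring

    R-∙ : ∀ i v → R i ∙ v ≗ lin 1ℚ v -1ℚ (K i ∙ v)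
    R-∙ i v x =
      trans (∑-cong (λ y → lem (δ x y) (K i x y) (v y)))
      (trans (∑-+ (λ y → 1ℚ * (δ x y * v y)) (λ y → -1ℚ * (K i x y * v y)))
             (cong₂ _+_ (trans (∑-*ˡ 1ℚ (λ y → δ x y * v y)) (cong (1ℚ *_) (∑-δ x v))) (∑-*ˡ -1ℚ (λ y → K i x y * v y))))
      where lem : ∀ a b v → (a - b) * v ≡ 1ℚ * (a * v) + -1ℚ * (b * v)
            lem = solve-∀ ℚ-ring

    K-sym : ∀ i → Sym (K i)
    K-sym zero    = sP
    K-sym (suc i) x y = cong₂ (λ a b → 2ℚ * a - b) (K-sym i x y) (·-sym (K-sym i) x y)

    R-sym : ∀ i → Sym (R i)
    R-sym i x y = cong₂ _-_ (δ-sym x y) (K-sym i x y)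

    R-suc : ∀ i v → R (suc i) ∙ v ≗ R i ∙ (R i ∙ v)
    R-suc i v x =
      trans (R-∙ (suc i) v x)
      (trans (cong (λ z → 1ℚ * v x + -1ℚ * z) (K-suc i v x))
      (trans (lem (v x) ((K i ∙ v) x) ((K i ∙ (K i ∙ v)) x))
      (sym (trans (R-∙ i (R i ∙ v) x)
           (cong₂ (λ a b → 1ℚ * a + -1ℚ * b) (R-∙ i v x)
                  (trans (∙-cong (K i) (R-∙ i v) x) (∙-lin (K i) 1ℚ v -1ℚ (K i ∙ v) x)))))))
      where lem : ∀ v k l → 1ℚ * v + -1ℚ * (2ℚ * k + -1ℚ * l) ≡ 1ℚ * (1ℚ * v + -1ℚ * k) + -1ℚ * (1ℚ * k + -1ℚ * l)
            lem = solve-∀ ℚ-ring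

    K-P-comm : ∀ i v → K i ∙ (P ∙ v) ≗ P ∙ (K i ∙ v)
    K-P-comm zero    v x = refl
    K-P-comm (suc i) v x =
      trans (K-suc i (P ∙ v) x)
      (trans (cong₂ (λ a b → 2ℚ * a + -1ℚ * b) (K-P-comm i v x)
                    (trans (∙-cong (K i) (K-P-comm i v) x) (K-P-comm i (K i ∙ v) x)))
      (sym (trans (∙-cong P (K-suc i v) x) (∙-lin P 2ℚ (K i ∙ v) -1ℚ (K i ∙ (K i ∙ v)) x))))

    R-P-comm : ∀ i v → R i ∙ (P ∙ v) ≗ P ∙ (R i ∙ v)
    R-P-comm i v x =
      trans (R-∙ i (P ∙ v) x)
      (trans (cong (λ z → 1ℚ * (P ∙ v) x + -1ℚ * z) (K-P-comm i v x))
      (sym (trans (∙-cong P (R-∙ i v) x) (∙-lin P 1ℚ v -1ℚ (K i ∙ v) x))))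

    qf-K-suc : ∀ i v → qf (K (suc i)) v ≡ 2ℚ * qf (K i) v + -1ℚ * dot (K i ∙ v) (K i ∙ v)
    qf-K-suc i v =
      trans (dot-cong {u = v} (λ _ → refl) (K-suc i v))
      (trans (dot-linʳ v 2ℚ (K i ∙ v) -1ℚ (K i ∙ (K i ∙ v)))
             (cong (λ z → 2ℚ * qf (K i) v + -1ℚ * z) (dot-adj (K-sym i) v (K i ∙ v))))

    R-norm : ∀ i v → dot (R i ∙ v) (R i ∙ v) ≡ dot v v - qf (K (suc i)) v
    R-norm i v =
      trans (dot-cong (R-∙ i v) (R-∙ i v))
      (trans (dot-linˡ 1ℚ v -1ℚ (K i ∙ v) (lin 1ℚ v -1ℚ (K i ∙ v)))
      (trans (cong₂ (λ a b → 1ℚ * a + -1ℚ * b) (dot-linʳ v 1ℚ v -1ℚ (K i ∙ v)) (dot-linʳ (K i ∙ v) 1ℚ v -1ℚ (K i ∙ v)))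
      (trans (cong (λ z → 1ℚ * (1ℚ * dot v v + -1ℚ * qf (K i) v) + -1ℚ * (1ℚ * z + -1ℚ * dot (K i ∙ v) (K i ∙ v)))
                   (dot-comm (K i ∙ v) v))
      (trans (lem (dot v v) (qf (K i) v) (dot (K i ∙ v) (K i ∙ v)))
             (cong (_-_ (dot v v)) (sym (qf-K-suc i v)))))))
      where lem : ∀ n a b → 1ℚ * (1ℚ * n + -1ℚ * a) + -1ℚ * (1ℚ * a + -1ℚ * b) ≡ n - (2ℚ * a + -1ℚ * b)
            lem = solve-∀ ℚ-ring

    -- K - K² = K (1-K) K + (1-K) K (1-K).
    K²≤K-from : ∀ i → PSD (K i) → (∀ v → qf (K i) v ≤ dot v v) → ∀ v → dot (K i ∙ v) (K i ∙ v) ≤ qf (K i) v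
    K²≤K-from i pK K≤1 v = ≤-by ((dot k k - qf (K i) k) + qf (K i) (lin 1ℚ v -1ℚ k)) eq
                                (0≤+ (0≤-diff (K≤1 k)) (pK (lin 1ℚ v -1ℚ k)))
      where
        k : Vec n
        k = K i ∙ v
        lem : ∀ a b c → b + ((b - c) + (1ℚ * 1ℚ * a + 2ℚ * (1ℚ * -1ℚ * b) + -1ℚ * -1ℚ * c)) ≡ a
        lem = solve-∀ ℚ-ring
        eq : dot k k + ((dot k k - qf (K i) k) + qf (K i) (lin 1ℚ v -1ℚ k)) ≡ qf (K i) v
        eq = trans (cong (λ z → dot k k + ((dot k k - qf (K i) k) + z))
               (trans (qf-lin (K-sym i) 1ℚ v -1ℚ k)
                      (cong (λ z → 1ℚ * 1ℚ * qf (K i) v + 2ℚ * (1ℚ * -1ℚ * z) + -1ℚ * -1ℚ * qf (K i) k) (dot-adj (K-sym i) v k))))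
               (lem (qf (K i) v) (dot k k) (qf (K i) k))

    K-psd : ∀ i → PSD (K i)
    K≤1   : ∀ i v → qf (K i) v ≤ dot v v
    K²≤K  : ∀ i v → dot (K i ∙ v) (K i ∙ v) ≤ qf (K i) v
    K²≤K i = K²≤K-from i (K-psd i) (K≤1 i)
    K-psd zero    = pP
    K-psd (suc i) v = subst (0ℚ ≤_) (trans (lem (qf (K i) v) (dot (K i ∙ v) (K i ∙ v))) (sym (qf-K-suc i v)))
                            (0≤+ (K-psd i v) (0≤-diff (K²≤K i v)))
      where lem : ∀ a b → a + (a - b) ≡ 2ℚ * a + -1ℚ * b
            lem = solve-∀ ℚ-ring
    K≤1 zero    = P≤1
    K≤1 (suc i) v = ≤-from-diff (subst (0ℚ ≤_) (R-norm i v) (0≤dot (R i ∙ v)))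

    K²≤1 : ∀ i v → dot (K i ∙ v) (K i ∙ v) ≤ dot v v
    K²≤1 i v = ≤-trans (K²≤K i v) (K≤1 i v)

    K≤2^iP : ∀ i v → qf (K i) v ≤ 2ℚ ↑ i * qf P v
    K≤2^iP zero    v = ≤-reflexive (sym (*-identityˡ _))
    K≤2^iP (suc i) v = ≤-trans
      (≤-by (dot (K i ∙ v) (K i ∙ v)) (trans (cong (_+ dot (K i ∙ v) (K i ∙ v)) (qf-K-suc i v)) (lem (qf (K i) v) (dot (K i ∙ v) (K i ∙ v))))
            (0≤dot (K i ∙ v)))
      (subst (2ℚ * qf (K i) v ≤_) (sym (*-assoc 2ℚ (2ℚ ↑ i) (qf P v))) (*-monoˡ 2ℚ 0≤2 (K≤2^iP i v)))
      where lem : ∀ a b → 2ℚ * a + -1ℚ * b + b ≡ 2ℚ * a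
            lem = solve-∀ ℚ-ring

    -- The scalar inequality 2N q (1-q)^(2N) ≤ 1 - (1-q)^(2N).
    tail-decay : ∀ i v → 2ℚ ↑ suc i * qf P (R i ∙ v) + dot (R i ∙ v) (R i ∙ v) ≤ dot v v
    tail-decay zero v = ≤-by (dot p p + 2ℚ * (dot p p - qf P p)) eq (0≤+ (0≤dot p) (0≤* 0≤2 (0≤-diff (P≤1 p))))
      where
        p : Vec n
        p = P ∙ v
        lem : ∀ n a b c → 2ℚ * 1ℚ * (1ℚ * 1ℚ * a + 2ℚ * (1ℚ * -1ℚ * b) + -1ℚ * -1ℚ * c) + (n - (2ℚ * a + -1ℚ * b)) + (b + 2ℚ * (b - c)) ≡ n
        lem = solve-∀ ℚ-ring
        eq : 2ℚ ↑ 1 * qf P (R zero ∙ v) + dot (R zero ∙ v) (R zero ∙ v) + (dot p p + 2ℚ * (dot p p - qf P p)) ≡ dot v v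
        eq = trans (cong₂ (λ a b → 2ℚ * 1ℚ * a + b + (dot p p + 2ℚ * (dot p p - qf P p)))
               (trans (dot-cong (R-∙ zero v) (∙-cong P (R-∙ zero v)))
               (trans (qf-lin sP 1ℚ v -1ℚ p)
                      (cong (λ z → 1ℚ * 1ℚ * qf P v + 2ℚ * (1ℚ * -1ℚ * z) + -1ℚ * -1ℚ * qf P p) (dot-adj sP v p))))
               (trans (R-norm zero v) (cong (_-_ (dot v v)) (qf-K-suc zero v))))
               (lem (dot v v) (qf P v) (dot p p) (qf P p))
    -- Apply the induction hypothesis to w = R v and double it. What remains is 2|w|² - |z|² ≤ |v|²,
    -- and |w|² = ⟨v, z⟩ because R is symmetric.
    tail-decay (suc i) v = ≤-trans (≤-by (2ℚ * (dot w w - (2ℚ ↑ suc i * qf P z + dot z z))) eq₁ (0≤* 0≤2 (0≤-diff (tail-decay i w))))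
                                   (≤-by ((dot v v + dot z z) - (dot v z + dot v z)) eq₂ (0≤-diff (2⟨⟩≤ v z)))
      where
        w z z′ : Vec n
        w  = R i ∙ v
        z  = R i ∙ w
        z′ = R (suc i) ∙ v
        2⟨⟩≤ : ∀ (a b : Vec n) → dot a b + dot a b ≤ dot a a + dot b b
        2⟨⟩≤ a b = subst₂ _≤_ (∑-+ (λ i → a i * b i) (λ i → a i * b i)) (∑-+ (λ i → a i * a i) (λ i → b i * b i)) (∑-mono (λ i → 2ab≤ (a i) (b i)))
        qz : qf P z′ ≡ qf P z
        qz = dot-cong (R-suc i v) (∙-cong P (R-suc i v))
        nz : dot z′ z′ ≡ dot z z
        nz = dot-cong (R-suc i v) (R-suc i v)
        ww : dot w w ≡ dot v z
        ww = sym (dot-adj (R-sym i) v w)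
        lem₁ : ∀ t q n w → 2ℚ * t * q + n + 2ℚ * (w - (t * q + n)) ≡ 2ℚ * w - n
        lem₁ = solve-∀ ℚ-ring
        eq₁ : 2ℚ ↑ suc (suc i) * qf P z′ + dot z′ z′ + 2ℚ * (dot w w - (2ℚ ↑ suc i * qf P z + dot z z)) ≡ 2ℚ * dot w w - dot z z
        eq₁ = trans (cong₂ (λ a b → 2ℚ ↑ suc (suc i) * a + b + 2ℚ * (dot w w - (2ℚ ↑ suc i * qf P z + dot z z))) qz nz)
                    (lem₁ (2ℚ ↑ suc i) (qf P z) (dot z z) (dot w w))
        lem₂ : ∀ a n z → 2ℚ * a - z + ((n + z) - (a + a)) ≡ n
        lem₂ = solve-∀ ℚ-ring
        eq₂ : 2ℚ * dot w w - dot z z + ((dot v v + dot z z) - (dot v z + dot v z)) ≡ dot v v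
        eq₂ = trans (cong (λ a → 2ℚ * a - dot z z + ((dot v v + dot z z) - (dot v z + dot v z))) ww) (lem₂ (dot v z) (dot v v) (dot z z))

  -- One squaring step: Φ ∘ Φ ⪯ M ∘ M, and M ∘ M is M up to a multiple of the identity

  sq-cancel : ∀ {x c} → 0ℚ ≤ x → 0ℚ ≤ c → x * x ≤ c * x → x ≤ c
  sq-cancel {x} {c} 0≤x 0≤c h with ≤⊎> x 0ℚ
  ... | inj₁ x≤0 = ≤-trans x≤0 0≤c
  ... | inj₂ x>0 = cancel-≤ x x>0 (subst (x * x ≤_) (*-comm c x) h)

  inner-gram : ∀ {n r} (B : Mat n r) v → qf (B · (B ᵀ)) v ≡ dot ((B ᵀ) ∙ v) ((B ᵀ) ∙ v)
  inner-gram B v = trans (dot-cong {u = v} (λ _ → refl) (·-∙ B (B ᵀ) v)) (dot-adjoint v B ((B ᵀ) ∙ v))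

  gram-sym′ : ∀ {n r} (B : Mat n r) → Sym (B · (B ᵀ))
  gram-sym′ B x y = dot-comm (B x) (B y)

  ∑-qf : ∀ {n r} (B : Mat n r) (Z : Mat r r) → ∑ (λ x → qf Z (B x)) ≡ ⟪ (B ᵀ) · B , Z ⟫
  ∑-qf {n} {r} B Z =
    trans (∑-swap (λ x k → B x k * (Z ∙ B x) k))
    (∑-cong (λ k → trans (∑-cong (λ x → sym (∑-*ˡ (B x k) (λ l → Z k l * B x l))))
      (trans (∑-swap (λ x l → B x k * (Z k l * B x l)))
        (∑-cong (λ l → trans (∑-cong (λ x → lem (B x k) (Z k l) (B x l))) (∑-*ʳ (Z k l) (λ x → B x k * B x l)))))))
    where lem : ∀ a z b → a * (z * b) ≡ a * b * z
          lem = solve-∀ ℚ-ring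

  bilinear-CS : ∀ {r} (N : Mat r r) (u v : Vec r) → dot u (N ∙ v) * dot u (N ∙ v) ≤ ⟪ N , N ⟫ * (dot u u * dot v v)
  bilinear-CS N u v = ≤-trans (dot-CS u (N ∙ v))
    (subst (dot u u * dot (N ∙ v) (N ∙ v) ≤_) (lem (dot u u) ⟪ N , N ⟫ (dot v v))
      (*-monoˡ (dot u u) (0≤dot u)
        (subst (dot (N ∙ v) (N ∙ v) ≤_) (∑-*ʳ (dot v v) (λ a → dot (N a) (N a))) (∑-mono (λ a → dot-CS (N a) v)))))
    where lem : ∀ a b c → a * (b * c) ≡ b * (a * c)
          lem = solve-∀ ℚ-ring

  module Squaring {n r} (B : Mat n r) (κ : ℚ) (κ>0 : 0ℚ < κ)
                  (M≤κ : ∀ v → qf (B · (B ᵀ)) v ≤ κ * dot v v) where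

    -- `M` acts on vertices, where entrywise products make sense; `M̂` acts on the space of the Gram
    -- vectors, where truncated norms are taken. Their nonzero eigenvalues agree, so both can be
    -- truncated at the same scale.
    M : Mat n n
    M = B · (B ᵀ)
    M̂ : Mat r r
    M̂ = (B ᵀ) · B

    -- For y = Bw one has ⟨y, y⟩² = ⟨w, Bᵀy⟩² ≤ ⟨w, w⟩ ⟨y, My⟩ ≤ κ ⟨w, w⟩ ⟨y, y⟩, and one factor ⟨y,
    -- y⟩ cancels.
    M̂≤κ : ∀ w → qf M̂ w ≤ κ * dot w w
    M̂≤κ w = subst (_≤ κ * dot w w) (sym eq)
              (sq-cancel (0≤dot y) (0≤* (<⇒≤ κ>0) (0≤dot w))
                (≤-trans (subst (λ z → z * z ≤ dot w w * dot ((B ᵀ) ∙ y) ((B ᵀ) ∙ y)) (dot-adjoint w (B ᵀ) y) (dot-CS w ((B ᵀ) ∙ y)))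
                  (subst (dot w w * dot ((B ᵀ) ∙ y) ((B ᵀ) ∙ y) ≤_) (lem (dot w w) κ (dot y y))
                    (*-monoˡ (dot w w) (0≤dot w) (subst (_≤ κ * dot y y) (inner-gram B y) (M≤κ y))))))
      where
        y : Vec n
        y = B ∙ w
        eq : qf M̂ w ≡ dot y y
        eq = inner-gram (B ᵀ) w
        lem : ∀ a k b → a * (k * b) ≡ k * a * b
        lem = solve-∀ ℚ-ring

    κ⁻¹ : ℚ
    κ⁻¹ = inv κ

    normalised : ∀ {m} → Mat m m → Mat m m
    normalised A x y = κ⁻¹ * A x y

    normalised-∙ : ∀ {m} (A : Mat m m) v x → (normalised A ∙ v) x ≡ κ⁻¹ * (A ∙ v) x
    normalised-∙ A v x = trans (∑-cong (λ y → *-assoc κ⁻¹ (A x y) (v y))) (∑-*ˡ κ⁻¹ (λ y → A x y * v y))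

    qf-normalised : ∀ {m} (A : Mat m m) v → qf (normalised A) v ≡ κ⁻¹ * qf A v
    qf-normalised A v = trans (∑-cong (λ x → trans (cong (v x *_) (normalised-∙ A v x)) (lem (v x) κ⁻¹ ((A ∙ v) x)))) (∑-*ˡ κ⁻¹ (λ x → v x * (A ∙ v) x))
      where lem : ∀ a b c → a * (b * c) ≡ b * (a * c)
            lem = solve-∀ ℚ-ring

    normalised-psd : ∀ {m l} (C : Mat m l) → PSD (normalised (C · (C ᵀ)))
    normalised-psd C v = subst (0ℚ ≤_) (sym (trans (qf-normalised (C · (C ᵀ)) v) (cong (κ⁻¹ *_) (inner-gram C v))))
                               (0≤* (0≤inv κ) (0≤dot ((C ᵀ) ∙ v)))

    normalised≤1 : ∀ {m} (A : Mat m m) → (∀ v → qf A v ≤ κ * dot v v) → ∀ v → qf (normalised A) v ≤ dot v v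
    normalised≤1 A h v = subst₂ _≤_ (sym (qf-normalised A v)) (trans (lem κ⁻¹ κ (dot v v)) (trans (cong (_* dot v v) (inv-* κ>0)) (*-identityˡ _)))
                                (*-monoˡ κ⁻¹ (0≤inv κ) (h v))
      where lem : ∀ i k d → i * (k * d) ≡ k * i * d
            lem = solve-∀ ℚ-ring

    module V = Truncation (normalised M) (λ x y → cong (κ⁻¹ *_) (gram-sym′ B x y)) (normalised-psd B) (normalised≤1 M M≤κ)
    module W = Truncation (normalised M̂) (λ x y → cong (κ⁻¹ *_) (gram-sym′ (B ᵀ) x y)) (normalised-psd (B ᵀ)) (normalised≤1 M̂ M̂≤κ)

    -- B p(BᵀB) = p(BBᵀ) B for every polynomial p. This is what carries the truncated trace from the
    -- Gram side to the vertex side.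
    intertwine : ∀ i w → B ∙ (W.K i ∙ w) ≗ V.K i ∙ (B ∙ w)
    intertwine zero w x =
      trans (∙-cong B (λ k → trans (normalised-∙ M̂ w k) (cong (κ⁻¹ *_) (·-∙ (B ᵀ) B w k))) x)
      (trans (∑-cong (λ k → lem (B x k) κ⁻¹ (((B ᵀ) ∙ (B ∙ w)) k)))
      (trans (∑-*ˡ κ⁻¹ (λ k → B x k * ((B ᵀ) ∙ (B ∙ w)) k))
      (sym (trans (normalised-∙ M (B ∙ w) x) (cong (κ⁻¹ *_) (·-∙ B (B ᵀ) (B ∙ w) x))))))
      where lem : ∀ a b c → a * (b * c) ≡ b * (a * c)
            lem = solve-∀ ℚ-ring
    intertwine (suc i) w x =
      trans (∙-cong B (W.K-suc i w) x)
      (trans (∙-lin B 2ℚ (W.K i ∙ w) -1ℚ (W.K i ∙ (W.K i ∙ w)) x)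
      (trans (cong₂ (λ a b → 2ℚ * a + -1ℚ * b) (intertwine i w x)
                (trans (intertwine i (W.K i ∙ w) x) (∙-cong (V.K i) (intertwine i w) x)))
             (sym (V.K-suc i (B ∙ w) x))))

    -- These are the traces of M̂K, M̂K² and K² for K = `W.K i`: the truncated trace, its variant
    -- for the matrix `Φ` below, and a smooth count of the eigenvalues above the threshold.
    f g D : ℕ → ℚ
    f i = ∑ (λ x → qf (W.K i) (B x))
    g i = ∑ (λ x → dot (W.K i ∙ B x) (W.K i ∙ B x))
    D i = ⟪ W.K i , W.K i ⟫

    trM : ℚ
    trM = ∑ (λ x → M x x)

    f-suc : ∀ i → f (suc i) ≡ 2ℚ * f i + -1ℚ * g i
    f-suc i = trans (∑-cong (λ x → W.qf-K-suc i (B x)))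
      (trans (∑-+ (λ x → 2ℚ * qf (W.K i) (B x)) (λ x → -1ℚ * dot (W.K i ∙ B x) (W.K i ∙ B x)))
             (cong₂ _+_ (∑-*ˡ 2ℚ (λ x → qf (W.K i) (B x))) (∑-*ˡ -1ℚ (λ x → dot (W.K i ∙ B x) (W.K i ∙ B x)))))

    f≤trM : ∀ i → f i ≤ trM
    f≤trM i = ∑-mono (λ x → W.K≤1 i (B x))

    0≤f : ∀ i → 0ℚ ≤ f i
    0≤f i = 0≤∑ (λ x → W.K-psd i (B x))

    f-vertex : ∀ i → ⟪ M , V.K i ⟫ ≡ f i
    f-vertex i =
      trans (∑-cong (λ x → trans (∑-cong (λ y → sym (∑-*ʳ (V.K i x y) (λ k → B x k * B y k))))
                                 (trans (∑-swap (λ y k → B x k * B y k * V.K i x y))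
                                        (∑-cong (λ k → trans (∑-cong (λ y → lem (B x k) (B y k) (V.K i x y)))
                                                             (∑-*ˡ (B x k) (λ y → V.K i x y * B y k)))))))
      (∑-cong (λ x → dot-cong {u = B x} (λ _ → refl) (λ k → col x k)))
      where
        lem : ∀ a b c → a * b * c ≡ a * (c * b)
        lem = solve-∀ ℚ-ring
        col : ∀ x k → ∑ (λ y → V.K i x y * B y k) ≡ (W.K i ∙ B x) k
        col x k = trans (∑-cong (λ y → cong (V.K i x y *_) (sym (∙-δ B k y))))
                  (trans (sym (intertwine i (δ k) x))
                  (trans (∑-cong (λ l → trans (cong (B x l *_) (∙-δ (W.K i) k l))
                                              (trans (*-comm (B x l) (W.K i l k)) (cong (_* B x l) (W.K-sym i l k)))))
                         refl))

    -- In the semidefinite order `W.K i` is at most 2^i κ⁻¹ M̂; pair the difference with `W.K i`.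
    -- Each counted eigenvalue is at least about κ/2^i, so the trace limits their number.
    D≤ : ∀ i → D i ≤ 2ℚ ↑ i * κ⁻¹ * f i
    D≤ i = ≤-from-diff (subst (0ℚ ≤_) eq (0≤⟪⟫ (W.K-sym i) (W.K-psd i) psd))
      where
        Z : Mat r r
        Z k l = 2ℚ ↑ i * κ⁻¹ * M̂ k l - W.K i k l
        lem : ∀ t j m k v → (t * j * m - k) * v ≡ t * (j * m * v) + -1ℚ * (k * v)
        lem = solve-∀ ℚ-ring
        Z∙ : ∀ v → Z ∙ v ≗ lin (2ℚ ↑ i) (normalised M̂ ∙ v) -1ℚ (W.K i ∙ v)
        Z∙ v x = trans (∑-cong (λ y → lem (2ℚ ↑ i) κ⁻¹ (M̂ x y) (W.K i x y) (v y)))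
                 (trans (∑-+ (λ y → 2ℚ ↑ i * (κ⁻¹ * M̂ x y * v y)) (λ y → -1ℚ * (W.K i x y * v y)))
                        (cong₂ _+_ (∑-*ˡ (2ℚ ↑ i) (λ y → κ⁻¹ * M̂ x y * v y)) (∑-*ˡ -1ℚ (λ y → W.K i x y * v y))))
        psd : PSD Z
        psd v = subst (0ℚ ≤_) (trans (lem₂ (2ℚ ↑ i * qf (normalised M̂) v) (qf (W.K i) v))
                  (sym (trans (dot-cong {u = v} (λ _ → refl) (Z∙ v)) (dot-linʳ v (2ℚ ↑ i) (normalised M̂ ∙ v) -1ℚ (W.K i ∙ v)))))
                  (0≤-diff (W.K≤2^iP i v))
          where lem₂ : ∀ a b → a - b ≡ a + -1ℚ * b
                lem₂ = solve-∀ ℚ-ring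
        lem₃ : ∀ k t m → k * (t * m - k) ≡ t * (m * k) - k * k
        lem₃ = solve-∀ ℚ-ring
        eq : ⟪ W.K i , Z ⟫ ≡ 2ℚ ↑ i * κ⁻¹ * f i - D i
        eq = trans (∑-cong (λ k → trans (∑-cong (λ l → lem₃ (W.K i k l) (2ℚ ↑ i * κ⁻¹) (M̂ k l)))
                     (trans (∑-- (λ l → 2ℚ ↑ i * κ⁻¹ * (M̂ k l * W.K i k l)) (λ l → W.K i k l * W.K i k l))
                            (cong (_- dot (W.K i k) (W.K i k)) (∑-*ˡ (2ℚ ↑ i * κ⁻¹) (λ l → M̂ k l * W.K i k l))))))
             (trans (∑-- (λ k → 2ℚ ↑ i * κ⁻¹ * dot (M̂ k) (W.K i k)) (λ k → dot (W.K i k) (W.K i k)))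
                    (cong (_- D i) (trans (∑-*ˡ (2ℚ ↑ i * κ⁻¹) (λ k → dot (M̂ k) (W.K i k))) (cong (2ℚ ↑ i * κ⁻¹ *_) (sym (∑-qf B (W.K i)))))))

    trK : ℕ → ℚ
    trK i = ∑ (λ x → V.K i x x)

    trK≤ : ∀ i → trK i ≤ 2ℚ ↑ i * κ⁻¹ * trM
    trK≤ i = subst (trK i ≤_) (∑-*ˡ (2ℚ ↑ i * κ⁻¹) (λ x → M x x))
      (∑-mono (λ x → subst₂ _≤_ (qf-δ (V.K i) x) (trans (cong (2ℚ ↑ i *_) (qf-δ (normalised M) x)) (sym (*-assoc (2ℚ ↑ i) κ⁻¹ (M x x)))) (V.K≤2^iP i (δ x))))

    module Step (c : ℚ) (0≤c : 0ℚ ≤ c)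
                (M∘M≤ : ∀ v → qf (λ x y → M x y * M x y) v ≤ qf M v + c * dot v v)
                (w : Vec n) (w-rows : ∀ x k → w x * B x k ≡ B x k) (i j : ℕ) where

      C : Mat n r
      C x = W.K i ∙ B x

      -- `Φ` is B K² Bᵀ with K = `W.K i`, a truncated M. Using K² instead of K makes it the Gram
      -- matrix of the explicit vectors K b_x, at the price that its trace is `g` and not `f`.
      Φ Y : Mat n n
      Φ = C · (C ᵀ)
      Y x y = Φ x y * Φ x y

      trY : ℚ
      trY = ∑ (λ x → Y x x)

      μ : ℚ
      μ = κ * inv (2ℚ ↑ suc j) + c

      Φ-support : ∀ x → w x * Φ x x ≡ Φ x x
      Φ-support x = trans (sym (∑-*ˡ (w x) (λ k → C x k * C x k)))
        (∑-cong (λ k → trans (sym (*-assoc (w x) (C x k) (C x k))) (cong (_* C x k) (wC k))))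
        where
          lem : ∀ a b c → a * (b * c) ≡ b * (a * c)
          lem = solve-∀ ℚ-ring
          wC : ∀ k → w x * C x k ≡ C x k
          wC k = trans (sym (∑-*ˡ (w x) (λ l → W.K i k l * B x l)))
                       (∑-cong (λ l → trans (lem (w x) (W.K i k l) (B x l)) (cong (W.K i k l *_) (w-rows x l))))

      -- Cauchy-Schwarz on the diagonal of `Φ`. It is supported where `w` is, so the cost is the
      -- weight of `w` and not the number of all vertices.
      g²≤ : g i * g i ≤ dot w w * trY
      g²≤ = subst (λ z → z * z ≤ dot w w * trY) (∑-cong Φ-support) (dot-CS w (λ x → Φ x x))

      C∙ : ∀ v → (C ᵀ) ∙ v ≗ W.K i ∙ ((B ᵀ) ∙ v)
      C∙ v k = trans (∑-cong (λ x → trans (*-comm (C x k) (v x)) (sym (∑-*ˡ (v x) (λ l → W.K i k l * B x l)))))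
               (trans (∑-swap (λ x l → v x * (W.K i k l * B x l)))
                      (∑-cong (λ l → trans (∑-cong (λ x → lem (v x) (W.K i k l) (B x l))) (∑-*ˡ (W.K i k l) (λ x → B x l * v x)))))
        where lem : ∀ v k b → v * (k * b) ≡ k * (b * v)
              lem = solve-∀ ℚ-ring

      Φ-sym : Sym Φ
      Φ-sym = gram-sym′ C

      Φ-psd : PSD Φ
      Φ-psd v = subst (0ℚ ≤_) (sym (inner-gram C v)) (0≤dot ((C ᵀ) ∙ v))

      Φ≤M : ∀ v → qf Φ v ≤ qf M v
      Φ≤M v = subst₂ _≤_ (sym (trans (inner-gram C v) (dot-cong (C∙ v) (C∙ v)))) (sym (inner-gram B v)) (W.K²≤1 i ((B ᵀ) ∙ v))

      combine-∙ : ∀ (A A′ : Mat n n) s t v → (λ x y → s * A x y + t * A′ x y) ∙ v ≗ lin s (A ∙ v) t (A′ ∙ v)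
      combine-∙ A A′ s t v x = trans (∑-cong (λ y → lem s (A x y) t (A′ x y) (v y)))
          (trans (∑-+ (λ y → s * (A x y * v y)) (λ y → t * (A′ x y * v y))) (cong₂ _+_ (∑-*ˡ s (λ y → A x y * v y)) (∑-*ˡ t (λ y → A′ x y * v y))))
        where lem : ∀ s a t b v → (s * a + t * b) * v ≡ s * (a * v) + t * (b * v)
              lem = solve-∀ ℚ-ring

      qf-combine : ∀ (A A′ : Mat n n) s t v → qf (λ x y → s * A x y + t * A′ x y) v ≡ s * qf A v + t * qf A′ v
      qf-combine A A′ s t v = trans (dot-cong {u = v} (λ _ → refl) (combine-∙ A A′ s t v)) (dot-linʳ v s (A ∙ v) t (A′ ∙ v))

      -- M ∘ M - Φ ∘ Φ = (M - Φ) ∘ (M + Φ), a Schur product of semidefinite matrices since K² is at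
      -- most the identity.
      Y≤M∘M : ∀ v → qf Y v ≤ qf (λ x y → M x y * M x y) v
      Y≤M∘M v = ≤-from-diff (subst (0ℚ ≤_) eq (Schur {A = λ x y → 1ℚ * M x y + -1ℚ * Φ x y} {B = λ x y → 1ℚ * M x y + 1ℚ * Φ x y} s₁ p₁ p₂ v))
        where
          s₁ : Sym (λ x y → 1ℚ * M x y + -1ℚ * Φ x y)
          s₁ x y = cong₂ (λ a b → 1ℚ * a + -1ℚ * b) (gram-sym′ B x y) (Φ-sym x y)
          lem : ∀ a b → a - b ≡ 1ℚ * a + -1ℚ * b
          lem = solve-∀ ℚ-ring
          lem′ : ∀ a b → a + b ≡ 1ℚ * a + 1ℚ * b
          lem′ = solve-∀ ℚ-ring
          lem″ : ∀ a b → (1ℚ * a + -1ℚ * b) * (1ℚ * a + 1ℚ * b) ≡ 1ℚ * (a * a) + -1ℚ * (b * b)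
          lem″ = solve-∀ ℚ-ring
          p₁ : PSD (λ x y → 1ℚ * M x y + -1ℚ * Φ x y)
          p₁ u = subst (0ℚ ≤_) (trans (lem (qf M u) (qf Φ u)) (sym (qf-combine M Φ 1ℚ -1ℚ u))) (0≤-diff (Φ≤M u))
          p₂ : PSD (λ x y → 1ℚ * M x y + 1ℚ * Φ x y)
          p₂ u = subst (0ℚ ≤_) (trans (lem′ (qf M u) (qf Φ u)) (sym (qf-combine M Φ 1ℚ 1ℚ u)))
                       (0≤+ (subst (0ℚ ≤_) (sym (inner-gram B u)) (0≤dot ((B ᵀ) ∙ u))) (Φ-psd u))
          eq : qf (λ x y → (1ℚ * M x y + -1ℚ * Φ x y) * (1ℚ * M x y + 1ℚ * Φ x y)) v ≡ qf (λ x y → M x y * M x y) v - qf Y v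
          eq = trans (qf-cong (λ x y → lem″ (M x y) (Φ x y)) v)
               (trans (qf-combine (λ x y → M x y * M x y) Y 1ℚ -1ℚ v) (sym (lem (qf (λ x y → M x y * M x y) v) (qf Y v))))

      K′ R′ : Mat n n
      K′ = V.K (suc j)
      R′ = V.R (suc j)

      -- Y is at most M ∘ M, hence at most M + cI. Paired with `K′`, M gives the truncated trace at
      -- the finer scale: this is the term that makes the inequality self-improving.
      smooth-part : ⟪ K′ , Y ⟫ ≤ f (suc j) + c * trK (suc j)
      smooth-part = ≤-from-diff (subst (0ℚ ≤_) eq (0≤⟪⟫ (V.K-sym (suc j)) (V.K-psd (suc j)) psd))
        where
          Z Z′ : Mat n n
          Z′ x y = 1ℚ * M x y + c * δ x y
          Z x y = 1ℚ * Z′ x y + -1ℚ * Y x y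
          qZ′ : ∀ v → qf Z′ v ≡ 1ℚ * qf M v + c * dot v v
          qZ′ v = trans (qf-combine M δ 1ℚ c v) (cong (λ z → 1ℚ * qf M v + c * z) (dot-cong {u = v} (λ _ → refl) (identity-∙ v)))
          lem : ∀ m d y → m + d - y ≡ 1ℚ * (1ℚ * m + d) + -1ℚ * y
          lem = solve-∀ ℚ-ring
          psd : PSD Z
          psd v = subst (0ℚ ≤_) (trans (lem (qf M v) (c * dot v v) (qf Y v))
                     (sym (trans (qf-combine Z′ Y 1ℚ -1ℚ v) (cong (λ z → 1ℚ * z + -1ℚ * qf Y v) (qZ′ v)))))
                     (0≤-diff (≤-trans (Y≤M∘M v) (M∘M≤ v)))
          lem₂ : ∀ k m c d y → k * (1ℚ * (1ℚ * m + c * d) + -1ℚ * y) ≡ m * k + c * (d * k) - k * y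
          lem₂ = solve-∀ ℚ-ring
          eq : ⟪ K′ , Z ⟫ ≡ f (suc j) + c * trK (suc j) - ⟪ K′ , Y ⟫
          eq = trans (∑-cong (λ x →
                 trans (∑-cong (λ y → lem₂ (K′ x y) (M x y) c (δ x y) (Y x y)))
                 (trans (∑-- (λ y → M x y * K′ x y + c * (δ x y * K′ x y)) (λ y → K′ x y * Y x y))
                 (cong (_- dot (K′ x) (Y x))
                   (trans (∑-+ (λ y → M x y * K′ x y) (λ y → c * (δ x y * K′ x y)))
                          (cong (dot (M x) (K′ x) +_) (trans (∑-*ˡ c (λ y → δ x y * K′ x y)) (cong (c *_) (∑-δ x (K′ x))))))))))
               (trans (∑-- (λ x → dot (M x) (K′ x) + c * K′ x x) (λ x → dot (K′ x) (Y x)))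
               (cong (_- ⟪ K′ , Y ⟫)
                 (trans (∑-+ (λ x → dot (M x) (K′ x)) (λ x → c * K′ x x))
                        (cong₂ _+_ (f-vertex (suc j)) (∑-*ˡ c (λ x → K′ x x))))))

      column : Fin r → Vec r
      column k = W.K i k

      zkl : Fin r → Fin r → Vec n
      zkl k l x = C x k * C x l

      -- With y = R z and s = R y, ⟨y, y⟩ = ⟨s, z⟩ is the bilinear form of N = Σ s_x b_x b_xᵀ at the
      -- columns k and l of `W.K i`. The squared Hilbert-Schmidt norm of N is the form of M ∘ M at
      -- s, at most ⟨s, Ms⟩ + c⟨s, s⟩, and `tail-decay` bounds that by μ⟨y, y⟩.
      rough-bound : ∀ k l → dot (V.R j ∙ zkl k l) (V.R j ∙ zkl k l) ≤ μ * (dot (column k) (column k) * dot (column l) (column l))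
      rough-bound k l = sq-cancel (0≤dot y) (0≤* 0≤μ (0≤* (0≤dot (column k)) (0≤dot (column l))))
        (≤-trans (subst (λ z → z * z ≤ ⟪ N , N ⟫ * (dot (column k) (column k) * dot (column l) (column l))) yy (bilinear-CS N (column k) (column l)))
          (subst (⟪ N , N ⟫ * (dot (column k) (column k) * dot (column l) (column l)) ≤_) (lem μ (dot y y) (dot (column k) (column k) * dot (column l) (column l)))
            (*-monoʳ _ (0≤* (0≤dot (column k)) (0≤dot (column l))) NN≤)))
        where
          y s : Vec n
          y = V.R j ∙ zkl k l
          s = V.R j ∙ y
          N : Mat r r
          N a b = ∑ (λ x → s x * (B x a * B x b))
          lem : ∀ m y q → m * y * q ≡ m * q * y
          lem = solve-∀ ℚ-ring
          0≤2^ : 0ℚ ≤ inv (2ℚ ↑ suc j)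
          0≤2^ = 0≤inv (2ℚ ↑ suc j)
          0≤μ : 0ℚ ≤ μ
          0≤μ = 0≤+ (0≤* (<⇒≤ κ>0) 0≤2^) 0≤c
          lem₁ : ∀ s ba bb u v → u * (s * (ba * bb) * v) ≡ s * ((u * ba) * (v * bb))
          lem₁ = solve-∀ ℚ-ring
          yy : dot (column k) (N ∙ column l) ≡ dot y y
          yy = trans (∑-cong (λ a → trans (cong (column k a *_) (trans (∑-cong (λ b → sym (∑-*ʳ (column l b) (λ x → s x * (B x a * B x b)))))
                                                                        (∑-swap (λ b x → s x * (B x a * B x b) * column l b))))
                                    (trans (sym (∑-*ˡ (column k a) (λ x → ∑ (λ b → s x * (B x a * B x b) * column l b))))
                                           (∑-cong (λ x → trans (sym (∑-*ˡ (column k a) (λ b → s x * (B x a * B x b) * column l b)))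
                                              (trans (∑-cong (λ b → lem₁ (s x) (B x a) (B x b) (column k a) (column l b)))
                                                (trans (∑-*ˡ (s x) (λ b → (column k a * B x a) * (column l b * B x b)))
                                                  (cong (s x *_) (∑-*ˡ (column k a * B x a) (λ b → column l b * B x b))))))))))
               (trans (∑-swap (λ a x → s x * ((column k a * B x a) * C x l)))
               (trans (∑-cong (λ x → trans (∑-*ˡ (s x) (λ a → (column k a * B x a) * C x l)) (cong (s x *_) (∑-*ʳ (C x l) (λ a → column k a * B x a)))))
               (sym (dot-adj (V.R-sym j) y (zkl k l)))))
          lem₂ : ∀ sx sy a b c d → sx * (a * b) * (sy * (c * d)) ≡ sx * ((a * c) * (b * d) * sy)
          lem₂ = solve-∀ ℚ-ring
          NN : ⟪ N , N ⟫ ≡ qf (λ x y → M x y * M x y) s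
          NN = trans (∑-cong (λ a → trans (∑-cong (λ b → expand a b)) (trans (∑-swap (λ b x → ∑ (λ z → s x * ((B x a * B z a) * (B x b * B z b) * s z))))
                        (∑-cong (λ x → ∑-swap (λ b z → s x * ((B x a * B z a) * (B x b * B z b) * s z)))))))
               (trans (∑-swap (λ a x → ∑ (λ z → ∑ (λ b → s x * ((B x a * B z a) * (B x b * B z b) * s z)))))
               (∑-cong (λ x → trans (∑-swap (λ a z → ∑ (λ b → s x * ((B x a * B z a) * (B x b * B z b) * s z))))
                 (trans (∑-cong (λ z → collapse x z)) (∑-*ˡ (s x) (λ z → M x z * M x z * s z))))))
            where
              expand : ∀ a b → N a b * N a b ≡ ∑ (λ x → ∑ (λ z → s x * ((B x a * B z a) * (B x b * B z b) * s z)))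
              expand a b = trans (sym (∑-*ʳ (N a b) (λ x → s x * (B x a * B x b))))
                (∑-cong (λ x → trans (sym (∑-*ˡ (s x * (B x a * B x b)) (λ z → s z * (B z a * B z b))))
                  (∑-cong (λ z → lem₂ (s x) (s z) (B x a) (B x b) (B z a) (B z b)))))
              collapse : ∀ x z → ∑ (λ a → ∑ (λ b → s x * ((B x a * B z a) * (B x b * B z b) * s z))) ≡ s x * (M x z * M x z * s z)
              collapse x z = trans (∑-cong (λ a → trans (∑-*ˡ (s x) (λ b → (B x a * B z a) * (B x b * B z b) * s z))
                  (cong (s x *_) (trans (∑-*ʳ (s z) (λ b → (B x a * B z a) * (B x b * B z b))) (cong (_* s z) (∑-*ˡ (B x a * B z a) (λ b → B x b * B z b)))))))
                (trans (∑-*ˡ (s x) (λ a → B x a * B z a * M x z * s z))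
                  (cong (s x *_) (trans (∑-*ʳ (s z) (λ a → B x a * B z a * M x z)) (cong (_* s z) (∑-*ʳ (M x z) (λ a → B x a * B z a))))))
          decay : 2ℚ ↑ suc j * (κ⁻¹ * qf M s) + dot s s ≤ dot y y
          decay = subst (λ z → 2ℚ ↑ suc j * z + dot s s ≤ dot y y) (qf-normalised M s) (V.tail-decay j y)
          0≤qM : 0ℚ ≤ qf M s
          0≤qM = subst (0ℚ ≤_) (sym (inner-gram B s)) (0≤dot ((B ᵀ) ∙ s))
          0<t : 0ℚ < 2ℚ ↑ suc j
          0<t = 0<↑ (suc j) (positive⁻¹ 2ℚ)
          s≤y : dot s s ≤ dot y y
          s≤y = ≤-trans (≤-by (2ℚ ↑ suc j * (κ⁻¹ * qf M s)) (+-comm (dot s s) _) (0≤* (<⇒≤ 0<t) (0≤* (0≤inv κ) 0≤qM))) decay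
          qM≤ : qf M s ≤ κ * inv (2ℚ ↑ suc j) * dot y y
          qM≤ = subst (_≤ κ * inv (2ℚ ↑ suc j) * dot y y)
                  (trans (lem₃ κ (inv (2ℚ ↑ suc j)) (2ℚ ↑ suc j) κ⁻¹ (qf M s)) (trans (cong₂ (λ a b → a * b * qf M s) (inv-* 0<t) (inv-* κ>0)) (lem₄ (qf M s))))
                  (*-monoˡ (κ * inv (2ℚ ↑ suc j)) (0≤* (<⇒≤ κ>0) 0≤2^)
                    (≤-trans (≤-by (dot s s) refl (0≤dot s)) decay))
            where
              lem₃ : ∀ k j t i q → k * j * (t * (i * q)) ≡ t * j * (k * i) * q
              lem₃ = solve-∀ ℚ-ring
              lem₄ : ∀ q → 1ℚ * 1ℚ * q ≡ q
              lem₄ = solve-∀ ℚ-ring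
          NN≤ : ⟪ N , N ⟫ ≤ μ * dot y y
          NN≤ = subst₂ _≤_ (sym NN) (sym (*-distribʳ-+ (dot y y) (κ * inv (2ℚ ↑ suc j)) c))
                  (≤-trans (M∘M≤ s) (+-mono-≤ qM≤ (*-monoˡ c 0≤c s≤y)))

      -- Y is the sum of the rank one matrices of the `zkl k l`, and R′ is the square of `V.R j`; so
      -- the pairing is the sum of the squared norms just bounded. The sum over pairs (k, l)
      -- produces D², the dimension count for Φ ∘ Φ.
      rough-part : ⟪ R′ , Y ⟫ ≤ μ * (D i * D i)
      rough-part = subst₂ _≤_ (sym lhs) rhs (∑-mono (λ k → ∑-mono (λ l → rough-bound k l)))
        where
          rhs : ∑ (λ k → ∑ (λ l → μ * (dot (column k) (column k) * dot (column l) (column l)))) ≡ μ * (D i * D i)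
          rhs = trans (∑-cong (λ k → trans (∑-*ˡ μ (λ l → dot (column k) (column k) * dot (column l) (column l)))
                                           (cong (μ *_) (∑-*ˡ (dot (column k) (column k)) (λ l → dot (column l) (column l))))))
                (trans (∑-*ˡ μ (λ k → dot (column k) (column k) * D i)) (cong (μ *_) (∑-*ʳ (D i) (λ k → dot (column k) (column k)))))
          lem : ∀ r a b c d → r * ((a * b) * (c * d)) ≡ a * c * (r * (b * d))
          lem = solve-∀ ℚ-ring
          qz : ∀ k l → qf R′ (zkl k l) ≡ dot (V.R j ∙ zkl k l) (V.R j ∙ zkl k l)
          qz k l = trans (dot-cong {u = zkl k l} (λ _ → refl) (V.R-suc j (zkl k l))) (dot-adj (V.R-sym j) (zkl k l) (V.R j ∙ zkl k l))
          expand : ∀ x y → R′ x y * Y x y ≡ ∑ (λ k → ∑ (λ l → zkl k l x * (R′ x y * zkl k l y)))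
          expand x y = trans (cong (R′ x y *_) (trans (sym (∑-*ʳ (Φ x y) (λ k → C x k * C y k)))
                         (∑-cong (λ k → sym (∑-*ˡ (C x k * C y k) (λ l → C x l * C y l))))))
            (trans (sym (∑-*ˡ (R′ x y) (λ k → ∑ (λ l → (C x k * C y k) * (C x l * C y l)))))
            (∑-cong (λ k → trans (sym (∑-*ˡ (R′ x y) (λ l → (C x k * C y k) * (C x l * C y l))))
              (∑-cong (λ l → lem (R′ x y) (C x k) (C y k) (C x l) (C y l))))))
          lhs : ⟪ R′ , Y ⟫ ≡ ∑ (λ k → ∑ (λ l → dot (V.R j ∙ zkl k l) (V.R j ∙ zkl k l)))
          lhs = trans (∑-cong (λ x → trans (∑-cong (expand x)) (trans (∑-swap (λ y k → ∑ (λ l → zkl k l x * (R′ x y * zkl k l y))))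
                    (∑-cong (λ k → trans (∑-swap (λ y l → zkl k l x * (R′ x y * zkl k l y))) (∑-cong (λ l → ∑-*ˡ (zkl k l x) (λ y → R′ x y * zkl k l y))))))))
                (trans (∑-swap (λ x k → ∑ (λ l → zkl k l x * (R′ ∙ zkl k l) x)))
                (∑-cong (λ k → trans (∑-swap (λ x l → zkl k l x * (R′ ∙ zkl k l) x)) (∑-cong (λ l → qz k l)))))

      trY≡ : ⟪ K′ , Y ⟫ + ⟪ R′ , Y ⟫ ≡ trY
      trY≡ = trans (sym (∑-+ (λ x → dot (K′ x) (Y x)) (λ x → dot (R′ x) (Y x))))
        (∑-cong (λ x → trans (sym (∑-+ (λ y → K′ x y * Y x y) (λ y → R′ x y * Y x y)))
          (trans (∑-cong (λ y → lem (K′ x y) (δ x y) (Y x y))) (∑-δ x (Y x)))))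
        where lem : ∀ k d y → k * y + (d - k) * y ≡ d * y
              lem = solve-∀ ℚ-ring

      squaring : g i * g i ≤ dot w w * (f (suc j) + c * trK (suc j) + μ * (D i * D i))
      squaring = ≤-trans g²≤ (*-monoˡ (dot w w) (0≤dot w) (subst (_≤ f (suc j) + c * trK (suc j) + μ * (D i * D i)) trY≡ (+-mono-≤ smooth-part rough-part)))

  -- Subpolynomial growth of the truncated trace

  inv-unique : ∀ {a b} → 0ℚ < a → a * b ≡ 1ℚ → inv a ≡ b
  inv-unique {a} {b} a>0 ab≡1 =
    trans (sym (*-identityʳ (inv a))) (trans (cong (inv a *_) (sym ab≡1))
      (trans (lem a b (inv a)) (trans (cong (_* b) (inv-* a>0)) (*-identityˡ b))))
    where lem : ∀ a b i → i * (a * b) ≡ a * i * b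
          lem = solve-∀ ℚ-ring

  inv-anti : ∀ {a b} → 0ℚ < a → a ≤ b → inv b ≤ inv a
  inv-anti {a} {b} a>0 h = cancel-≤ (a * b) (0<* a>0 b>0)
      (subst₂ _≤_ (trans (sym (*-identityʳ a)) (trans (cong (a *_) (sym (inv-* b>0))) (sym (*-assoc a b (inv b)))))
                  (trans (sym (*-identityʳ b)) (trans (cong (b *_) (sym (inv-* a>0))) (lem b a (inv a)))) h)
    where b>0 = 0<-≤ a>0 h
          lem : ∀ b d i → b * (d * i) ≡ d * b * i
          lem = solve-∀ ℚ-ring

  3/2ℚ 16ℚ 8ℚ 4ℚ 3ℚ ¼ℚ 1/8ℚ 1/16ℚ 1/32ℚ : ℚ
  3/2ℚ = ℤ.+ 3 / 2
  16ℚ  = ℤ.+ 16 / 1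
  8ℚ   = ℤ.+ 8 / 1
  4ℚ   = ℤ.+ 4 / 1
  3ℚ   = ℤ.+ 3 / 1
  ¼ℚ   = ℤ.+ 1 / 4
  1/8ℚ = ℤ.+ 1 / 8
  1/16ℚ = ℤ.+ 1 / 16
  1/32ℚ = ℤ.+ 1 / 32

  0<2 : 0ℚ < 2ℚ
  0<2 = positive⁻¹ 2ℚ

  1≤2 : 1ℚ ≤ 2ℚ
  1≤2 = ≤ᵇ⇒≤ tt

  doubling : ∀ {x y b} → 0ℚ ≤ x → 3/2ℚ * x ≤ y → b < x ↑ 8 → 2ℚ * b < y ↑ 8
  doubling {x} {y} {b} 0≤x h b< = <-≤-trans (*-monoʳ-<-pos 2ℚ {{Data.Rational.positive 0<2}} b<)
    (≤-trans (*-monoʳ (x ↑ 8) (0≤↑ 8 0≤x) (≤ᵇ⇒≤ {2ℚ} {3/2ℚ ↑ 8} tt))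
    (≤-trans (≤-reflexive (sym (↑-*-dist 3/2ℚ x 8))) (↑-mono 8 (0≤* (nonNegative⁻¹ 3/2ℚ) 0≤x) h)))

  squared : ∀ {x y b} → 0ℚ ≤ b → 0ℚ ≤ x → x * x ≤ 16ℚ * y → b < x ↑ 8 → b * b < 16ℚ ↑ 8 * y ↑ 8
  squared {x} {y} {b} 0≤b 0≤x h b< = <-≤-trans lt
    (≤-trans (≤-reflexive (sym (↑-*-dist x x 8)))
    (≤-trans (↑-mono 8 (0≤* 0≤x 0≤x) h) (≤-reflexive (↑-*-dist 16ℚ y 8))))
    where
      0<x8 : 0ℚ < x ↑ 8
      0<x8 = ≤-<-trans 0≤b b<
      lt : b * b < x ↑ 8 * x ↑ 8
      lt = ≤-<-trans (*-monoˡ b 0≤b (<⇒≤ b<)) (*-monoˡ-<-pos (x ↑ 8) {{Data.Rational.positive 0<x8}} b<)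

  -- 16^8 = 2^32, and 32 + (40 + 4) ≤ 2·40 is what the constant 40 has to satisfy.
  exponent-step : ∀ i → 16ℚ ↑ 8 * 2ℚ ↑ (40 ℕ.+ (4 ℕ.+ (i ℕ.+ i))) ≤ 2ℚ ↑ (40 ℕ.+ i) * 2ℚ ↑ (40 ℕ.+ i)
  exponent-step i = subst₂ _≤_ eq₁ (↑-+ 2ℚ (40 ℕ.+ i) (40 ℕ.+ i)) (↑-mono-exp {2ℚ} {32 ℕ.+ (40 ℕ.+ (4 ℕ.+ (i ℕ.+ i)))} {(40 ℕ.+ i) ℕ.+ (40 ℕ.+ i)} 1≤2 le)
    where
      eq₁ : 2ℚ ↑ (32 ℕ.+ (40 ℕ.+ (4 ℕ.+ (i ℕ.+ i)))) ≡ 16ℚ ↑ 8 * 2ℚ ↑ (40 ℕ.+ (4 ℕ.+ (i ℕ.+ i)))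
      eq₁ = trans (↑-+ 2ℚ 32 (40 ℕ.+ (4 ℕ.+ (i ℕ.+ i)))) (cong (_* 2ℚ ↑ (40 ℕ.+ (4 ℕ.+ (i ℕ.+ i)))) (sym (↑-↑ 2ℚ 4 8)))
      le : 32 ℕ.+ (40 ℕ.+ (4 ℕ.+ (i ℕ.+ i))) ℕ.≤ (40 ℕ.+ i) ℕ.+ (40 ℕ.+ i)
      le = subst (76 ℕ.+ (i ℕ.+ i) ℕ.≤_) (eq₂ i) (ℕₚ.+-monoˡ-≤ (i ℕ.+ i) (ℕₚ.m≤m+n 76 4))
        where
          eq₂ : ∀ i → 80 ℕ.+ (i ℕ.+ i) ≡ (40 ℕ.+ i) ℕ.+ (40 ℕ.+ i)
          eq₂ i = trans (ℕₚ.+-assoc 40 40 (i ℕ.+ i)) (trans (cong (40 ℕ.+_) (trans (sym (ℕₚ.+-assoc 40 i i)) (trans (cong (ℕ._+ i) (ℕₚ.+-comm 40 i)) (ℕₚ.+-assoc i 40 i))))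
                    (sym (ℕₚ.+-assoc 40 i (40 ℕ.+ i))))

  -- A violation of the bound at scale i propagates to a larger scale, and F ≤ ℓ rules it out at scale m.
  module Subpolynomial (F : ℕ → ℚ) (ℓ : ℚ) (0≤F : ∀ i → 0ℚ ≤ F i) (F≤ℓ : ∀ i → F i ≤ ℓ)
      (m : ℕ) (ℓ8≤ : ℓ ↑ 8 ≤ 2ℚ ↑ m)
      (step : ∀ i → F (suc i) < 3/2ℚ * F i → 2ℚ ↑ 5 ≤ F i → 2ℚ ↑ i ≤ ℓ ↑ 8 → F i * F i ≤ 16ℚ * F (4 ℕ.+ (i ℕ.+ i))) where

    -- If F grows by 3/2, the violation moves to i + 1, because (3/2)^8 ≥ 2; otherwise the squaring
    -- step moves it to 2i + 4. The scale rises each time, so `fuel` measures the distance left to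
    -- m, where F ≤ ℓ forbids a violation.
    no-violation : ∀ fuel i → m ℕ.≤ i ℕ.+ fuel → ¬ (2ℚ ↑ (40 ℕ.+ i) < F i ↑ 8)
    no-violation fuel i m≤ bad with ≤⊎> (ℓ ↑ 8) (2ℚ ↑ i)
    ... | inj₁ ℓ8≤T = <⇒¬≤ bad (≤-trans (↑-mono 8 (0≤F i) (F≤ℓ i)) (≤-trans ℓ8≤T (↑-mono-exp {2ℚ} {i} {40 ℕ.+ i} 1≤2 (ℕₚ.m≤n+m i 40))))
    no-violation zero i m≤ bad | inj₂ T<ℓ8 =
      <⇒¬≤ T<ℓ8 (≤-trans ℓ8≤ (↑-mono-exp {2ℚ} {m} {i} 1≤2 (subst (m ℕ.≤_) (ℕₚ.+-identityʳ i) m≤)))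
    no-violation (suc fuel) i m≤ bad | inj₂ T<ℓ8 with ≤⊎> (3/2ℚ * F i) (F (suc i))
    ... | inj₁ grows = no-violation fuel (suc i) (subst (m ℕ.≤_) (ℕₚ.+-suc i fuel) m≤)
            (subst (_< F (suc i) ↑ 8) (cong (2ℚ ↑_) (sym (ℕₚ.+-suc 40 i))) (doubling {F i} {F (suc i)} {2ℚ ↑ (40 ℕ.+ i)} (0≤F i) grows bad))
    ... | inj₂ slow = no-violation fuel (4 ℕ.+ (i ℕ.+ i)) (ℕₚ.≤-trans m≤ le) bad′
      where
        32≤F : 2ℚ ↑ 5 ≤ F i
        32≤F = ↑-cancel-≤ {2ℚ ↑ 5} {F i} 7 (0≤F i) (≤-trans {(2ℚ ↑ 5) ↑ 8} {2ℚ ↑ 40} {F i ↑ 8} (≤-reflexive (↑-↑ 2ℚ 5 8))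
                 (≤-trans {2ℚ ↑ 40} {2ℚ ↑ (40 ℕ.+ i)} {F i ↑ 8} (↑-mono-exp {2ℚ} {40} {40 ℕ.+ i} 1≤2 (ℕₚ.m≤m+n 40 i)) (<⇒≤ bad)))
        le : i ℕ.+ suc fuel ℕ.≤ 4 ℕ.+ (i ℕ.+ i) ℕ.+ fuel
        le = subst (ℕ._≤ 4 ℕ.+ (i ℕ.+ i) ℕ.+ fuel) (sym (ℕₚ.+-suc i fuel))
               (ℕₚ.+-monoˡ-≤ fuel (ℕ.s≤s (ℕₚ.≤-trans (ℕₚ.m≤m+n i i) (ℕₚ.m≤n+m (i ℕ.+ i) 3))))
        bad′ : 2ℚ ↑ (40 ℕ.+ (4 ℕ.+ (i ℕ.+ i))) < F (4 ℕ.+ (i ℕ.+ i)) ↑ 8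
        bad′ = *-cancelˡ-<-nonNeg (16ℚ ↑ 8) {{Data.Rational.nonNegative (0≤↑ {16ℚ} 8 (nonNegative⁻¹ 16ℚ))}} {2ℚ ↑ (40 ℕ.+ (4 ℕ.+ (i ℕ.+ i)))} {F (4 ℕ.+ (i ℕ.+ i)) ↑ 8}
                 (≤-<-trans (exponent-step i) (squared {F i} {F (4 ℕ.+ (i ℕ.+ i))} {2ℚ ↑ (40 ℕ.+ i)} (0≤↑ (40 ℕ.+ i) 0≤2) (0≤F i) (step i slow 32≤F (<⇒≤ T<ℓ8)) bad))

    -- At multiples of 8 the eighth root of 2^(40 + 8j) is a rational number.
    bound : ∀ j → F (8 ℕ.* j) ≤ 2ℚ ↑ (5 ℕ.+ j)
    bound j with ≤⊎> (F (8 ℕ.* j) ↑ 8) (2ℚ ↑ (40 ℕ.+ 8 ℕ.* j))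
    ... | inj₂ bad = ⊥-elim (no-violation m (8 ℕ.* j) (ℕₚ.m≤n+m m (8 ℕ.* j)) bad)
    ... | inj₁ ok  = ↑-cancel-≤ {F (8 ℕ.* j)} {2ℚ ↑ (5 ℕ.+ j)} 7 (0≤↑ (5 ℕ.+ j) 0≤2)
                       (≤-trans ok (≤-reflexive (trans (cong (2ℚ ↑_) (sym (ℕₚ.*-distribˡ-+ 8 5 j))) (sym (↑-↑ 2ℚ (5 ℕ.+ j) 8)))))

  -- After the lower order terms are absorbed, F² ≤ 4(Fj + 1 + F²/16). The last term takes F²/4, and
  -- F² ≥ 8 lets the constant 4 take F²/2; what is left is F²/4 ≤ 4Fj.
  good-scale-arith : ∀ {u F² Fj c ℓ X} → 0ℚ < u → 0ℚ ≤ F² →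
    u * u * F² ≤ 4ℚ * (u * (u * Fj + 8ℚ * (c * ℓ * X) + (1/32ℚ * (u * F²) + ¼ℚ * (c * X * F²)))) →
    8ℚ * (c * ℓ * X) ≤ u → 8ℚ * (c * X) ≤ u → 8ℚ ≤ F² → F² ≤ 16ℚ * Fj
  good-scale-arith {u} {F²} {Fj} {c} {ℓ} {X} u>0 0≤F² h ha hb hd =
    ≤-by (4ℚ * (4ℚ * (Fj + 1ℚ + 1/16ℚ * F²) - F²) + 2ℚ * (F² - 8ℚ)) (lem₃ F² Fj)
         (0≤+ (0≤* (nonNegative⁻¹ 4ℚ) (0≤-diff s₂)) (0≤* 0≤2 (0≤-diff hd)))
    where
      lem₃ : ∀ f j → f + (4ℚ * (4ℚ * (j + 1ℚ + 1/16ℚ * f) - f) + 2ℚ * (f - 8ℚ)) ≡ 16ℚ * j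
      lem₃ = solve-∀ ℚ-ring
      lem₁ : ∀ u f j c l x → u * j + 8ℚ * (c * l * x) + (1/32ℚ * (u * f) + ¼ℚ * (c * x * f))
               + ((u - 8ℚ * (c * l * x)) + 1/32ℚ * (f * (u - 8ℚ * (c * x)))) ≡ u * (j + 1ℚ + 1/16ℚ * f)
      lem₁ = solve-∀ ℚ-ring
      s₁ : u * Fj + 8ℚ * (c * ℓ * X) + (1/32ℚ * (u * F²) + ¼ℚ * (c * X * F²)) ≤ u * (Fj + 1ℚ + 1/16ℚ * F²)
      s₁ = ≤-by ((u - 8ℚ * (c * ℓ * X)) + 1/32ℚ * (F² * (u - 8ℚ * (c * X)))) (lem₁ u F² Fj c ℓ X)
                (0≤+ (0≤-diff ha) (0≤* (nonNegative⁻¹ 1/32ℚ) (0≤* 0≤F² (0≤-diff hb))))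
      lem₂ : ∀ u z → 4ℚ * (u * (u * z)) ≡ u * u * (4ℚ * z)
      lem₂ = solve-∀ ℚ-ring
      s₂ : F² ≤ 4ℚ * (Fj + 1ℚ + 1/16ℚ * F²)
      s₂ = cancel-≤ (u * u) (0<* u>0 u>0) (≤-trans h (subst (4ℚ * (u * (u * Fj + 8ℚ * (c * ℓ * X) + (1/32ℚ * (u * F²) + ¼ℚ * (c * X * F²)))) ≤_)
             (lem₂ u (Fj + 1ℚ + 1/16ℚ * F²)) (*-monoˡ 4ℚ (nonNegative⁻¹ 4ℚ) (*-monoˡ u (<⇒≤ u>0) s₁))))

  module Growth {n r} (B : Mat n r) (u ℓ : ℚ) (u>0 : 0ℚ < u) (1≤ℓ : 1ℚ ≤ ℓ)
                (M≤2u : ∀ v → qf (B · (B ᵀ)) v ≤ 2ℚ * u * dot v v)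
                (M∘M≤ : ∀ v → qf (λ x y → (B · (B ᵀ)) x y * (B · (B ᵀ)) x y) v ≤ qf (B · (B ᵀ)) v + ℓ * ℓ * dot v v)
                (w : Vec n) (w-rows : ∀ x k → w x * B x k ≡ B x k) (ww≡u : dot w w ≡ u)
                (trM≤ : ∑ (λ x → (B · (B ᵀ)) x x) ≤ ℓ * u)
                (u-large : 8ℚ * ℓ ↑ 19 ≤ u) (m : ℕ) (ℓ8≤ : ℓ ↑ 8 ≤ 2ℚ ↑ m) where

    2u>0 : 0ℚ < 2ℚ * u
    2u>0 = 0<* 0<2 u>0

    open Squaring B (2ℚ * u) 2u>0 M≤2u public

    u⁻¹ : ℚ
    u⁻¹ = inv u

    F : ℕ → ℚ
    F i = u⁻¹ * f i

    0≤ℓ : 0ℚ ≤ ℓ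
    0≤ℓ = ≤-trans 0≤1 1≤ℓ

    uF : ∀ i → u * F i ≡ f i
    uF i = trans (sym (*-assoc u u⁻¹ (f i))) (trans (cong (_* f i) (inv-* u>0)) (*-identityˡ (f i)))

    0≤F : ∀ i → 0ℚ ≤ F i
    0≤F i = 0≤* (0≤inv u) (0≤f i)

    F≤ℓ : ∀ i → F i ≤ ℓ
    F≤ℓ i = cancel-≤ u u>0 (subst₂ _≤_ (sym (uF i)) (*-comm ℓ u) (≤-trans (f≤trM i) trM≤))

    uκ⁻¹ : u * κ⁻¹ ≡ ½
    uκ⁻¹ = trans (cong (u *_) (inv-unique 2u>0 eq)) (trans (lem u u⁻¹) (trans (cong (½ *_) (inv-* u>0)) refl))
      where
        lem₀ : ∀ u i → 2ℚ * u * (½ * i) ≡ u * i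
        lem₀ = solve-∀ ℚ-ring
        eq : 2ℚ * u * (½ * u⁻¹) ≡ 1ℚ
        eq = trans (lem₀ u u⁻¹) (inv-* u>0)
        lem : ∀ u i → u * (½ * i) ≡ ½ * (u * i)
        lem = solve-∀ ℚ-ring

    module GoodScale (i : ℕ) (F≤2G : F i ≤ 2ℚ * (u⁻¹ * g i)) (32≤F : 2ℚ ↑ 5 ≤ F i) (T≤ : 2ℚ ↑ i ≤ ℓ ↑ 8) where
      private
        j j₀ : ℕ
        -- With 2^j = 16 · 4^i the main rough contribution 2u · 2^(-j) · D² is at most uF²/32, small
        -- enough to be moved to the left-hand side.
        j  = 4 ℕ.+ (i ℕ.+ i)
        j₀ = 3 ℕ.+ (i ℕ.+ i)
        c T X e : ℚ
        c = ℓ * ℓ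
        T = 2ℚ ↑ i
        X = T * T
        e = inv (2ℚ ↑ j)

      open Step c (0≤sq ℓ) M∘M≤ w w-rows i j₀ using (squaring)

      0≤T : 0ℚ ≤ T
      0≤T = 0≤↑ i 0≤2

      2↑j≡ : 2ℚ ↑ j ≡ 16ℚ * X
      2↑j≡ = trans (↑-+ 2ℚ 4 (i ℕ.+ i)) (cong (16ℚ *_) (↑-+ 2ℚ i i))

      eX : e * X ≡ 1/16ℚ
      eX = trans (lem e X) (trans (cong (1/16ℚ *_) (trans (cong (_* e) (sym 2↑j≡)) (inv-* (0<↑ j 0<2)))) refl)
        where lem : ∀ e x → e * x ≡ 1/16ℚ * (16ℚ * x * e)
              lem = solve-∀ ℚ-ring

      f≤2g : f i ≤ 2ℚ * g i
      f≤2g = subst₂ _≤_ (uF i) (trans (lem u u⁻¹ (g i)) (trans (cong (λ z → 2ℚ * (z * g i)) (inv-* u>0)) (cong (2ℚ *_) (*-identityˡ (g i)))))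
               (*-monoˡ u (<⇒≤ u>0) F≤2G)
        where lem : ∀ u v g → u * (2ℚ * (v * g)) ≡ 2ℚ * (u * v * g)
              lem = solve-∀ ℚ-ring

      trK-bound : trK j ≤ 8ℚ * (ℓ * X)
      trK-bound = ≤-trans (trK≤ j) (subst (2ℚ ↑ j * κ⁻¹ * trM ≤_) eq (*-monoˡ (2ℚ ↑ j * κ⁻¹) (0≤* (0≤↑ j 0≤2) (0≤inv (2ℚ * u))) trM≤))
        where
          lem : ∀ k l u x → 16ℚ * x * k * (l * u) ≡ 16ℚ * (x * l) * (u * k)
          lem = solve-∀ ℚ-ring
          lem′ : ∀ l x → 16ℚ * (x * l) * ½ ≡ 8ℚ * (l * x)
          lem′ = solve-∀ ℚ-ring
          eq : 2ℚ ↑ j * κ⁻¹ * (ℓ * u) ≡ 8ℚ * (ℓ * X)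
          eq = trans (cong (λ z → z * κ⁻¹ * (ℓ * u)) 2↑j≡) (trans (lem κ⁻¹ ℓ u X) (trans (cong (16ℚ * (X * ℓ) *_) uκ⁻¹) (lem′ ℓ X)))

      0≤D : 0ℚ ≤ D i
      0≤D = 0≤∑ (λ k → 0≤dot (W.K i k))

      D-bound : D i * D i ≤ ¼ℚ * (X * (F i * F i))
      D-bound = subst (D i * D i ≤_) (lem T (F i)) (*-mono 0≤D 0≤b D≤b D≤b)
        where
          lem : ∀ t f → ½ * (t * f) * (½ * (t * f)) ≡ ¼ℚ * (t * t * (f * f))
          lem = solve-∀ ℚ-ring
          0≤b : 0ℚ ≤ ½ * (T * F i)
          0≤b = 0≤* 0≤½ (0≤* 0≤T (0≤F i))
          lem₂ : ∀ t k u f → t * k * (u * f) ≡ (u * k) * (t * f)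
          lem₂ = solve-∀ ℚ-ring
          D≤b : D i ≤ ½ * (T * F i)
          D≤b = subst (D i ≤_) (trans (cong (T * κ⁻¹ *_) (sym (uF i))) (trans (lem₂ T κ⁻¹ u (F i)) (cong (_* (T * F i)) uκ⁻¹))) (D≤ i)

      main : u * u * (F i * F i) ≤ 4ℚ * (u * (u * F j + 8ℚ * (c * ℓ * X) + (1/32ℚ * (u * (F i * F i)) + ¼ℚ * (c * X * (F i * F i)))))
      main = ≤-trans
        (subst₂ _≤_ (trans (cong₂ _*_ (sym (uF i)) (sym (uF i))) (lem u (F i))) (lem′ (g i)) (*-mono (0≤f i) (≤-trans (0≤f i) f≤2g) f≤2g f≤2g))
        (*-monoˡ 4ℚ (nonNegative⁻¹ 4ℚ) (≤-trans (subst (λ z → g i * g i ≤ z * (f j + c * trK j + (2ℚ * u * e + c) * (D i * D i))) ww≡u squaring)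
          (*-monoˡ u (<⇒≤ u>0) (+-mono-≤ (+-mono-≤ (≤-reflexive (sym (uF j))) t₁) t₂))))
        where
          lem : ∀ u f → u * f * (u * f) ≡ u * u * (f * f)
          lem = solve-∀ ℚ-ring
          lem′ : ∀ g → 2ℚ * g * (2ℚ * g) ≡ 4ℚ * (g * g)
          lem′ = solve-∀ ℚ-ring
          lem₁ : ∀ c l x → c * (8ℚ * (l * x)) ≡ 8ℚ * (c * l * x)
          lem₁ = solve-∀ ℚ-ring
          t₁ : c * trK j ≤ 8ℚ * (c * ℓ * X)
          t₁ = subst (c * trK j ≤_) (lem₁ c ℓ X) (*-monoˡ c (0≤sq ℓ) trK-bound)
          lem₂ : ∀ u e c x f → (2ℚ * u * e + c) * (¼ℚ * (x * f)) ≡ ½ * (e * x * (u * f)) + ¼ℚ * (c * x * f)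
          lem₂ = solve-∀ ℚ-ring
          lem₃ : ∀ z → ½ * (1/16ℚ * z) ≡ 1/32ℚ * z
          lem₃ = solve-∀ ℚ-ring
          t₂ : (2ℚ * u * e + c) * (D i * D i) ≤ 1/32ℚ * (u * (F i * F i)) + ¼ℚ * (c * X * (F i * F i))
          t₂ = subst ((2ℚ * u * e + c) * (D i * D i) ≤_)
                 (trans (lem₂ u e c X (F i * F i)) (cong (_+ ¼ℚ * (c * X * (F i * F i))) (trans (cong (λ z → ½ * (z * (u * (F i * F i)))) eX) (lem₃ (u * (F i * F i))))))
                 (*-monoˡ (2ℚ * u * e + c) (0≤+ (0≤* (<⇒≤ 2u>0) (0≤inv (2ℚ ↑ j))) (0≤sq ℓ)) D-bound)

      -- Here cℓ = ℓ³ and X = 4^i ≤ ℓ^16, whence the exponent 19.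
      8cℓX≤u : 8ℚ * (c * ℓ * X) ≤ u
      8cℓX≤u = ≤-trans (subst (8ℚ * (c * ℓ * X) ≤_) (cong (8ℚ *_) (trans (lem ℓ (ℓ ↑ 8)) (trans (cong (ℓ ↑ 3 *_) (sym (↑-+ ℓ 8 8))) (sym (↑-+ ℓ 3 16)))))
                   (*-monoˡ 8ℚ (nonNegative⁻¹ 8ℚ) (*-monoˡ (c * ℓ) (0≤* (0≤sq ℓ) 0≤ℓ) (*-mono 0≤T (0≤↑ 8 0≤ℓ) T≤ T≤)))) u-large
        where lem : ∀ l z → l * l * l * (z * z) ≡ l * (l * (l * 1ℚ)) * (z * z)
              lem = solve-∀ ℚ-ring

      8cX≤u : 8ℚ * (c * X) ≤ u
      8cX≤u = ≤-trans (*-monoˡ 8ℚ (nonNegative⁻¹ 8ℚ) (*-monoʳ X (0≤* 0≤T 0≤T) (subst (_≤ c * ℓ) (*-identityʳ c) (*-monoˡ c (0≤sq ℓ) 1≤ℓ)))) 8cℓX≤u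

      F²≤16Fj : F i * F i ≤ 16ℚ * F j
      F²≤16Fj = good-scale-arith {u} {F i * F i} {F j} {c} {ℓ} {X} u>0 (0≤sq (F i)) main 8cℓX≤u 8cX≤u
        (≤-trans (≤ᵇ⇒≤ {8ℚ} {2ℚ ↑ 5 * 2ℚ ↑ 5} tt) (*-mono (0≤↑ 5 0≤2) (0≤F i) 32≤F 32≤F))

    -- The squaring inequality controls g, which can be far below f when many eigenvalues lie under
    -- the threshold. Since f at the next scale is 2f - g, slow growth forces g ≥ f/2; fast growth
    -- is progress by itself.
    step : ∀ i → F (suc i) < 3/2ℚ * F i → 2ℚ ↑ 5 ≤ F i → 2ℚ ↑ i ≤ ℓ ↑ 8 → F i * F i ≤ 16ℚ * F (4 ℕ.+ (i ℕ.+ i))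
    step i slow 32≤F = GoodScale.F²≤16Fj i F≤2G 32≤F
      where
        lem : ∀ f g v → v * (2ℚ * f + -1ℚ * g) ≡ 2ℚ * (v * f) + -1ℚ * (v * g)
        lem = solve-∀ ℚ-ring
        lem₂ : ∀ f g → 3/2ℚ * f - (2ℚ * f + -1ℚ * g) ≡ g - ½ * f
        lem₂ = solve-∀ ℚ-ring
        ½F≤G : ½ * F i ≤ u⁻¹ * g i
        ½F≤G = ≤-from-diff (subst (0ℚ ≤_) (trans (cong (_-_ (3/2ℚ * F i)) (trans (cong (u⁻¹ *_) (f-suc i)) (lem (f i) (g i) u⁻¹))) (lem₂ (F i) (u⁻¹ * g i)))
                  (0≤-diff (<⇒≤ slow)))
        lem₃ : ∀ f → 2ℚ * (½ * f) ≡ f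
        lem₃ = solve-∀ ℚ-ring
        F≤2G : F i ≤ 2ℚ * (u⁻¹ * g i)
        F≤2G = subst (_≤ 2ℚ * (u⁻¹ * g i)) (lem₃ (F i)) (*-monoˡ 2ℚ 0≤2 ½F≤G)

    open Subpolynomial F ℓ 0≤F F≤ℓ m ℓ8≤ step public renaming (bound to F-bound) using ()

  -- Dispersion of neighbourhoods

  𝟙 : Bool → ℚ
  𝟙 true  = 1ℚ
  𝟙 false = 0ℚ

  0≤𝟙 : ∀ b → 0ℚ ≤ 𝟙 b
  0≤𝟙 true  = 0≤1
  0≤𝟙 false = ≤-refl

  𝟙≤1 : ∀ b → 𝟙 b ≤ 1ℚ
  𝟙≤1 true  = ≤-refl
  𝟙≤1 false = 0≤1

  𝟙² : ∀ b → 𝟙 b * 𝟙 b ≡ 𝟙 b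
  𝟙² true  = *-identityˡ 1ℚ
  𝟙² false = *-zeroˡ 0ℚ

  module Dispersion {n r} (B : Mat n r) (U : Fin n → Bool) (a : Mat n n) (u ℓ : ℚ)
      (a-sym : Sym a) (a² : ∀ x y → a x y * a x y ≡ a x y) (a-diag : ∀ x → a x x ≡ 0ℚ) (a-row : ∀ x y → 𝟙 (U x) * a x y ≡ a x y)
      (a≤1 : ∀ x y → a x y ≤ 1ℚ)
      (B-gram : ∀ x y → (B · (B ᵀ)) x y ≡ a x y + ℓ * (𝟙 (U x) * δ x y)) (B-row : ∀ x k → 𝟙 (U x) * B x k ≡ B x k)
      (u-def : ∑ (λ x → 𝟙 (U x)) ≡ u) (u>0 : 0ℚ < u) (1≤ℓ : 1ℚ ≤ ℓ) (u-large : 8ℚ * ℓ ↑ 19 ≤ u)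
      (m : ℕ) (ℓ8≤ : ℓ ↑ 8 ≤ 2ℚ ↑ m) where

    private
      w 𝟏 d : Vec n
      w x = 𝟙 (U x)
      𝟏 _ = 1ℚ
      d x = ∑ (a x)
      0≤ℓ : 0ℚ ≤ ℓ
      0≤ℓ = ≤-trans 0≤1 1≤ℓ

    0≤a : ∀ x y → 0ℚ ≤ a x y
    0≤a x y = subst (0ℚ ≤_) (a² x y) (0≤sq (a x y))

    a-col : ∀ x y → a x y * w y ≡ a x y
    a-col x y = trans (*-comm (a x y) (w y)) (trans (cong (w y *_) (a-sym x y)) (trans (a-row y x) (a-sym y x)))

    a≤w : ∀ x y → a x y ≤ w y
    a≤w x y = subst₂ _≤_ (a-col x y) (*-identityˡ (w y)) (*-monoʳ (w y) (0≤𝟙 (U y)) (a≤1 x y))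

    d≤u : ∀ x → d x ≤ u
    d≤u x = subst (d x ≤_) u-def (∑-mono (a≤w x))

    ww≡u : dot w w ≡ u
    ww≡u = trans (∑-cong (λ x → 𝟙² (U x))) u-def

    ℓ≤u : ℓ ≤ u
    ℓ≤u = ≤-trans (subst₂ _≤_ (*-identityʳ ℓ) refl (*-monoˡ ℓ 0≤ℓ (1≤↑ 18 1≤ℓ)))
          (≤-trans (subst (_≤ 8ℚ * ℓ ↑ 19) (*-identityˡ (ℓ ↑ 19)) (*-monoʳ (ℓ ↑ 19) (0≤↑ 19 0≤ℓ) (≤ᵇ⇒≤ {1ℚ} {8ℚ} tt))) u-large)

    M₀ : Mat n n
    M₀ = B · (B ᵀ)

    M₀-∙ : ∀ v x → (M₀ ∙ v) x ≡ (a ∙ v) x + ℓ * (w x * v x)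
    M₀-∙ v x = trans (∑-cong (λ y → trans (cong (_* v y) (B-gram x y)) (lem (a x y) ℓ (w x) (δ x y) (v y))))
               (trans (∑-+ (λ y → a x y * v y) (λ y → ℓ * w x * (δ x y * v y)))
                      (cong ((a ∙ v) x +_) (trans (∑-*ˡ (ℓ * w x) (λ y → δ x y * v y)) (trans (cong (ℓ * w x *_) (∑-δ x v)) (*-assoc ℓ (w x) (v x))))))
      where lem : ∀ a l w d v → (a + l * (w * d)) * v ≡ a * v + l * w * (d * v)
            lem = solve-∀ ℚ-ring

    qf-M₀ : ∀ v → qf M₀ v ≡ qf a v + ℓ * ∑ (λ x → w x * (v x * v x))
    qf-M₀ v = trans (∑-cong (λ x → trans (cong (v x *_) (M₀-∙ v x)) (lem (v x) ((a ∙ v) x) ℓ (w x))))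
              (trans (∑-+ (λ x → v x * (a ∙ v) x) (λ x → ℓ * (w x * (v x * v x)))) (cong (qf a v +_) (∑-*ˡ ℓ (λ x → w x * (v x * v x)))))
      where lem : ∀ v a l w → v * (a + l * (w * v)) ≡ v * a + l * (w * (v * v))
            lem = solve-∀ ℚ-ring

    wv²≤ : ∀ v → ∑ (λ x → w x * (v x * v x)) ≤ dot v v
    wv²≤ v = ∑-mono (λ x → subst (w x * (v x * v x) ≤_) (*-identityˡ (v x * v x)) (*-monoʳ (v x * v x) (0≤sq (v x)) (𝟙≤1 (U x))))

    qf-a≤ : ∀ v → qf a v ≤ u * dot v v
    qf-a≤ v = cancel-≤ 2ℚ 0<2 (≤-trans (≤-trans (≤-reflexive eq₁) (∑-mono (λ x → ∑-mono (λ y → *-monoˡ (a x y) (0≤a x y) (2ab≤ (v x) (v y))))))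
                (≤-trans (≤-reflexive eq₂) (subst (2ℚ * ∑ (λ x → d x * (v x * v x)) ≤_) (cong (2ℚ *_) (∑-*ˡ u (λ x → v x * v x)))
                  (*-monoˡ 2ℚ 0≤2 (∑-mono (λ x → *-monoʳ (v x * v x) (0≤sq (v x)) (d≤u x)))))))
      where
        lem : ∀ v a z → 2ℚ * (v * (a * z)) ≡ a * (v * z + v * z)
        lem = solve-∀ ℚ-ring
        eq₁ : 2ℚ * qf a v ≡ ∑ (λ x → ∑ (λ y → a x y * (v x * v y + v x * v y)))
        eq₁ = trans (sym (∑-*ˡ 2ℚ (λ x → v x * (a ∙ v) x)))
              (∑-cong (λ x → trans (cong (2ℚ *_) (sym (∑-*ˡ (v x) (λ y → a x y * v y)))) (trans (sym (∑-*ˡ 2ℚ (λ y → v x * (a x y * v y))))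
                (∑-cong (λ y → lem (v x) (a x y) (v y))))))
        S₁ : ∑ (λ x → ∑ (λ y → a x y * (v x * v x))) ≡ ∑ (λ x → d x * (v x * v x))
        S₁ = ∑-cong (λ x → ∑-*ʳ (v x * v x) (a x))
        S₂ : ∑ (λ x → ∑ (λ y → a x y * (v y * v y))) ≡ ∑ (λ x → d x * (v x * v x))
        S₂ = trans (∑-swap (λ x y → a x y * (v y * v y))) (trans (∑-cong (λ y → ∑-cong (λ x → cong (_* (v y * v y)) (a-sym x y)))) S₁)
        lem₂ : ∀ z → z + z ≡ 2ℚ * z
        lem₂ = solve-∀ ℚ-ring
        eq₂ : ∑ (λ x → ∑ (λ y → a x y * (v x * v x + v y * v y))) ≡ 2ℚ * ∑ (λ x → d x * (v x * v x))
        eq₂ = trans (∑-cong (λ x → trans (∑-cong (λ y → *-distribˡ-+ (a x y) (v x * v x) (v y * v y))) (∑-+ (λ y → a x y * (v x * v x)) (λ y → a x y * (v y * v y)))))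
              (trans (∑-+ (λ x → ∑ (λ y → a x y * (v x * v x))) (λ x → ∑ (λ y → a x y * (v y * v y))))
              (trans (cong₂ _+_ S₁ S₂) (lem₂ (∑ (λ x → d x * (v x * v x))))))

    M≤2u : ∀ v → qf M₀ v ≤ 2ℚ * u * dot v v
    M≤2u v = subst₂ _≤_ (sym (qf-M₀ v)) (lem u (dot v v))
      (+-mono-≤ (qf-a≤ v) (≤-trans (*-monoˡ ℓ 0≤ℓ (wv²≤ v)) (*-monoʳ (dot v v) (0≤dot v) ℓ≤u)))
      where lem : ∀ u z → u * z + u * z ≡ 2ℚ * u * z
            lem = solve-∀ ℚ-ring

    aδ : ∀ x y → a x y * δ x y ≡ 0ℚ
    aδ x y = lem x y {a x} (a-diag x)
      where
        lem : ∀ {k} (x y : Fin k) {f : Fin k → ℚ} → f x ≡ 0ℚ → f y * δ x y ≡ 0ℚ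
        lem zero    zero    {f} h = trans (cong (_* 1ℚ) h) (*-zeroˡ 1ℚ)
        lem zero    (suc y) {f} h = *-zeroʳ (f (suc y))
        lem (suc x) zero    {f} h = *-zeroʳ (f zero)
        lem (suc x) (suc y) {f} h = lem x y {f ∘ suc} h

    δ² : ∀ {k} (x y : Fin k) → δ x y * δ x y ≡ δ x y
    δ² zero    zero    = *-identityˡ 1ℚ
    δ² zero    (suc y) = *-zeroˡ 0ℚ
    δ² (suc x) zero    = *-zeroˡ 0ℚ
    δ² (suc x) (suc y) = δ² x y

    -- The entries of `a` and `δ` are idempotent and their supports disjoint, so squaring only
    -- changes the coefficient ℓ to ℓ².
    M₀² : ∀ x y → M₀ x y * M₀ x y ≡ a x y + ℓ * ℓ * (w x * δ x y)
    M₀² x y = trans (cong₂ _*_ (B-gram x y) (B-gram x y)) (trans (lem (a x y) ℓ (w x) (δ x y))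
              (trans (cong₂ (λ p q → p + (2ℚ * ℓ * w x * q + ℓ * ℓ * ((w x * w x) * (δ x y * δ x y)))) (a² x y) (aδ x y))
              (trans (cong₂ (λ p q → a x y + (2ℚ * ℓ * w x * 0ℚ + ℓ * ℓ * (p * q))) (𝟙² (U x)) (δ² x y)) (lem₂ (a x y) ℓ (w x) (δ x y)))))
      where lem : ∀ a l w d → (a + l * (w * d)) * (a + l * (w * d)) ≡ a * a + (2ℚ * l * w * (a * d) + l * l * ((w * w) * (d * d)))
            lem = solve-∀ ℚ-ring
            lem₂ : ∀ a l w d → a + (2ℚ * l * w * 0ℚ + l * l * (w * d)) ≡ a + l * l * (w * d)
            lem₂ = solve-∀ ℚ-ring

    M∘M≤ : ∀ v → qf (λ x y → M₀ x y * M₀ x y) v ≤ qf M₀ v + ℓ * ℓ * dot v v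
    M∘M≤ v = subst₂ _≤_ (sym eq) (cong (_+ ℓ * ℓ * dot v v) (sym (qf-M₀ v)))
        (≤-trans (+-monoʳ-≤ (qf a v) (*-monoˡ (ℓ * ℓ) (0≤sq ℓ) (wv²≤ v)))
          (≤-by (ℓ * ∑ (λ x → w x * (v x * v x))) (lem₃ (qf a v) (ℓ * ℓ * dot v v) (ℓ * ∑ (λ x → w x * (v x * v x))))
            (0≤* 0≤ℓ (0≤∑ (λ x → 0≤* (0≤𝟙 (U x)) (0≤sq (v x)))))))
      where
        lem : ∀ a l w d v → (a + l * l * (w * d)) * v ≡ a * v + l * l * w * (d * v)
        lem = solve-∀ ℚ-ring
        lem₂ : ∀ v a l w → v * (a + l * l * w * v) ≡ v * a + l * l * (w * (v * v))
        lem₂ = solve-∀ ℚ-ring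
        lem₃ : ∀ p q r → p + q + r ≡ p + r + q
        lem₃ = solve-∀ ℚ-ring
        eq : qf (λ x y → M₀ x y * M₀ x y) v ≡ qf a v + ℓ * ℓ * ∑ (λ x → w x * (v x * v x))
        eq = trans (∑-cong (λ x → trans (cong (v x *_) (trans (∑-cong (λ y → trans (cong (_* v y) (M₀² x y)) (lem (a x y) ℓ (w x) (δ x y) (v y))))
                     (trans (∑-+ (λ y → a x y * v y) (λ y → ℓ * ℓ * w x * (δ x y * v y)))
                       (cong ((a ∙ v) x +_) (trans (∑-*ˡ (ℓ * ℓ * w x) (λ y → δ x y * v y)) (cong (ℓ * ℓ * w x *_) (∑-δ x v)))))))
                   (lem₂ (v x) ((a ∙ v) x) ℓ (w x))))
             (trans (∑-+ (λ x → v x * (a ∙ v) x) (λ x → ℓ * ℓ * (w x * (v x * v x)))) (cong (qf a v +_) (∑-*ˡ (ℓ * ℓ) (λ x → w x * (v x * v x)))))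

    trM≤ : ∑ (λ x → M₀ x x) ≤ ℓ * u
    trM≤ = ≤-reflexive (trans (∑-cong (λ x → trans (B-gram x x) (trans (cong₂ (λ p q → p + ℓ * (w x * q)) (a-diag x) (δ-refl x)) (lem ℓ (w x)))))
             (trans (∑-*ˡ ℓ w) (cong (ℓ *_) u-def)))
      where lem : ∀ l w → 0ℚ + l * (w * 1ℚ) ≡ l * w
            lem = solve-∀ ℚ-ring

    open Growth B u ℓ u>0 1≤ℓ M≤2u M∘M≤ w B-row ww≡u trM≤ u-large m ℓ8≤ public
      using (module W; f; F; uF; F-bound; κ⁻¹; u⁻¹; uκ⁻¹; M̂; 2u>0; normalised-∙)

    private
      β : Vec r
      β = (B ᵀ) ∙ 𝟏

    -- Both sides are Σ_y (M₀ x y)². As `a` is 0/1, b_x has inner product d x with the sum of its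
    -- neighbours' vectors, so about 1 with their mean; this is the 1 in 1 - p.
    row-square : ∀ x → dot (B x) (M̂ ∙ B x) ≡ d x + ℓ * ℓ * w x
    row-square x = trans (inner-gram (B ᵀ) (B x)) (trans (∑-cong (λ y → trans (cong₂ _*_ (eq y) (eq y)) (M₀² x y)))
        (trans (∑-+ (a x) (λ y → ℓ * ℓ * (w x * δ x y))) (cong (d x +_) (trans (∑-*ˡ (ℓ * ℓ) (λ y → w x * δ x y)) (cong (ℓ * ℓ *_)
          (trans (∑-cong (λ y → *-comm (w x) (δ x y))) (∑-δ x (λ _ → w x))))))))
      where eq : ∀ y → (B ∙ B x) y ≡ M₀ x y
            eq y = dot-comm (B y) (B x)

    M̂-row : ∀ x → M̂ ∙ B x ≗ (B ᵀ) ∙ M₀ x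
    M̂-row x k = trans (·-∙ (B ᵀ) B (B x) k) (∙-cong (B ᵀ) (λ y → dot-comm (B y) (B x)) k)

    β-norm : dot β β ≡ ∑ d + ℓ * u
    β-norm = trans (sym (inner-gram B 𝟏)) (trans (qf-M₀ 𝟏) (cong₂ (λ p q → p + ℓ * q)
        (∑-cong (λ x → trans (*-identityˡ ((a ∙ 𝟏) x)) (∑-cong (λ y → *-identityʳ (a x y)))))
        (trans (∑-cong (λ x → *-identityʳ (w x))) u-def)))

    module At (dmin : ℚ) (dmin>0 : 0ℚ < dmin) (dmin≤ : ∀ x → U x ≡ true → dmin ≤ d x)
              (τ : ℚ) (triangles : ∀ x → U x ≡ true → ∑ (λ y → a x y * ∑ (λ z → a y z * a x z)) ≤ τ * (d x * d x)) where

      γ : Vec n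
      γ x = w x * inv (d x)

      γₘ : ℚ
      γₘ = inv dmin

      d>0 : ∀ x → U x ≡ true → 0ℚ < d x
      d>0 x h = 0<-≤ dmin>0 (dmin≤ x h)

      γd : ∀ x → γ x * d x ≡ w x
      γd x with U x in eq
      ... | true  = trans (lem (inv (d x)) (d x)) (inv-* (d>0 x eq))
        where lem : ∀ i d → 1ℚ * i * d ≡ d * i
              lem = solve-∀ ℚ-ring
      ... | false = trans (cong (_* d x) (*-zeroˡ (inv (d x)))) (*-zeroˡ (d x))

      0≤γ : ∀ x → 0ℚ ≤ γ x
      0≤γ x = 0≤* (0≤𝟙 (U x)) (0≤inv (d x))

      0≤γₘ : 0ℚ ≤ γₘ
      0≤γₘ = 0≤inv dmin

      γ≤γₘ : ∀ x → γ x ≤ γₘ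
      γ≤γₘ x with U x in eq
      ... | true  = subst (_≤ γₘ) (sym (*-identityˡ (inv (d x)))) (inv-anti dmin>0 (dmin≤ x eq))
      ... | false = subst (_≤ γₘ) (sym (*-zeroˡ (inv (d x)))) (0≤inv dmin)

      -- For x in U, M̂ b_x is the sum of b_y over the neighbours of x plus ℓ b_x. So `v x` is the
      -- mean over the neighbourhood minus the mean over U, up to (ℓ/d x) b_x.
      v : Fin n → Vec r
      v x = lin (γ x) (M̂ ∙ B x) (- u⁻¹) β

      V : ℚ
      V = τ + (3ℚ * ℓ * γₘ + ℓ ↑ 3 * (γₘ * γₘ)) + (u⁻¹ * u⁻¹ * (∑ d + ℓ * u) - 2ℚ * (u⁻¹ * dmin))

      -- The squared norm of the neighbourhood mean is essentially the density inside the
      -- neighbourhood, at most τ. That of the mean over U is the density of U, and the mixed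
      -- product is at least dmin/u. The terms with ℓ stem from the diagonal of M₀.
      v-norm : ∀ x → U x ≡ true → dot (v x) (v x) ≤ V
      v-norm x Ux = subst (_≤ V) (sym expand) (+-mono-≤ (+-mono-≤ t₁ (+-mono-≤ t₂ t₃)) (+-monoʳ-≤ (u⁻¹ * u⁻¹ * (∑ d + ℓ * u)) t₄))
        where
          w≡1 : w x ≡ 1ℚ
          w≡1 = cong 𝟙 Ux
          tri : ℚ
          tri = ∑ (λ y → a x y * ∑ (λ z → a y z * a x z))
          row≡ : ∀ y → M₀ x y ≡ lin 1ℚ (a x) ℓ (δ x) y
          row≡ y = trans (B-gram x y) (trans (cong (λ z → a x y + ℓ * (z * δ x y)) w≡1) (lem (a x y) ℓ (δ x y)))
            where lem : ∀ a l d → a + l * (1ℚ * d) ≡ 1ℚ * a + l * d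
                  lem = solve-∀ ℚ-ring
          cross : dot (a x) (a ∙ δ x) ≡ d x
          cross = ∑-cong (λ y → trans (cong (a x y *_) (trans (∙-δ a x y) (a-sym y x))) (a² x y))
          wm² : ∑ (λ y → w y * (lin 1ℚ (a x) ℓ (δ x) y * lin 1ℚ (a x) ℓ (δ x) y)) ≡ d x + ℓ * ℓ
          wm² = trans (∑-cong (λ y → trans (lem (w y) (a x y) ℓ (δ x y))
                   (cong₂ (λ p q → p * w y + (2ℚ * (ℓ * w y) * q + ℓ * ℓ * (w y * (δ x y * δ x y)))) (a² x y) (aδ x y))))
                (trans (∑-cong (λ y → trans (cong (λ q → a x y * w y + (2ℚ * (ℓ * w y) * 0ℚ + ℓ * ℓ * (w y * q))) (δ² x y))
                          (trans (lem₂ (a x y * w y) ℓ (w y) (δ x y)) (cong (_+ ℓ * ℓ * (δ x y * w y)) (a-col x y)))))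
                (trans (∑-+ (a x) (λ y → ℓ * ℓ * (δ x y * w y))) (cong (d x +_) (trans (∑-*ˡ (ℓ * ℓ) (λ y → δ x y * w y))
                  (trans (cong (ℓ * ℓ *_) (trans (∑-δ x w) w≡1)) (*-identityʳ (ℓ * ℓ)))))))
            where lem : ∀ w a l d → w * ((1ℚ * a + l * d) * (1ℚ * a + l * d)) ≡ a * a * w + (2ℚ * (l * w) * (a * d) + l * l * (w * (d * d)))
                  lem = solve-∀ ℚ-ring
                  lem₂ : ∀ p l w d → p + (2ℚ * (l * w) * 0ℚ + l * l * (w * d)) ≡ p + l * l * (d * w)
                  lem₂ = solve-∀ ℚ-ring
          cubes : dot (M̂ ∙ B x) (M̂ ∙ B x) ≡ tri + 3ℚ * ℓ * d x + ℓ ↑ 3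
          cubes = trans (dot-cong (M̂-row x) (M̂-row x)) (trans (sym (inner-gram B (M₀ x)))
            (trans (dot-cong row≡ (∙-cong M₀ row≡)) (trans (qf-M₀ (lin 1ℚ (a x) ℓ (δ x)))
            (trans (cong₂ (λ p q → p + ℓ * q) (trans (qf-lin a-sym 1ℚ (a x) ℓ (δ x)) (cong₂ (λ p q → 1ℚ * 1ℚ * tri + 2ℚ * (1ℚ * ℓ * p) + ℓ * ℓ * q) cross (trans (qf-δ a x) (a-diag x)))) wm²)
              (lem tri ℓ (d x))))))
            where lem : ∀ t l d → 1ℚ * 1ℚ * t + 2ℚ * (1ℚ * l * d) + l * l * 0ℚ + l * (d + l * l) ≡ t + 3ℚ * l * d + l * (l * (l * 1ℚ))
                  lem = solve-∀ ℚ-ring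
          inner : dmin * d x ≤ dot (M̂ ∙ B x) β
          inner = subst (dmin * d x ≤_) (sym eq) (≤-trans (≤-reflexive (sym (∑-*ˡ dmin (a x)))) (∑-mono pointwise))
            where
              M𝟏 : ∀ y → (M₀ ∙ 𝟏) y ≡ d y + ℓ * w y
              M𝟏 y = trans (M₀-∙ 𝟏 y) (cong₂ (λ p q → p + ℓ * q) (∑-cong (λ z → *-identityʳ (a y z))) (*-identityʳ (w y)))
              eq : dot (M̂ ∙ B x) β ≡ ∑ (λ y → M₀ x y * (d y + ℓ * w y))
              eq = trans (dot-cong {v = β} (M̂-row x) (λ _ → refl)) (trans (sym (dot-adjoint (M₀ x) B β))
                   (∑-cong (λ y → cong (M₀ x y *_) (trans (sym (·-∙ B (B ᵀ) 𝟏 y)) (M𝟏 y)))))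
              0≤δ : ∀ {k} (x y : Fin k) → 0ℚ ≤ δ x y
              0≤δ x y = subst (0ℚ ≤_) (δ² x y) (0≤sq (δ x y))
              0≤d : ∀ y → 0ℚ ≤ d y
              0≤d y = 0≤∑ (0≤a y)
              pointwise : ∀ y → dmin * a x y ≤ M₀ x y * (d y + ℓ * w y)
              pointwise y = ≤-trans (byU (U y) refl)
                (subst (λ z → a x y * (d y + ℓ * w y) ≤ z * (d y + ℓ * w y)) (sym (B-gram x y))
                  (*-monoʳ {a x y} {a x y + ℓ * (w x * δ x y)} (d y + ℓ * w y) (0≤+ (0≤d y) (0≤* 0≤ℓ (0≤𝟙 (U y)))) (≤-by (ℓ * (w x * δ x y)) refl (0≤* 0≤ℓ (0≤* (0≤𝟙 (U x)) (0≤δ x y))))))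
                where
                  byU : ∀ b → U y ≡ b → dmin * a x y ≤ a x y * (d y + ℓ * w y)
                  byU true  e = subst (_≤ a x y * (d y + ℓ * w y)) (*-comm (a x y) dmin)
                                  (*-monoˡ (a x y) (0≤a x y) (≤-trans (dmin≤ y e) (≤-by (ℓ * w y) refl (0≤* 0≤ℓ (0≤𝟙 (U y))))))
                  byU false e = ≤-reflexive (trans (cong (dmin *_) a≡0) (trans (*-zeroʳ dmin) (sym (trans (cong (_* (d y + ℓ * w y)) a≡0) (*-zeroˡ (d y + ℓ * w y))))))
                    where a≡0 : a x y ≡ 0ℚ
                          a≡0 = trans (sym (a-col x y)) (trans (cong (λ b → a x y * 𝟙 b) e) (*-zeroʳ (a x y)))
          g : ℚ
          g = γ x
          gd≡1 : g * d x ≡ 1ℚ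
          gd≡1 = trans (γd x) w≡1
          expand : dot (v x) (v x) ≡ (g * g * tri + (3ℚ * ℓ * g + ℓ ↑ 3 * (g * g))) + (u⁻¹ * u⁻¹ * (∑ d + ℓ * u) + - (2ℚ * (u⁻¹ * (g * dot (M̂ ∙ B x) β))))
          expand = trans (dot-linˡ g (M̂ ∙ B x) (- u⁻¹) β (v x))
            (trans (cong₂ (λ p q → g * p + - u⁻¹ * q) (dot-linʳ (M̂ ∙ B x) g (M̂ ∙ B x) (- u⁻¹) β) (dot-linʳ β g (M̂ ∙ B x) (- u⁻¹) β))
            (trans (cong₂ (λ p q → g * (g * p + - u⁻¹ * dot (M̂ ∙ B x) β) + - u⁻¹ * (g * q + - u⁻¹ * dot β β)) cubes (dot-comm β (M̂ ∙ B x)))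
            (trans (cong (λ q → g * (g * (tri + 3ℚ * ℓ * d x + ℓ ↑ 3) + - u⁻¹ * dot (M̂ ∙ B x) β) + - u⁻¹ * (g * dot (M̂ ∙ B x) β + - u⁻¹ * q)) β-norm)
            (trans (lem g tri ℓ (d x) (ℓ ↑ 3) u⁻¹ (dot (M̂ ∙ B x) β) (∑ d + ℓ * u))
              (trans (cong (λ z → (g * g * tri + (3ℚ * ℓ * g * z + ℓ ↑ 3 * (g * g))) + (u⁻¹ * u⁻¹ * (∑ d + ℓ * u) + - (2ℚ * (u⁻¹ * (g * dot (M̂ ∙ B x) β))))) gd≡1)
                (lem₂ (g * g * tri) (3ℚ * ℓ * g) (ℓ ↑ 3 * (g * g)) (u⁻¹ * u⁻¹ * (∑ d + ℓ * u) + - (2ℚ * (u⁻¹ * (g * dot (M̂ ∙ B x) β))))))))))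
            where
              lem : ∀ g t l d k i m b → g * (g * (t + 3ℚ * l * d + k) + - i * m) + - i * (g * m + - i * b)
                    ≡ (g * g * t + (3ℚ * l * g * (g * d) + k * (g * g))) + (i * i * b + - (2ℚ * (i * (g * m))))
              lem = solve-∀ ℚ-ring
              lem₂ : ∀ p q r s → (p + (q * 1ℚ + r)) + s ≡ (p + (q + r)) + s
              lem₂ = solve-∀ ℚ-ring
          t₁ : g * g * tri ≤ τ
          t₁ = subst (g * g * tri ≤_) (trans (lem g τ (d x)) (trans (cong (λ z → τ * (z * z)) gd≡1) (lem₂ τ))) (*-monoˡ (g * g) (0≤sq g) (triangles x Ux))
            where lem : ∀ g t d → g * g * (t * (d * d)) ≡ t * ((g * d) * (g * d))
                  lem = solve-∀ ℚ-ring
                  lem₂ : ∀ t → t * (1ℚ * 1ℚ) ≡ t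
                  lem₂ = solve-∀ ℚ-ring
          t₂ : 3ℚ * ℓ * g ≤ 3ℚ * ℓ * γₘ
          t₂ = *-monoˡ (3ℚ * ℓ) (0≤* (nonNegative⁻¹ 3ℚ) 0≤ℓ) (γ≤γₘ x)
          t₃ : ℓ ↑ 3 * (g * g) ≤ ℓ ↑ 3 * (γₘ * γₘ)
          t₃ = *-monoˡ (ℓ ↑ 3) (0≤↑ 3 0≤ℓ) (*-mono (0≤γ x) (0≤inv dmin) (γ≤γₘ x) (γ≤γₘ x))
          t₄ : - (2ℚ * (u⁻¹ * (g * dot (M̂ ∙ B x) β))) ≤ - (2ℚ * (u⁻¹ * dmin))
          t₄ = neg-antimono-≤ (*-monoˡ 2ℚ 0≤2 (*-monoˡ u⁻¹ (0≤inv u)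
                 (subst (_≤ g * dot (M̂ ∙ B x) β) (trans (lem g dmin (d x)) (trans (cong (dmin *_) gd≡1) (*-identityʳ dmin))) (*-monoˡ g (0≤γ x) inner))))
            where lem : ∀ g m d → g * (m * d) ≡ m * (g * d)
                  lem = solve-∀ ℚ-ring

      module _ (i : ℕ) where
        private
          K̂ : Mat r r
          K̂ = W.K (suc i)

        h : Fin n → ℚ
        h x = dot (B x) (K̂ ∙ v x)

        h-support : ∀ x → w x * h x ≡ h x
        h-support x = trans (sym (∑-*ˡ (w x) (λ k → B x k * (K̂ ∙ v x) k)))
          (∑-cong (λ k → trans (sym (*-assoc (w x) (B x k) ((K̂ ∙ v x) k))) (cong (_* (K̂ ∙ v x) k) (B-row x k))))

        h²≤ : ∀ {V′} → 0ℚ ≤ V′ → V ≤ V′ → ∀ x → h x * h x ≤ qf K̂ (B x) * V′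
        h²≤ {V′} 0≤V′ V≤V′ x = byU (U x) refl
          where
            byU : ∀ b → U x ≡ b → h x * h x ≤ qf K̂ (B x) * V′
            byU true  e = ≤-trans (PSD-CS (W.K-sym (suc i)) (W.K-psd (suc i)) (B x) (v x))
                            (*-monoˡ (qf K̂ (B x)) (W.K-psd (suc i) (B x)) (≤-trans (W.K≤1 (suc i) (v x)) (≤-trans (v-norm x e) V≤V′)))
            byU false e = ≤-trans (≤-reflexive (trans (cong (_* h x) h≡0) (*-zeroˡ (h x)))) (0≤* (W.K-psd (suc i) (B x)) 0≤V′)
              where h≡0 : h x ≡ 0ℚ
                    h≡0 = trans (sym (h-support x)) (trans (cong (λ b → 𝟙 b * h x) e) (*-zeroˡ (h x)))

        -- Cauchy-Schwarz for the form `K̂` at each x and then over U. The form is what helps: the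
        -- sum of ⟨b_x, K̂ b_x⟩ is the truncated trace, much smaller than the full trace ℓu.
        Σh²≤ : ∀ {V′} → 0ℚ ≤ V′ → V ≤ V′ → ∑ h * ∑ h ≤ u * (f (suc i) * V′)
        Σh²≤ {V′} 0≤V′ V≤V′ = ≤-trans (subst₂ (λ p q → p * p ≤ q * dot h h) (∑-cong h-support) ww≡u (dot-CS w h))
          (*-monoˡ u (<⇒≤ u>0) (subst (dot h h ≤_) (∑-*ʳ V′ (λ x → qf K̂ (B x))) (∑-mono (h²≤ 0≤V′ V≤V′))))

        ρ : Fin n → ℚ
        ρ x = 2ℚ * u * inv (2ℚ ↑ suc i) * qf K̂ (B x)

        0<2^ : 0ℚ < 2ℚ ↑ suc i
        0<2^ = 0<↑ (suc i) 0<2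

        -- The part of M̂ b lost by the truncation is controlled by the tail decay.
        main-term : ∀ x → d x - ρ x ≤ dot (B x) (K̂ ∙ (M̂ ∙ B x))
        main-term x = ≤-trans (+-mono-≤ d≤ (neg-antimono-≤ tail)) (≤-reflexive (sym split))
          where
            b s : Vec r
            b = B x
            s = W.R i ∙ b
            P̂ : Mat r r
            P̂ k l = κ⁻¹ * M̂ k l
            M̂b : M̂ ∙ b ≗ lin (2ℚ * u) (P̂ ∙ b) 0ℚ b
            M̂b k = sym (trans (cong (λ z → 2ℚ * u * z + 0ℚ * b k) (normalised-∙ M̂ b k)) (trans (lem u κ⁻¹ ((M̂ ∙ b) k) (b k)) (trans (cong (λ z → 2ℚ * (z * (M̂ ∙ b) k)) uκ⁻¹) (lem₂ ((M̂ ∙ b) k)))))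
              where lem : ∀ u k m b → 2ℚ * u * (k * m) + 0ℚ * b ≡ 2ℚ * (u * k * m)
                    lem = solve-∀ ℚ-ring
                    lem₂ : ∀ m → 2ℚ * (½ * m) ≡ m
                    lem₂ = solve-∀ ℚ-ring
            d≤ : d x ≤ dot b (M̂ ∙ b)
            d≤ = subst (d x ≤_) (sym (row-square x)) (≤-by (ℓ * ℓ * w x) refl (0≤* (0≤sq ℓ) (0≤𝟙 (U x))))
            RPb : dot b (W.R (suc i) ∙ (P̂ ∙ b)) ≡ qf P̂ s
            RPb = trans (dot-cong {u = b} (λ _ → refl) (W.R-suc i (P̂ ∙ b))) (trans (dot-adj (W.R-sym i) b (W.R i ∙ (P̂ ∙ b)))
                    (dot-cong {u = s} (λ _ → refl) (W.R-P-comm i b)))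
            Rb≡ : dot b (W.R (suc i) ∙ (M̂ ∙ b)) ≡ 2ℚ * u * qf P̂ s
            Rb≡ = trans (dot-cong {u = b} (λ _ → refl) (λ k → trans (∙-cong (W.R (suc i)) M̂b k) (∙-lin (W.R (suc i)) (2ℚ * u) (P̂ ∙ b) 0ℚ b k)))
                  (trans (dot-linʳ b (2ℚ * u) (W.R (suc i) ∙ (P̂ ∙ b)) 0ℚ (W.R (suc i) ∙ b)) (trans (lem (2ℚ * u * dot b (W.R (suc i) ∙ (P̂ ∙ b))) (dot b (W.R (suc i) ∙ b))) (cong (2ℚ * u *_) RPb)))
              where lem : ∀ p q → p + 0ℚ * q ≡ p
                    lem = solve-∀ ℚ-ring
            split : dot b (K̂ ∙ (M̂ ∙ b)) ≡ dot b (M̂ ∙ b) - 2ℚ * u * qf P̂ s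
            split = trans (lem (dot b (M̂ ∙ b)) (dot b (K̂ ∙ (M̂ ∙ b)))) (cong (_-_ (dot b (M̂ ∙ b)))
                      (trans (sym (trans (dot-cong {u = b} (λ _ → refl) (W.R-∙ (suc i) (M̂ ∙ b))) (dot-linʳ b 1ℚ (M̂ ∙ b) -1ℚ (K̂ ∙ (M̂ ∙ b))))) Rb≡))
              where lem : ∀ p q → q ≡ p - (1ℚ * p + -1ℚ * q)
                    lem = solve-∀ ℚ-ring
            decay : 2ℚ ↑ suc i * qf P̂ s ≤ qf K̂ b
            decay = ≤-from-diff (subst (0ℚ ≤_) (trans (cong (λ z → dot b b - (2ℚ ↑ suc i * qf P̂ s + z)) (W.R-norm i b)) (lem (dot b b) (2ℚ ↑ suc i * qf P̂ s) (qf K̂ b))) (0≤-diff (W.tail-decay i b)))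
              where lem : ∀ n p k → n - (p + (n - k)) ≡ k - p
                    lem = solve-∀ ℚ-ring
            tail : 2ℚ * u * qf P̂ s ≤ ρ x
            tail = subst (_≤ ρ x) (trans (lem u (inv (2ℚ ↑ suc i)) (2ℚ ↑ suc i) (qf P̂ s)) (trans (cong (λ z → 2ℚ * u * (z * qf P̂ s)) (inv-* 0<2^)) (cong (2ℚ * u *_) (*-identityˡ (qf P̂ s)))))
                     (*-monoˡ (2ℚ * u * inv (2ℚ ↑ suc i)) (0≤* (<⇒≤ 2u>0) (0≤inv (2ℚ ↑ suc i))) decay)
              where lem : ∀ u j t q → 2ℚ * u * j * (t * q) ≡ 2ℚ * u * (t * j * q)
                    lem = solve-∀ ℚ-ring

        -- The neighbourhood means contribute 1 per vertex of U apart from the truncation loss. The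
        -- mean over U contributes ⟨β, K̂β⟩/u, at most |β|²/u, which is u times the density up to ℓ.
        Σh≥ : u - γₘ * (2ℚ * u * inv (2ℚ ↑ suc i) * f (suc i)) - u⁻¹ * (∑ d + ℓ * u) ≤ ∑ h
        Σh≥ = subst (u - γₘ * (2ℚ * u * inv (2ℚ ↑ suc i) * f (suc i)) - u⁻¹ * (∑ d + ℓ * u) ≤_) (sym Σh≡)
                (+-mono-≤ first (neg-antimono-≤ (*-monoˡ u⁻¹ (0≤inv u) (subst (qf K̂ β ≤_) β-norm (W.K≤1 (suc i) β)))))
          where
            c₀ : ℚ
            c₀ = 2ℚ * u * inv (2ℚ ↑ suc i)
            0≤c₀ : 0ℚ ≤ c₀
            0≤c₀ = 0≤* (<⇒≤ 2u>0) (0≤inv (2ℚ ↑ suc i))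
            h≡ : ∀ x → h x ≡ γ x * dot (B x) (K̂ ∙ (M̂ ∙ B x)) + - u⁻¹ * dot (B x) (K̂ ∙ β)
            h≡ x = trans (dot-cong {u = B x} (λ _ → refl) (∙-lin K̂ (γ x) (M̂ ∙ B x) (- u⁻¹) β)) (dot-linʳ (B x) (γ x) (K̂ ∙ (M̂ ∙ B x)) (- u⁻¹) (K̂ ∙ β))
            second : ∑ (λ x → dot (B x) (K̂ ∙ β)) ≡ qf K̂ β
            second = trans (∑-cong (λ x → sym (*-identityˡ (dot (B x) (K̂ ∙ β))))) (dot-adjoint 𝟏 B (K̂ ∙ β))
            Σh≡ : ∑ h ≡ ∑ (λ x → γ x * dot (B x) (K̂ ∙ (M̂ ∙ B x))) - u⁻¹ * qf K̂ β
            Σh≡ = trans (∑-cong h≡) (trans (∑-+ (λ x → γ x * dot (B x) (K̂ ∙ (M̂ ∙ B x))) (λ x → - u⁻¹ * dot (B x) (K̂ ∙ β)))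
                  (cong (∑ (λ x → γ x * dot (B x) (K̂ ∙ (M̂ ∙ B x))) +_) (trans (∑-*ˡ (- u⁻¹) (λ x → dot (B x) (K̂ ∙ β)))
                    (trans (cong (- u⁻¹ *_) second) (sym (neg-distribˡ-* u⁻¹ (qf K̂ β)))))))
            pointwise : ∀ x → w x - γₘ * (c₀ * qf K̂ (B x)) ≤ γ x * dot (B x) (K̂ ∙ (M̂ ∙ B x))
            pointwise x = ≤-trans (≤-by ((γₘ - γ x) * (c₀ * qf K̂ (B x))) (trans (cong (λ z → z - γₘ * (c₀ * qf K̂ (B x)) + (γₘ - γ x) * (c₀ * qf K̂ (B x))) (sym (γd x))) (lem (γ x) (d x) γₘ (c₀ * qf K̂ (B x))))
                              (0≤* (0≤-diff (γ≤γₘ x)) (0≤* 0≤c₀ (W.K-psd (suc i) (B x)))))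
                            (*-monoˡ (γ x) (0≤γ x) (main-term x))
              where lem : ∀ g d m r → g * d - m * r + (m - g) * r ≡ g * (d - r)
                    lem = solve-∀ ℚ-ring
            first : u - γₘ * (c₀ * f (suc i)) ≤ ∑ (λ x → γ x * dot (B x) (K̂ ∙ (M̂ ∙ B x)))
            first = subst (_≤ ∑ (λ x → γ x * dot (B x) (K̂ ∙ (M̂ ∙ B x))))
              (trans (∑-- w (λ x → γₘ * (c₀ * qf K̂ (B x)))) (cong₂ _-_ u-def (trans (∑-*ˡ γₘ (λ x → c₀ * qf K̂ (B x))) (cong (γₘ *_) (∑-*ˡ c₀ (λ x → qf K̂ (B x)))))))
              (∑-mono pointwise)

        raw : ∀ {V′} → 0ℚ ≤ V′ → V ≤ V′ →
              0ℚ ≤ u - γₘ * (2ℚ * u * inv (2ℚ ↑ suc i) * f (suc i)) - u⁻¹ * (∑ d + ℓ * u) →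
              (u - γₘ * (2ℚ * u * inv (2ℚ ↑ suc i) * f (suc i)) - u⁻¹ * (∑ d + ℓ * u)) * (u - γₘ * (2ℚ * u * inv (2ℚ ↑ suc i) * f (suc i)) - u⁻¹ * (∑ d + ℓ * u))
              ≤ u * (f (suc i) * V′)
        raw 0≤V′ V≤V′ 0≤L = ≤-trans (*-mono 0≤L (≤-trans 0≤L Σh≥) Σh≥ Σh≥) (Σh²≤ 0≤V′ V≤V′)

      dispersion : ∀ j {V′ L} → 0ℚ ≤ V′ → V ≤ V′ → 0ℚ ≤ L →
        L ≤ 1ℚ - γₘ * (2ℚ * u * inv (2ℚ ↑ (8 ℕ.* suc j)) * 2ℚ ↑ (5 ℕ.+ suc j)) - u⁻¹ * u⁻¹ * (∑ d + ℓ * u) →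
        L * L ≤ 2ℚ ↑ (5 ℕ.+ suc j) * V′
      dispersion j {V′} {L} 0≤V′ V≤V′ 0≤L L≤ = cancel-≤ (u * u) (0<* u>0 u>0)
          (≤-trans (subst (_≤ X * X) (lem₁ u L) (*-mono (0≤* (<⇒≤ u>0) 0≤L) 0≤X uL≤X uL≤X))
          (≤-trans (raw i 0≤V′ V≤V′ 0≤X)
          (≤-trans (*-monoˡ u (<⇒≤ u>0) (*-monoʳ V′ 0≤V′ (subst (_≤ u * b) (uF (suc i)) (*-monoˡ u (<⇒≤ u>0) Fb)))) (≤-reflexive (lem₂ u b V′)))))
        where
          i : ℕ
          -- The truncation used is `W.K (suc i)`, and suc i = 8(j + 1) is a scale at which
          -- `F-bound` speaks.
          i = 7 ℕ.+ 8 ℕ.* j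
          eqi : 8 ℕ.* suc j ≡ suc i
          eqi = ℕₚ.*-suc 8 j
          b e X : ℚ
          b = 2ℚ ↑ (5 ℕ.+ suc j)
          e = inv (2ℚ ↑ suc i)
          X = u - γₘ * (2ℚ * u * e * f (suc i)) - u⁻¹ * (∑ d + ℓ * u)
          Fb : F (suc i) ≤ b
          Fb = subst (λ k → F k ≤ b) eqi (F-bound (suc j))
          lem₁ : ∀ u L → u * L * (u * L) ≡ u * u * (L * L)
          lem₁ = solve-∀ ℚ-ring
          lem₂ : ∀ u b v → u * (u * b * v) ≡ u * u * (b * v)
          lem₂ = solve-∀ ℚ-ring
          uL≤X : u * L ≤ X
          uL≤X = ≤-trans (*-monoˡ u (<⇒≤ u>0) (subst (λ k → L ≤ 1ℚ - γₘ * (2ℚ * u * inv (2ℚ ↑ k) * b) - u⁻¹ * u⁻¹ * (∑ d + ℓ * u)) eqi L≤))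
                   (≤-by (γₘ * (2ℚ * u * e) * (u * b - f (suc i))) (trans (lem₃ u γₘ e b u⁻¹ (∑ d + ℓ * u) (f (suc i)))
                      (trans (cong (λ z → u - γₘ * (2ℚ * u * e * f (suc i)) - z * (u⁻¹ * (∑ d + ℓ * u))) (inv-* u>0)) (cong (λ z → u - γₘ * (2ℚ * u * e * f (suc i)) - z) (*-identityˡ (u⁻¹ * (∑ d + ℓ * u))))))
                     (0≤* (0≤* 0≤γₘ (0≤* (<⇒≤ 2u>0) (0≤inv (2ℚ ↑ suc i)))) (0≤-diff (subst (_≤ u * b) (uF (suc i)) (*-monoˡ u (<⇒≤ u>0) Fb)))))
            where lem₃ : ∀ u g e b i s f → u * (1ℚ - g * (2ℚ * u * e * b) - i * i * s) + g * (2ℚ * u * e) * (u * b - f) ≡ u - g * (2ℚ * u * e * f) - u * i * (i * s)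
                  lem₃ = solve-∀ ℚ-ring
          0≤X : 0ℚ ≤ X
          0≤X = ≤-trans (0≤* (<⇒≤ u>0) 0≤L) uL≤X

  -- Graph quantities as rational sums

  𝟙-∧ : ∀ b c → 𝟙 (b ∧ c) ≡ 𝟙 b * 𝟙 c
  𝟙-∧ true  c = sym (*-identityˡ (𝟙 c))
  𝟙-∧ false c = sym (*-zeroˡ (𝟙 c))

  𝟙-not : ∀ b → 𝟙 (not b) ≡ 1ℚ - 𝟙 b
  𝟙-not true  = refl
  𝟙-not false = refl

  ι-if : ∀ b → ι (if b then 1 else 0) ≡ 𝟙 b
  ι-if true  = refl
  ι-if false = refl

  ι-sumFin : ∀ {n} (f : Fin n → ℕ) → ι (sumFin f) ≡ ∑ (λ i → ι (f i))
  ι-sumFin {zero}  f = refl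
  ι-sumFin {suc n} f = trans (ι-+ (f zero) _) (cong (ι (f zero) +_) (ι-sumFin (λ i → f (suc i))))

  𝟙-≟ : ∀ {n} (x y : Fin n) → 𝟙 (does (x Finₚ.≟ y)) ≡ δ x y
  𝟙-≟ zero    zero    = refl
  𝟙-≟ zero    (suc y) = refl
  𝟙-≟ (suc x) zero    = refl
  𝟙-≟ (suc x) (suc y) = 𝟙-≟ x y

  lt : ∀ {n} → Fin n → Fin n → ℚ
  lt i j = 𝟙 (does (i Fin.<? j))

  lt-cmp : ∀ {n} (i j : Fin n) → lt i j + lt j i + δ i j ≡ 1ℚ
  lt-cmp zero    zero    = refl
  lt-cmp zero    (suc j) = refl
  lt-cmp (suc i) zero    = refl
  lt-cmp (suc i) (suc j) = trans (cong₂ (λ a b → a + b + δ i j) (lt-suc i j) (lt-suc j i)) (lt-cmp i j)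
    where
      lt-suc : ∀ {n} (i j : Fin n) → lt (suc i) (suc j) ≡ lt i j
      lt-suc i j = cong 𝟙 (does-⇔ (suc i Fin.<? suc j) (i Fin.<? j) ℕ.s≤s⁻¹ ℕ.s≤s)
        where
          does-⇔ : ∀ {P Q : Set} (P? : Dec P) (Q? : Dec Q) → (P → Q) → (Q → P) → does P? ≡ does Q?
          does-⇔ (yes p) (yes q) f g = refl
          does-⇔ (yes p) (no ¬q) f g = ⊥-elim (¬q (f p))
          does-⇔ (no ¬p) (yes q) f g = ⊥-elim (¬p (g q))
          does-⇔ (no ¬p) (no ¬q) f g = refl

  ∑∑-halves : ∀ {n} (s : Mat n n) → Sym s → (∀ i → s i i ≡ 0ℚ) →
              ∑ (λ i → ∑ (s i)) ≡ 2ℚ * ∑ (λ i → ∑ (λ j → lt i j * s i j))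
  ∑∑-halves {n} s s-sym s-diag =
    trans (∑-cong (λ i → trans (∑-cong (λ j → trans (sym (*-identityˡ (s i j))) (trans (cong (_* s i j) (sym (lt-cmp i j))) (lem (lt i j) (lt j i) (δ i j) (s i j)))))
            (trans (∑-+ (λ j → lt i j * s i j + lt j i * s i j) (λ j → δ i j * s i j))
                   (cong₂ _+_ (∑-+ (λ j → lt i j * s i j) (λ j → lt j i * s i j)) (trans (∑-δ i (s i)) (s-diag i))))))
    (trans (∑-cong (λ i → +-identityʳ (∑ (λ j → lt i j * s i j) + ∑ (λ j → lt j i * s i j))))
    (trans (∑-+ (λ i → ∑ (λ j → lt i j * s i j)) (λ i → ∑ (λ j → lt j i * s i j)))
    (trans (cong (∑ (λ i → ∑ (λ j → lt i j * s i j)) +_)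
             (trans (∑-swap (λ i j → lt j i * s i j)) (∑-cong (λ j → ∑-cong (λ i → cong (lt j i *_) (s-sym i j))))))
           (lem₂ (∑ (λ i → ∑ (λ j → lt i j * s i j)))))))
    where
      lem : ∀ a b d s → (a + b + d) * s ≡ a * s + b * s + d * s
      lem = solve-∀ ℚ-ring
      lem₂ : ∀ z → z + z ≡ 2ℚ * z
      lem₂ = solve-∀ ℚ-ring

  _⊑_ : ∀ {n} → (Fin n → Bool) → (Fin n → Bool) → Set
  W ⊑ S = ∀ x → W x ≡ true → S x ≡ true

  module OnGraph {n} (G : Graph n) where

    A : Mat n n
    A x y = 𝟙 (adj G x y)

    A-sym : Sym A
    A-sym x y = cong 𝟙 (adj-sym G x y)

    A-diag : ∀ x → A x x ≡ 0ℚ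
    A-diag x = cong 𝟙 (adj-irrefl G x)

    a : (Fin n → Bool) → Mat n n
    a S x y = 𝟙 (S x) * (𝟙 (S y) * A x y)

    sz e₂ : (Fin n → Bool) → ℚ
    sz S = ∑ (λ x → 𝟙 (S x))
    e₂ S = ∑ (λ x → ∑ (a S x))

    a-bool : ∀ S x y → a S x y ≡ 𝟙 (S x ∧ S y ∧ adj G x y)
    a-bool S x y = sym (trans (𝟙-∧ (S x) (S y ∧ adj G x y)) (cong (𝟙 (S x) *_) (𝟙-∧ (S y) (adj G x y))))

    a-sym : ∀ S → Sym (a S)
    a-sym S x y = trans (lem (𝟙 (S x)) (𝟙 (S y)) (A x y)) (cong (λ z → 𝟙 (S y) * (𝟙 (S x) * z)) (A-sym x y))
      where lem : ∀ p q r → p * (q * r) ≡ q * (p * r)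
            lem = solve-∀ ℚ-ring

    a² : ∀ S x y → a S x y * a S x y ≡ a S x y
    a² S x y = trans (cong₂ _*_ (a-bool S x y) (a-bool S x y)) (trans (𝟙² (S x ∧ S y ∧ adj G x y)) (sym (a-bool S x y)))

    a-diag : ∀ S x → a S x x ≡ 0ℚ
    a-diag S x = trans (cong (λ z → 𝟙 (S x) * (𝟙 (S x) * z)) (A-diag x)) (lem (𝟙 (S x)))
      where lem : ∀ p → p * (p * 0ℚ) ≡ 0ℚ
            lem = solve-∀ ℚ-ring

    a-row : ∀ S x y → 𝟙 (S x) * a S x y ≡ a S x y
    a-row S x y = trans (sym (*-assoc (𝟙 (S x)) (𝟙 (S x)) (𝟙 (S y) * A x y))) (cong (_* (𝟙 (S y) * A x y)) (𝟙² (S x)))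

    a≤1 : ∀ S x y → a S x y ≤ 1ℚ
    a≤1 S x y = subst (_≤ 1ℚ) (sym (a-bool S x y)) (𝟙≤1 (S x ∧ S y ∧ adj G x y))

    0≤a : ∀ S x y → 0ℚ ≤ a S x y
    0≤a S x y = subst (0ℚ ≤_) (sym (a-bool S x y)) (0≤𝟙 (S x ∧ S y ∧ adj G x y))

    a-cong : ∀ {S T} → S ≗ T → ∀ x y → a S x y ≡ a T x y
    a-cong h x y = cong₂ (λ p q → 𝟙 p * (𝟙 q * A x y)) (h x) (h y)

    sz-cong : ∀ {S T} → S ≗ T → sz S ≡ sz T
    sz-cong h = ∑-cong (λ x → cong 𝟙 (h x))

    e₂-cong : ∀ {S T} → S ≗ T → e₂ S ≡ e₂ T
    e₂-cong h = ∑-cong (λ x → ∑-cong (a-cong h x))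

    0≤sz : ∀ S → 0ℚ ≤ sz S
    0≤sz S = 0≤∑ (λ x → 0≤𝟙 (S x))

    0≤e₂ : ∀ S → 0ℚ ≤ e₂ S
    0≤e₂ S = 0≤∑ (λ x → 0≤∑ (0≤a S x))

    sz-size : ∀ S → ι (size S) ≡ sz S
    sz-size S = trans (ι-sumFin (λ x → if S x then 1 else 0)) (∑-cong (λ x → ι-if (S x)))

    e₂-edges : ∀ S → e₂ S ≡ 2ℚ * ι (edgesIn G S)
    e₂-edges S = trans (∑∑-halves (a S) (a-sym S) (a-diag S)) (cong (2ℚ *_)
      (sym (trans (ι-sumFin row) (∑-cong (λ i → trans (ι-sumFin (cell i)) (∑-cong (λ j → trans (ι-if (does (i Fin.<? j) ∧ S i ∧ S j ∧ adj G i j))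
        (trans (𝟙-∧ (does (i Fin.<? j)) (S i ∧ S j ∧ adj G i j)) (cong (lt i j *_) (sym (a-bool S i j)))))))))))
      where
        cell : Fin n → Fin n → ℕ
        cell i j = if does (i Fin.<? j) ∧ S i ∧ S j ∧ adj G i j then 1 else 0
        row : Fin n → ℕ
        row i = sumFin (cell i)

    e₂≤sz² : ∀ S → e₂ S ≤ sz S * sz S
    e₂≤sz² S = subst (e₂ S ≤_) (trans (∑-cong (λ x → ∑-*ˡ (𝟙 (S x)) (λ y → 𝟙 (S y)))) (∑-*ʳ (sz S) (λ x → 𝟙 (S x))))
      (∑-mono (λ x → ∑-mono (λ y → *-monoˡ (𝟙 (S x)) (0≤𝟙 (S x))
        (subst (𝟙 (S y) * A x y ≤_) (*-identityʳ (𝟙 (S y))) (*-monoˡ (𝟙 (S y)) (0≤𝟙 (S y)) (𝟙≤1 (adj G x y)))))))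

    deg : (Fin n → Bool) → Fin n → ℚ
    deg S x = ∑ (a S x)

    remove : Fin n → (Fin n → Bool) → Fin n → Bool
    remove x U y = U y ∧ not (does (x Finₚ.≟ y))

    𝟙-remove : ∀ x U y → 𝟙 (remove x U y) ≡ 𝟙 (U y) * (1ℚ - δ x y)
    𝟙-remove x U y = trans (𝟙-∧ (U y) (not (does (x Finₚ.≟ y)))) (cong (𝟙 (U y) *_) (trans (𝟙-not (does (x Finₚ.≟ y))) (cong (_-_ 1ℚ) (𝟙-≟ x y))))

    remove⊑ : ∀ x U → remove x U ⊑ U
    remove⊑ x U y h with U y
    ... | true = refl

    sz-remove : ∀ x U → U x ≡ true → sz (remove x U) ≡ sz U - 1ℚ
    sz-remove x U Ux = trans (∑-cong (λ y → trans (𝟙-remove x U y) (lem (𝟙 (U y)) (δ x y))))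
      (trans (∑-- (λ y → 𝟙 (U y)) (λ y → δ x y * 𝟙 (U y))) (cong (_-_ (sz U)) (trans (∑-δ x (λ y → 𝟙 (U y))) (cong 𝟙 Ux))))
      where lem : ∀ u d → u * (1ℚ - d) ≡ u - d * u
            lem = solve-∀ ℚ-ring

    e₂-remove : ∀ x U → e₂ (remove x U) ≡ e₂ U - 2ℚ * deg U x
    e₂-remove x U = trans (∑-cong (λ y → trans (∑-cong (λ z → trans (cong₂ (λ p q → p * (q * A y z)) (𝟙-remove x U y) (𝟙-remove x U z))
                             (lem (𝟙 (U y)) (δ x y) (𝟙 (U z)) (δ x z) (A y z))))
                          (trans (∑-+ (λ z → (1ℚ - δ x y) * a U y z) (λ z → (-1ℚ + δ x y) * (δ x z * a U y z)))
                          (trans (cong₂ _+_ (∑-*ˡ (1ℚ - δ x y) (a U y)) (trans (∑-*ˡ (-1ℚ + δ x y) (λ z → δ x z * a U y z)) (cong ((-1ℚ + δ x y) *_) (∑-δ x (a U y)))))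
                                 (lem₂ (δ x y) (deg U y) (a U y x))))))
      (trans (∑-+ (λ y → deg U y + -1ℚ * a U y x) (λ y → δ x y * (a U y x - deg U y)))
      (trans (cong₂ _+_ (trans (∑-+ (deg U) (λ y → -1ℚ * a U y x)) (cong (e₂ U +_) (trans (∑-*ˡ -1ℚ (λ y → a U y x)) (cong (-1ℚ *_) (∑-cong (λ y → a-sym U y x))))))
                        (trans (∑-δ x (λ y → a U y x - deg U y)) (cong (_- deg U x) (a-diag U x))))
             (lem₃ (e₂ U) (deg U x))))
      where
        lem : ∀ u d v e a → u * (1ℚ - d) * (v * (1ℚ - e) * a) ≡ (1ℚ - d) * (u * (v * a)) + (-1ℚ + d) * (e * (u * (v * a)))
        lem = solve-∀ ℚ-ring
        lem₂ : ∀ d g b → (1ℚ - d) * g + (-1ℚ + d) * b ≡ g + -1ℚ * b + d * (b - g)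
        lem₂ = solve-∀ ℚ-ring
        lem₃ : ∀ e d → e + -1ℚ * d + (0ℚ - d) ≡ e - 2ℚ * d
        lem₃ = solve-∀ ℚ-ring

    nbhd : (Fin n → Bool) → Fin n → Fin n → Bool
    nbhd U x y = U x ∧ U y ∧ adj G x y

    nbhd⊑ : ∀ U x → nbhd U x ⊑ U
    nbhd⊑ U x y h with U x | U y
    ... | true  | true = refl

    sz-nbhd : ∀ U x → sz (nbhd U x) ≡ deg U x
    sz-nbhd U x = ∑-cong (λ y → sym (a-bool U x y))

    e₂-nbhd : ∀ U x → e₂ (nbhd U x) ≡ ∑ (λ y → a U x y * ∑ (λ z → a U y z * a U x z))
    e₂-nbhd U x = ∑-cong (λ y → trans (∑-cong (λ z → trans (cong₂ (λ p q → p * (q * A y z)) (sym (a-bool U x y)) (sym (a-bool U x z)))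
                    (sym (trans (lem (a U x y) (𝟙 (U y)) (𝟙 (U z)) (A y z) (a U x z)) (cong₂ (λ p q → p * (q * A y z)) (a-col x y) (a-col x z))))))
                    (∑-*ˡ (a U x y) (λ z → a U y z * a U x z)))
      where
        lem : ∀ p u v b q → p * (u * (v * b) * q) ≡ (p * u) * ((q * v) * b)
        lem = solve-∀ ℚ-ring
        a-col : ∀ x y → a U x y * 𝟙 (U y) ≡ a U x y
        a-col x y = trans (lem′ (𝟙 (U x)) (𝟙 (U y)) (A x y)) (cong (λ z → 𝟙 (U x) * (z * A x y)) (𝟙² (U y)))
          where lem′ : ∀ p q r → p * (q * r) * q ≡ p * ((q * q) * r)
                lem′ = solve-∀ ℚ-ring

  -- Extremal vertex sets

  argmax : ∀ {X : Set} (φ : X → ℚ) (x : X) (xs : List X) →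
           ∃[ y ] (∀ z → z Mem.∈ (x ∷ xs) → φ z ≤ φ y)
  argmax φ x []        = x , λ { z (here refl) → ≤-refl }
  argmax φ x (x′ ∷ xs) with argmax φ x′ xs
  ... | y , h with ≤⊎> (φ x) (φ y)
  ...   | inj₁ x≤y = y , λ { z (here refl) → x≤y ; z (there z∈) → h z z∈ }
  ...   | inj₂ y<x = x , λ { z (here refl) → ≤-refl ; z (there z∈) → ≤-trans (h z z∈) (<⇒≤ y<x) }

  colouring-complete : ∀ {n} (c : Fin n → Bool) → ∃[ c′ ] (c′ Mem.∈ colourings n × c ≗ c′)
  colouring-complete {zero}  c = (λ ()) , here refl , λ ()
  colouring-complete {suc n} c with colouring-complete (λ i → c (suc i))
  ... | c′ , c′∈ , eq = extension (c zero) refl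
    where
      extension : ∀ b → c zero ≡ b → ∃[ c″ ] (c″ Mem.∈ colourings (suc n) × c ≗ c″)
      extension true  e = (true VF.∷ c′) , Memₚ.∈-concatMap⁺ (λ c → (true VF.∷ c) ∷ (false VF.∷ c) ∷ []) (Data.List.Relation.Unary.Any.map (λ { refl → here refl }) c′∈)
                        , λ { zero → e ; (suc i) → eq i }
      extension false e = (false VF.∷ c′) , Memₚ.∈-concatMap⁺ (λ c → (true VF.∷ c) ∷ (false VF.∷ c) ∷ []) (Data.List.Relation.Unary.Any.map (λ { refl → there (here refl) }) c′∈)
                        , λ { zero → e ; (suc i) → eq i }

  -- The list contains each vertex set only up to pointwise equality, so the maximised quantity has
  -- to respect it.
  argmax-colouring : ∀ {n} (φ : (Fin n → Bool) → ℚ) → (∀ {c c′} → c ≗ c′ → φ c ≡ φ c′) → ∃[ y ] (∀ z → φ z ≤ φ y)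
  argmax-colouring {n} φ φ-cong with colourings n in eq
  ... | [] = (λ _ → true) , λ z → ⊥-elim (absurd (subst (proj₁ (colouring-complete z) Mem.∈_) eq (proj₁ (proj₂ (colouring-complete z)))))
    where absurd : ∀ {X : Set} {x : X} → ¬ (x Mem.∈ [])
          absurd ()
  ... | x ∷ xs with argmax φ x xs
  ...   | y , h = y , λ z → subst (_≤ φ y) (sym (φ-cong (proj₂ (proj₂ (colouring-complete z)))))
                     (h (proj₁ (colouring-complete z)) (subst (proj₁ (colouring-complete z) Mem.∈_) eq (proj₁ (proj₂ (colouring-complete z)))))

  bernoulli : ∀ {s} k → 0ℚ ≤ 1ℚ - s → 1ℚ - ι k * s ≤ (1ℚ - s) ↑ k
  bernoulli {s} zero    h = ≤-reflexive (lem s)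
    where lem : ∀ s → 1ℚ - 0ℚ * s ≡ 1ℚ
          lem = solve-∀ ℚ-ring
  bernoulli {s} (suc k) h = ≤-trans (≤-by (ι k * (s * s)) (lem s (ι k)) (0≤* (0≤ι k) (0≤sq s))) (*-monoˡ (1ℚ - s) h (bernoulli k h))
    where lem : ∀ s k → 1ℚ - (1ℚ + k) * s + k * (s * s) ≡ (1ℚ - s) * (1ℚ - k * s)
          lem = solve-∀ ℚ-ring

  bernoulli⁺ : ∀ {y} k → 0ℚ ≤ y → 1ℚ + ι k * y ≤ (1ℚ + y) ↑ k
  bernoulli⁺ {y} zero    h = ≤-reflexive (lem y)
    where lem : ∀ s → 1ℚ + 0ℚ * s ≡ 1ℚ
          lem = solve-∀ ℚ-ring
  bernoulli⁺ {y} (suc k) h = ≤-trans (≤-by (ι k * (y * y)) (lem y (ι k)) (0≤* (0≤ι k) (0≤sq y))) (*-monoˡ (1ℚ + y) (0≤+ 0≤1 h) (bernoulli⁺ k h))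
    where lem : ∀ s k → 1ℚ + (1ℚ + k) * s + k * (s * s) ≡ (1ℚ + s) * (1ℚ + k * s)
          lem = solve-∀ ℚ-ring

  ↑≤1 : ∀ {y} k → 0ℚ ≤ y → y ≤ 1ℚ → y ↑ k ≤ 1ℚ
  ↑≤1 {y} k 0≤y y≤1 = subst (y ↑ k ≤_) (1↑ k) (↑-mono k 0≤y y≤1)

  -- The bound (1 - y)^k ≤ 1/(1 + ky) without division: (1 - y)^k (1 + y)^k = (1 - y²)^k ≤ 1.
  bernoulli⁻ : ∀ {y} k → 0ℚ ≤ y → y ≤ 1ℚ → (1ℚ - y) ↑ k * (1ℚ + ι k * y) ≤ 1ℚ
  bernoulli⁻ {y} k 0≤y y≤1 = ≤-trans (*-monoˡ ((1ℚ - y) ↑ k) (0≤↑ k (0≤-diff y≤1)) (bernoulli⁺ k 0≤y))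
    (subst (_≤ 1ℚ) (↑-*-dist (1ℚ - y) (1ℚ + y) k) (↑≤1 k (0≤* (0≤-diff y≤1) (0≤+ 0≤1 0≤y)) (≤-by (y * y) (lem y) (0≤sq y))))
    where lem : ∀ y → (1ℚ - y) * (1ℚ + y) + y * y ≡ 1ℚ
          lem = solve-∀ ℚ-ring

  module Extremal {n} (G : Graph n) where
    open OnGraph G

    density : (Fin n → Bool) → ℚ
    density W = e₂ W * (inv (sz W) * inv (sz W))

    -- The potential |U| p(U)^K with K = k + 1.
    ψ : ℕ → (Fin n → Bool) → ℚ
    ψ k W = density W ↑ suc k * sz W

    0≤density : ∀ W → 0ℚ ≤ density W
    0≤density W = 0≤* (0≤e₂ W) (0≤* (0≤inv (sz W)) (0≤inv (sz W)))

    density-sz : ∀ W → 0ℚ < sz W → density W * (sz W * sz W) ≡ e₂ W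
    density-sz W h = trans (lem (e₂ W) (inv (sz W)) (sz W)) (trans (cong (λ z → e₂ W * (z * z)) (inv-* h)) (lem′ (e₂ W)))
      where lem : ∀ e i w → e * (i * i) * (w * w) ≡ e * ((w * i) * (w * i))
            lem = solve-∀ ℚ-ring
            lem′ : ∀ e → e * (1ℚ * 1ℚ) ≡ e
            lem′ = solve-∀ ℚ-ring

    density≤1 : ∀ W → 0ℚ < sz W → density W ≤ 1ℚ
    density≤1 W h = cancel-≤ (sz W * sz W) (0<* h h)
      (subst₂ _≤_ (trans (sym (density-sz W h)) (*-comm (density W) (sz W * sz W))) (sym (*-identityʳ (sz W * sz W))) (e₂≤sz² W))

    -- Clearing denominators: comparisons of potentials become polynomial inequalities between edge
    -- counts and sizes.
    ψ-pow : ∀ k W → 0ℚ < sz W → ψ k W * sz W ↑ suc (k ℕ.+ k) ≡ e₂ W ↑ suc k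
    ψ-pow k W h = trans (*-assoc (density W ↑ suc k) (sz W) (sz W ↑ suc (k ℕ.+ k)))
      (trans (cong (λ z → density W ↑ suc k * z) (trans (cong (λ j → sz W ↑ suc j) (sym (ℕₚ.+-suc k k))) (trans (↑-+ (sz W) (suc k) (suc k)) (sym (↑-*-dist (sz W) (sz W) (suc k))))))
      (trans (sym (↑-*-dist (density W) (sz W * sz W) (suc k))) (cong (_↑ suc k) (density-sz W h))))

    ψ-cong : ∀ k {W W′} → W ≗ W′ → ψ k W ≡ ψ k W′
    ψ-cong k h = cong₂ (λ e s → (e * (inv s * inv s)) ↑ suc k * s) (e₂-cong h) (sz-cong h)

    sz-pos : ∀ W → 0ℚ < e₂ W → 0ℚ < sz W
    sz-pos W h with ≤⊎> (sz W) 0ℚ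
    ... | inj₂ p = p
    ... | inj₁ p = ⊥-elim (<⇒¬≤ h (≤-trans (e₂≤sz² W) (≤-trans (*-monoˡ (sz W) (0≤sz W) p) (≤-reflexive (*-zeroʳ (sz W))))))

    sz-mono : ∀ {W S} → W ⊑ S → sz W ≤ sz S
    sz-mono {W} {S} h = ∑-mono (λ x → go x (W x) refl)
      where go : ∀ x b → W x ≡ b → 𝟙 (W x) ≤ 𝟙 (S x)
            go x true  e = ≤-reflexive (trans (cong 𝟙 e) (sym (cong 𝟙 (h x e))))
            go x false e = subst (_≤ 𝟙 (S x)) (sym (cong 𝟙 e)) (0≤𝟙 (S x))

    record IsExtremal (k : ℕ) (S U : Fin n → Bool) : Set where
      field
        U⊑S  : U ⊑ S
        e>0  : 0ℚ < e₂ U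
        best : ∀ W → W ⊑ S → ψ k W ≤ ψ k U

    extremal-exists : ∀ k S → 0ℚ < e₂ S → ∃[ U ] IsExtremal k S U
    extremal-exists k S eS>0 = U , record { U⊑S = U⊑S ; e>0 = e>0 ; best = best }
      where
        _∩S : (Fin n → Bool) → Fin n → Bool
        (W ∩S) x = W x ∧ S x
        -- Intersecting with S turns a maximum over subsets of S into one over all vertex sets.
        φ : (Fin n → Bool) → ℚ
        φ W = ψ k (W ∩S)
        m : ∃[ y ] (∀ z → φ z ≤ φ y)
        m = argmax-colouring φ (λ h → ψ-cong k (λ x → cong (_∧ S x) (h x)))
        U : Fin n → Bool
        U = proj₁ m ∩S
        U⊑S : U ⊑ S
        U⊑S x h with proj₁ m x
        ... | true = h
        best : ∀ W → W ⊑ S → ψ k W ≤ ψ k U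
        best W W⊑S = subst (_≤ ψ k U) (ψ-cong k (λ x → go x (W x) refl)) (proj₂ m W)
          where go : ∀ x b → W x ≡ b → W x ∧ S x ≡ W x
                go x true  e = trans (cong (_∧ S x) e) (trans (W⊑S x e) (sym e))
                go x false e = trans (cong (_∧ S x) e) (sym e)
        sS>0 : 0ℚ < sz S
        sS>0 = sz-pos S eS>0
        ψS>0 : 0ℚ < ψ k S
        ψS>0 = 0<* (0<↑ (suc k) (0<* eS>0 (0<* (0<inv sS>0) (0<inv sS>0)))) sS>0
        ψU>0 : 0ℚ < ψ k U
        ψU>0 = <-≤-trans ψS>0 (best S (λ _ h → h))
        e>0 : 0ℚ < e₂ U
        e>0 with ≤⊎> (e₂ U) 0ℚ
        ... | inj₂ p = p
        ... | inj₁ p = ⊥-elim (<⇒¬≤ ψU>0 (≤-reflexive (trans (cong (λ e → (e * (inv (sz U) * inv (sz U))) ↑ suc k * sz U) (≤-antisym p (0≤e₂ U)))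
                         (lem (inv (sz U) * inv (sz U)) ((0ℚ * (inv (sz U) * inv (sz U))) ↑ k) (sz U)))))
          where lem : ∀ i z s → 0ℚ * i * z * s ≡ 0ℚ
                lem = solve-∀ ℚ-ring

    module Consequences (k : ℕ) (S U : Fin n → Bool) (ext : IsExtremal k S U) where
      open IsExtremal ext

      u E q u⁻¹ : ℚ
      u   = sz U
      E   = e₂ U
      q   = density U
      u⁻¹ = inv u

      u>0 : 0ℚ < u
      u>0 = sz-pos U e>0

      q>0 : 0ℚ < q
      q>0 = 0<* e>0 (0<* (0<inv u>0) (0<inv u>0))

      E≡ : E ≡ q * (u * u)
      E≡ = sym (density-sz U u>0)

      sub : ∀ {W} → W ⊑ U → W ⊑ S
      sub h x e = U⊑S x (h x e)

      remove-bound : ∀ x → U x ≡ true → 1ℚ < u → (1ℚ - 2ℚ * deg U x * inv E) ↑ suc k ≤ (1ℚ - u⁻¹) ↑ suc (k ℕ.+ k)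
      remove-bound x Ux 1<u = cancel-≤ (E ↑ suc k) (0<↑ (suc k) e>0)
        (subst₂ _≤_ (trans (cong (_↑ suc k) eW) (↑-*-dist E s (suc k))) rhs
          (subst (_≤ ψ k U * w ↑ c) (ψ-pow k W w>0) (*-monoʳ (w ↑ c) (0≤↑ c (<⇒≤ w>0)) (best W (sub (remove⊑ x U))))))
        where
          W : Fin n → Bool
          W = remove x U
          c : ℕ
          c = suc (k ℕ.+ k)
          w s y : ℚ
          w = sz W
          s = 1ℚ - 2ℚ * deg U x * inv E
          y = 1ℚ - u⁻¹
          w≡ : w ≡ u * y
          w≡ = trans (sz-remove x U Ux) (trans (cong (_-_ u) (sym (inv-* u>0))) (lem u u⁻¹))
            where lem : ∀ u i → u - u * i ≡ u * (1ℚ - i)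
                  lem = solve-∀ ℚ-ring
          w>0 : 0ℚ < w
          w>0 = subst (0ℚ <_) (sym (sz-remove x U Ux)) (subst (_< u - 1ℚ) (+-inverseʳ 1ℚ) (+-monoˡ-< (- 1ℚ) 1<u))
          eW : e₂ W ≡ E * s
          eW = trans (e₂-remove x U) (trans (cong (_-_ E) (trans (sym (*-identityʳ (2ℚ * deg U x))) (cong (2ℚ * deg U x *_) (sym (inv-* e>0))))) (lem E (2ℚ * deg U x) (inv E)))
            where lem : ∀ e d i → e - d * (e * i) ≡ e * (1ℚ - d * i)
                  lem = solve-∀ ℚ-ring
          rhs : ψ k U * w ↑ c ≡ E ↑ suc k * y ↑ c
          rhs = trans (cong (ψ k U *_) (trans (cong (_↑ c) w≡) (↑-*-dist u y c))) (trans (sym (*-assoc (ψ k U) (u ↑ c) (y ↑ c))) (cong (_* y ↑ c) (ψ-pow k U u>0)))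

      -- Deleting x multiplies the edge count by 1 - s, s = 2 deg/E, and the size by 1 - 1/u, so
      -- optimality reads (1 - s)^(k+1) ≤ (1 - 1/u)^(2k+1). To first order (k + 1)s ≥ (2k + 1)/u;
      -- giving up one of the 2k + 1 pays for the second order as soon as u ≥ 2k(2k + 1).
      min-degree : ι (2 ℕ.* k ℕ.* suc (2 ℕ.* k)) ≤ u → 1ℚ < u → ∀ x → U x ≡ true → ι k * (E * u⁻¹) ≤ ι (suc k) * deg U x
      min-degree large 1<u x Ux = cancel-≤ (2ℚ * inv E) (0<* 0<2 (0<inv e>0))
        (subst₂ _≤_ (sym (trans (lem₁ (inv E) (ι k) E u⁻¹) (trans (cong (λ z → 2ℚ * (ι k * (z * u⁻¹))) (inv-* e>0)) (cong (λ z → 2ℚ * (ι k * z)) (*-identityˡ u⁻¹)))))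
                    (lem₂ (inv E) (ι (suc k)) (deg U x))
          (cancel-≤ (1ℚ + C * y) 0<1+Cy (≤-trans s₂ s₁)))
        where
          K C y s : ℚ
          K = ι (suc k)
          C = ι (suc (k ℕ.+ k))
          y = u⁻¹
          s = 2ℚ * deg U x * inv E
          lem₁ : ∀ e k E i → 2ℚ * e * (k * (E * i)) ≡ 2ℚ * (k * (E * e * i))
          lem₁ = solve-∀ ℚ-ring
          lem₂ : ∀ e k d → k * (2ℚ * d * e) ≡ 2ℚ * e * (k * d)
          lem₂ = solve-∀ ℚ-ring
          0≤y : 0ℚ ≤ y
          0≤y = 0≤inv u
          y≤1 : y ≤ 1ℚ
          y≤1 = cancel-≤ u u>0 (subst₂ _≤_ (sym (inv-* u>0)) (sym (*-identityʳ u)) (<⇒≤ 1<u))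
          0≤1-s : 0ℚ ≤ 1ℚ - s
          0≤1-s = cancel-≤ E e>0 (subst₂ _≤_ (sym (*-zeroʳ E)) eq (0≤e₂ (remove x U)))
            where
              lem : ∀ e d i → e - d * (e * i) ≡ e * (1ℚ - d * i)
              lem = solve-∀ ℚ-ring
              eq : e₂ (remove x U) ≡ E * (1ℚ - s)
              eq = trans (e₂-remove x U) (trans (cong (_-_ E) (trans (sym (*-identityʳ (2ℚ * deg U x))) (cong (2ℚ * deg U x *_) (sym (inv-* e>0))))) (lem E (2ℚ * deg U x) (inv E)))
          0<1+Cy : 0ℚ < 1ℚ + C * y
          0<1+Cy = 0<-≤ 0<1 (≤-by (C * y) refl (0≤* (0≤ι (suc (k ℕ.+ k))) 0≤y))
          prod : (1ℚ - K * s) * (1ℚ + C * y) ≤ 1ℚ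
          prod = ≤-trans (*-monoʳ (1ℚ + C * y) (<⇒≤ 0<1+Cy) (≤-trans (bernoulli (suc k) 0≤1-s) (remove-bound x Ux 1<u))) (bernoulli⁻ (suc (k ℕ.+ k)) 0≤y y≤1)
          s₁ : C * y ≤ (1ℚ + C * y) * (K * s)
          s₁ = ≤-from-diff (subst (0ℚ ≤_) (lem K s (C * y)) (0≤-diff prod))
            where lem : ∀ k s c → 1ℚ - (1ℚ - k * s) * (1ℚ + c) ≡ (1ℚ + c) * (k * s) - c
                  lem = solve-∀ ℚ-ring
          C≡ : C ≡ 1ℚ + 2ℚ * ι k
          C≡ = cong (1ℚ +_) (trans (ι-+ k k) (lem (ι k)))
            where lem : ∀ z → z + z ≡ 2ℚ * z
                  lem = solve-∀ ℚ-ring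
          2kC≡ : ι (2 ℕ.* k ℕ.* suc (2 ℕ.* k)) ≡ 2ℚ * ι k * C
          2kC≡ = trans (ι-* (2 ℕ.* k) (suc (2 ℕ.* k))) (trans (cong₂ _*_ (ι-* 2 k) (cong (1ℚ +_) (ι-* 2 k))) (cong (2ℚ * ι k *_) (sym C≡)))
          small : 2ℚ * ι k * C * y ≤ 1ℚ
          small = subst₂ _≤_ (cong (_* y) 2kC≡) (inv-* u>0) (*-monoʳ y 0≤y large)
          s₂ : (1ℚ + C * y) * (2ℚ * (ι k * y)) ≤ C * y
          s₂ = ≤-trans (≤-by (y * (1ℚ - 2ℚ * ι k * C * y)) (lem (ι k) C y) (0≤* 0≤y (0≤-diff small))) (≤-reflexive (cong (_* y) (sym C≡)))
            where lem : ∀ k c y → (1ℚ + c * y) * (2ℚ * (k * y)) + y * (1ℚ - 2ℚ * k * c * y) ≡ (1ℚ + 2ℚ * k) * y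
                  lem = solve-∀ ℚ-ring

      -- The left side is twice the number of edges inside the neighbourhood of x. Optimality
      -- against this neighbourhood gives p^(k+1) deg ≤ q^(k+1) u for its density p, and the last
      -- hypothesis turns this into p ≤ τ.
      triangle-bound : ∀ {τ} x → 0ℚ ≤ τ → 0ℚ < deg U x → q ↑ suc k * u ≤ τ ↑ suc k * deg U x →
        ∑ (λ y → a U x y * ∑ (λ z → a U y z * a U x z)) ≤ τ * (deg U x * deg U x)
      triangle-bound {τ} x 0≤τ d>0 h = subst (_≤ τ * (d * d)) (e₂-nbhd U x)
        (↑-cancel-≤ {e₂ W} {τ * (d * d)} k (0≤* 0≤τ (0≤sq d))
          (≤-trans (≤-reflexive (sym (trans (cong (λ z → ψ k W * z ↑ c) (sym (sz-nbhd U x))) (ψ-pow k W w>0))))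
          (≤-trans (*-monoʳ (d ↑ c) (0≤↑ c (<⇒≤ d>0)) (≤-trans (best W (sub (nbhd⊑ U x))) h))
            (≤-reflexive (trans (*-assoc (τ ↑ suc k) d (d ↑ c))
              (trans (cong (τ ↑ suc k *_) (trans (cong (λ j → d ↑ suc j) (sym (ℕₚ.+-suc k k))) (trans (↑-+ d (suc k) (suc k)) (sym (↑-*-dist d d (suc k))))))
                (sym (↑-*-dist τ (d * d) (suc k)))))))))
        where
          W : Fin n → Bool
          W = nbhd U x
          c : ℕ
          c = suc (k ℕ.+ k)
          d : ℚ
          d = deg U x
          w>0 : 0ℚ < sz W
          w>0 = subst (0ℚ <_) (sym (sz-nbhd U x)) d>0

  -- A dense set with positive semidefinite A + ℓ has a dense piece

  ½↑-2↑ : ∀ k → ½ ↑ k * 2ℚ ↑ k ≡ 1ℚ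
  ½↑-2↑ k = trans (sym (↑-*-dist ½ 2ℚ k)) (1↑ k)

  inv-2↑ : ∀ k → inv (2ℚ ↑ k) ≡ ½ ↑ k
  inv-2↑ k = inv-unique (0<↑ k 0<2) (trans (*-comm (2ℚ ↑ k) (½ ↑ k)) (½↑-2↑ k))

  0<½ : 0ℚ < ½
  0<½ = positive⁻¹ ½

  -- At N = 2^(8J) the relative truncation loss is F(N)/N with F(N) ≤ 32 N^(1/8); this is the origin
  -- of the exponents 7J below.
  scale-factor : ∀ J → inv (2ℚ ↑ (8 ℕ.* J)) * 2ℚ ↑ (5 ℕ.+ J) ≡ 2ℚ ↑ 5 * ½ ↑ (7 ℕ.* J)
  scale-factor J = trans (cong₂ _*_ (trans (inv-2↑ (8 ℕ.* J)) (↑-+ ½ J (7 ℕ.* J))) (↑-+ 2ℚ 5 J))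
    (trans (lem (½ ↑ J) (½ ↑ (7 ℕ.* J)) (2ℚ ↑ 5) (2ℚ ↑ J)) (trans (cong (_* (2ℚ ↑ 5 * ½ ↑ (7 ℕ.* J))) (½↑-2↑ J)) (*-identityˡ (2ℚ ↑ 5 * ½ ↑ (7 ℕ.* J)))))
    where lem : ∀ a b c d → a * b * (c * d) ≡ a * d * (c * b)
          lem = solve-∀ ℚ-ring

  module Factored {n} (G : Graph n) (S : Fin n → Bool) (ℓ : ℚ) (1≤ℓ : 1ℚ ≤ ℓ) (m : ℕ) (ℓ8≤ : ℓ ↑ 8 ≤ 2ℚ ↑ m)
                  {r} (B₀ : Mat n r) (gram₀ : ∀ x y → (B₀ · (B₀ ᵀ)) x y ≡ OnGraph.a G S x y + ℓ * δ x y) where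
    open OnGraph G
    open Extremal G

    0≤ℓ : 0ℚ ≤ ℓ
    0≤ℓ = ≤-trans 0≤1 1≤ℓ

    module Piece (k′ : ℕ) (S′ U : Fin n → Bool) (S′⊑S : S′ ⊑ S) (ext : IsExtremal (suc k′) S′ U)
                 (u-large : 8ℚ * ℓ ↑ 19 ≤ sz U) (u-large′ : ι (2 ℕ.* suc k′ ℕ.* suc (2 ℕ.* suc k′)) ≤ sz U) where
      open Consequences (suc k′) S′ U ext public

      private
        k : ℕ
        k = suc k′

      U⊑S : U ⊑ S
      U⊑S x e = S′⊑S x (IsExtremal.U⊑S ext x e)

      B : Mat n r
      B x j = 𝟙 (U x) * B₀ x j

      US : ∀ x → 𝟙 (U x) * 𝟙 (S x) ≡ 𝟙 (U x)
      US x = go (U x) refl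
        where go : ∀ b → U x ≡ b → 𝟙 (U x) * 𝟙 (S x) ≡ 𝟙 (U x)
              go true  e = trans (cong (𝟙 (U x) *_) (cong 𝟙 (U⊑S x e))) (*-identityʳ (𝟙 (U x)))
              go false e = trans (cong (λ b → 𝟙 b * 𝟙 (S x)) e) (trans (*-zeroˡ (𝟙 (S x))) (sym (cong 𝟙 e)))

      𝟙δ : ∀ x y → 𝟙 (U x) * (𝟙 (U y) * δ x y) ≡ 𝟙 (U x) * δ x y
      𝟙δ x y = lem x y (λ z → 𝟙 (U z)) (λ z → 𝟙² (U z))
        where
          lem : ∀ {l} (x y : Fin l) (f : Fin l → ℚ) → (∀ z → f z * f z ≡ f z) → f x * (f y * δ x y) ≡ f x * δ x y
          lem zero    zero    f h = trans (sym (*-assoc (f zero) (f zero) 1ℚ)) (cong (_* 1ℚ) (h zero))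
          lem zero    (suc y) f h = cong (f zero *_) (*-zeroʳ (f (suc y)))
          lem (suc x) zero    f h = cong (f (suc x) *_) (*-zeroʳ (f zero))
          lem (suc x) (suc y) f h = lem x y (f ∘ suc) (h ∘ suc)

      B-gram : ∀ x y → (B · (B ᵀ)) x y ≡ a U x y + ℓ * (𝟙 (U x) * δ x y)
      B-gram x y = trans (∑-cong (λ j → lem (𝟙 (U x)) (B₀ x j) (𝟙 (U y)) (B₀ y j)))
        (trans (∑-*ˡ (𝟙 (U x) * 𝟙 (U y)) (λ j → B₀ x j * B₀ y j))
        (trans (cong (𝟙 (U x) * 𝟙 (U y) *_) (gram₀ x y))
        (trans (lem₂ (𝟙 (U x)) (𝟙 (U y)) (𝟙 (S x)) (𝟙 (S y)) (A x y) ℓ (δ x y))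
        (cong₂ _+_ (cong₂ (λ p q → p * (q * A x y)) (US x) (US y)) (cong (ℓ *_) (𝟙δ x y))))))
        where
          lem : ∀ p b q c → p * b * (q * c) ≡ p * q * (b * c)
          lem = solve-∀ ℚ-ring
          lem₂ : ∀ p q s t a l d → p * q * (s * (t * a) + l * d) ≡ p * s * (q * t * a) + l * (p * (q * d))
          lem₂ = solve-∀ ℚ-ring

      B-row : ∀ x j → 𝟙 (U x) * B x j ≡ B x j
      B-row x j = trans (sym (*-assoc (𝟙 (U x)) (𝟙 (U x)) (B₀ x j))) (cong (_* B₀ x j) (𝟙² (U x)))

      module Disp = Dispersion B U (a U) u ℓ (a-sym U) (a² U) (a-diag U) (a-row U) (a≤1 U) B-gram B-row refl u>0 1≤ℓ u-large m ℓ8≤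

      κₖ D dmin g : ℚ
      κₖ   = ι k * inv (ι (suc k))
      D    = E * u⁻¹
      dmin = κₖ * D
      g    = 2ℚ * inv (q * u)

      0<K : 0ℚ < ι (suc k)
      0<K = 0<ι {suc k} (ℕ.s≤s ℕ.z≤n)

      D≡qu : D ≡ q * u
      D≡qu = trans (cong (_* u⁻¹) E≡) (trans (lem q u u⁻¹) (trans (cong (q * u *_) (inv-* u>0)) (*-identityʳ (q * u))))
        where lem : ∀ q u i → q * (u * u) * i ≡ q * u * (u * i)
              lem = solve-∀ ℚ-ring

      qu>0 : 0ℚ < q * u
      qu>0 = 0<* q>0 u>0

      D>0 : 0ℚ < D
      D>0 = subst (0ℚ <_) (sym D≡qu) qu>0

      ½≤κₖ : ½ ≤ κₖ
      ½≤κₖ = cancel-≤ (ι (suc k)) 0<K (subst (ι (suc k) * ½ ≤_) (trans (sym (*-identityʳ (ι k))) (trans (cong (ι k *_) (sym (inv-* 0<K))) (lem (ι k) (ι (suc k)) (inv (ι (suc k))))))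
                (≤-by (½ * ι k′) (lem₂ (ι k′)) (0≤* 0≤½ (0≤ι k′))))
        where lem : ∀ k s i → k * (s * i) ≡ s * (k * i)
              lem = solve-∀ ℚ-ring
              lem₂ : ∀ k → (1ℚ + (1ℚ + k)) * ½ + ½ * k ≡ 1ℚ + k
              lem₂ = solve-∀ ℚ-ring

      ½qu≤dmin : ½ * (q * u) ≤ dmin
      ½qu≤dmin = subst (λ z → ½ * z ≤ dmin) D≡qu (*-monoʳ D (<⇒≤ D>0) ½≤κₖ)

      ½qu>0 : 0ℚ < ½ * (q * u)
      ½qu>0 = 0<* 0<½ qu>0

      dmin>0 : 0ℚ < dmin
      dmin>0 = 0<-≤ ½qu>0 ½qu≤dmin

      1<u : 1ℚ < u
      1<u = <-≤-trans (subst (1ℚ <_) refl (≤-<-trans (≤ᵇ⇒≤ {1ℚ} {ι 5} tt) (ι-mono-< {5} {6} (ℕₚ.≤-refl)))) (≤-trans (ι-mono {6} le) u-large′)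
        where le : 6 ℕ.≤ 2 ℕ.* suc k′ ℕ.* suc (2 ℕ.* suc k′)
              le = ℕₚ.*-mono-≤ {2} {2 ℕ.* suc k′} {3} (ℕₚ.*-monoʳ-≤ 2 {1} (ℕ.s≤s ℕ.z≤n)) (ℕ.s≤s (ℕₚ.*-monoʳ-≤ 2 {1} (ℕ.s≤s ℕ.z≤n)))

      dmin≤ : ∀ x → U x ≡ true → dmin ≤ deg U x
      dmin≤ x Ux = cancel-≤ (ι (suc k)) 0<K (subst (_≤ ι (suc k) * deg U x)
          (sym (trans (lem (ι (suc k)) (ι k) (inv (ι (suc k))) D) (trans (cong (λ z → z * (ι k * D)) (inv-* 0<K)) (*-identityˡ (ι k * D))))) (min-degree u-large′ 1<u x Ux))
        where lem : ∀ s k i d → s * (k * i * d) ≡ s * i * (k * d)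
              lem = solve-∀ ℚ-ring

      γ≤g : inv dmin ≤ g
      γ≤g = subst (inv dmin ≤_) (inv-unique ½qu>0 (trans (lem (q * u) (inv (q * u))) (inv-* qu>0))) (inv-anti ½qu>0 ½qu≤dmin)
        where lem : ∀ z i → ½ * z * (2ℚ * i) ≡ z * i
              lem = solve-∀ ℚ-ring

      -- The dispersion inequality for extremal U. Minimum degree (1 - 1/(k+1))qu turns the norm
      -- bound into τ - q + 2q/(k+1), and η collects all terms with ℓ. The factor 2 in the condition
      -- on τ pays for using only deg ≥ qu/2 in `triangle-bound`.
      key : ∀ j {τ L η} → 0ℚ ≤ τ → 2ℚ * q ↑ suc k ≤ τ ↑ suc k * q →
        3ℚ * ℓ * g + ℓ ↑ 3 * (g * g) + ℓ * u⁻¹ ≤ η → 0ℚ ≤ L →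
        L ≤ 1ℚ - q - η - 4ℚ * inv q * (2ℚ ↑ 5 * ½ ↑ (7 ℕ.* suc j)) →
        0ℚ ≤ τ - q + 2ℚ * q * inv (ι (suc k)) + η →
        L * L ≤ 2ℚ ↑ (5 ℕ.+ suc j) * (τ - q + 2ℚ * q * inv (ι (suc k)) + η)
      key j {τ} {L} {η} 0≤τ hτ hη 0≤L hL 0≤V′ = At.dispersion j 0≤V′ V≤ 0≤L L≤
        where
          d>0 : ∀ x → U x ≡ true → 0ℚ < deg U x
          d>0 x e = 0<-≤ dmin>0 (dmin≤ x e)
          τ-cond : ∀ x → U x ≡ true → q ↑ suc k * u ≤ τ ↑ suc k * deg U x
          τ-cond x e = ≤-trans (subst (q ↑ suc k * u ≤_) (lem₂ (τ ↑ suc k) q u)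
                         (subst (_≤ ½ * (τ ↑ suc k * q) * u) (lem (q ↑ suc k) u) (*-monoʳ u (<⇒≤ u>0) (*-monoˡ ½ 0≤½ hτ))))
                         (*-monoˡ (τ ↑ suc k) (0≤↑ (suc k) 0≤τ) (≤-trans ½qu≤dmin (dmin≤ x e)))
            where lem : ∀ z u → ½ * (2ℚ * z) * u ≡ z * u
                  lem = solve-∀ ℚ-ring
                  lem₂ : ∀ t q u → ½ * (t * q) * u ≡ t * (½ * (q * u))
                  lem₂ = solve-∀ ℚ-ring
          module At = Disp.At dmin dmin>0 dmin≤ τ (λ x e → triangle-bound x 0≤τ (d>0 x e) (τ-cond x e))
          0≤γ : 0ℚ ≤ inv dmin
          0≤γ = 0≤inv dmin
          0≤g : 0ℚ ≤ g
          0≤g = ≤-trans 0≤γ γ≤g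
          mean : u⁻¹ * u⁻¹ * (E + ℓ * u) ≡ q + ℓ * u⁻¹
          mean = trans (lem u⁻¹ E ℓ u) (trans (cong (λ z → q + ℓ * (z * u⁻¹)) (inv-* u>0)) (lem₂ q ℓ u⁻¹))
            where
              lem : ∀ i e l u → i * i * (e + l * u) ≡ e * (i * i) + l * (u * i * i)
              lem = solve-∀ ℚ-ring
              lem₂ : ∀ q l i → q + l * (1ℚ * i) ≡ q + l * i
              lem₂ = solve-∀ ℚ-ring
          u⁻¹dmin : u⁻¹ * dmin ≡ κₖ * q
          u⁻¹dmin = trans (cong (λ z → u⁻¹ * (κₖ * z)) D≡qu) (trans (lem u⁻¹ κₖ q u) (trans (cong (κₖ * q *_) (inv-* u>0)) (*-identityʳ (κₖ * q))))
            where lem : ∀ i k q u → i * (k * (q * u)) ≡ k * q * (u * i)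
                  lem = solve-∀ ℚ-ring
          κ-eq : q - 2ℚ * (κₖ * q) ≡ 2ℚ * q * inv (ι (suc k)) - q
          κ-eq = trans (lem q (ι k) (inv (ι (suc k)))) (trans (cong (λ z → 2ℚ * q * inv (ι (suc k)) + q - 2ℚ * q * z) (inv-* 0<K)) (lem₂ q (inv (ι (suc k)))))
            where lem : ∀ q k i → q - 2ℚ * (k * i * q) ≡ 2ℚ * q * i + q - 2ℚ * q * ((1ℚ + k) * i)
                  lem = solve-∀ ℚ-ring
                  lem₂ : ∀ q i → 2ℚ * q * i + q - 2ℚ * q * 1ℚ ≡ 2ℚ * q * i - q
                  lem₂ = solve-∀ ℚ-ring
          V≡ : At.V ≡ τ + (3ℚ * ℓ * inv dmin + ℓ ↑ 3 * (inv dmin * inv dmin)) + (2ℚ * q * inv (ι (suc k)) - q + ℓ * u⁻¹)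
          V≡ = cong (τ + (3ℚ * ℓ * inv dmin + ℓ ↑ 3 * (inv dmin * inv dmin)) +_)
                 (trans (cong₂ (λ x y → x - 2ℚ * y) mean u⁻¹dmin) (trans (lem q (ℓ * u⁻¹) (2ℚ * (κₖ * q))) (cong (_+ ℓ * u⁻¹) κ-eq)))
            where lem : ∀ q l z → q + l - z ≡ q - z + l
                  lem = solve-∀ ℚ-ring
          V≤ : At.V ≤ τ - q + 2ℚ * q * inv (ι (suc k)) + η
          V≤ = subst (_≤ τ - q + 2ℚ * q * inv (ι (suc k)) + η) (sym V≡)
                 (≤-trans (+-monoˡ-≤ (2ℚ * q * inv (ι (suc k)) - q + ℓ * u⁻¹) (+-monoʳ-≤ τ (+-mono-≤ (*-monoˡ (3ℚ * ℓ) (0≤* (nonNegative⁻¹ 3ℚ) 0≤ℓ) γ≤g)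
                             (*-monoˡ (ℓ ↑ 3) (0≤↑ 3 0≤ℓ) (*-mono 0≤γ 0≤g γ≤g γ≤g)))))
                 (≤-by (η - (3ℚ * ℓ * g + ℓ ↑ 3 * (g * g) + ℓ * u⁻¹)) (lem τ (3ℚ * ℓ * g) (ℓ ↑ 3 * (g * g)) (2ℚ * q * inv (ι (suc k))) q (ℓ * u⁻¹) η) (0≤-diff hη)))
            where lem : ∀ t x y z q l h → t + (x + y) + (z - q + l) + (h - (x + y + l)) ≡ t - q + z + h
                  lem = solve-∀ ℚ-ring
          ℓu⁻¹≤η : ℓ * u⁻¹ ≤ η
          ℓu⁻¹≤η = ≤-trans (≤-by (3ℚ * ℓ * g + ℓ ↑ 3 * (g * g)) (+-comm (ℓ * u⁻¹) (3ℚ * ℓ * g + ℓ ↑ 3 * (g * g)))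
                     (0≤+ (0≤* (0≤* (nonNegative⁻¹ 3ℚ) 0≤ℓ) 0≤g) (0≤* (0≤↑ 3 0≤ℓ) (0≤sq g)))) hη
          Z : ℚ
          Z = 2ℚ ↑ 5 * ½ ↑ (7 ℕ.* suc j)
          0≤Z : 0ℚ ≤ Z
          0≤Z = 0≤* (0≤↑ 5 0≤2) (0≤↑ (7 ℕ.* suc j) 0≤½)
          i₈ b : ℚ
          i₈ = inv (2ℚ ↑ (8 ℕ.* suc j))
          b  = 2ℚ ↑ (5 ℕ.+ suc j)
          gu : g * (2ℚ * u) ≡ 4ℚ * inv q
          gu = trans (cong (λ z → 2ℚ * z * (2ℚ * u)) (inv-unique qu>0 (trans (lem q u (inv q) u⁻¹) (trans (cong₂ _*_ (inv-* q>0) (inv-* u>0)) refl))))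
               (trans (lem₂ (inv q) u⁻¹ u) (trans (cong (4ℚ * inv q *_) (inv-* u>0)) (*-identityʳ (4ℚ * inv q))))
            where lem : ∀ q u a b → q * u * (a * b) ≡ (q * a) * (u * b)
                  lem = solve-∀ ℚ-ring
                  lem₂ : ∀ a b u → 2ℚ * (a * b) * (2ℚ * u) ≡ 4ℚ * a * (u * b)
                  lem₂ = solve-∀ ℚ-ring
          tail≤ : inv dmin * (2ℚ * u * i₈ * b) ≤ 4ℚ * inv q * Z
          tail≤ = subst₂ _≤_ (trans (cong (λ z → inv dmin * (2ℚ * u) * z) (sym (scale-factor (suc j)))) (lem (inv dmin) u i₈ b)) (cong (_* Z) gu)
                    (*-monoʳ Z 0≤Z (*-monoʳ (2ℚ * u) (0≤* 0≤2 (<⇒≤ u>0)) γ≤g))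
            where lem : ∀ d u i b → d * (2ℚ * u) * (i * b) ≡ d * (2ℚ * u * i * b)
                  lem = solve-∀ ℚ-ring
          L≤ : L ≤ 1ℚ - inv dmin * (2ℚ * u * i₈ * b) - u⁻¹ * u⁻¹ * (E + ℓ * u)
          L≤ = ≤-trans hL (subst (1ℚ - q - η - 4ℚ * inv q * Z ≤_) (cong (_-_ (1ℚ - inv dmin * (2ℚ * u * i₈ * b))) (sym mean))
                 (≤-by ((η - ℓ * u⁻¹) + (4ℚ * inv q * Z - inv dmin * (2ℚ * u * i₈ * b))) (lem q η (4ℚ * inv q * Z) (ℓ * u⁻¹) (inv dmin * (2ℚ * u * i₈ * b)))
                   (0≤+ (0≤-diff ℓu⁻¹≤η) (0≤-diff tail≤))))
            where lem : ∀ q h z l t → 1ℚ - q - h - z + ((h - l) + (z - t)) ≡ 1ℚ - t - (q + l)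
                  lem = solve-∀ ℚ-ring

  -- From density 1/T to constant density, and on to density 1 - ε

  least : ∀ {P : ℕ → Set} → (∀ j → Dec (P j)) → ∀ m → P m → ∃[ j ] (P j × (∀ i → j ≡ suc i → ¬ P i))
  least P? zero    p = zero , p , λ i ()
  least P? (suc m) p with P? m
  ... | yes q = least P? m q
  ... | no ¬q = suc m , p , λ { i refl → ¬q }

  ½≤1 : ½ ≤ 1ℚ
  ½≤1 = ≤ᵇ⇒≤ tt

  ½↑-anti : ∀ {i j} → i ℕ.≤ j → ½ ↑ j ≤ ½ ↑ i
  ½↑-anti {j = j} ℕ.z≤n   = ↑≤1 j 0≤½ ½≤1
  ½↑-anti (ℕ.s≤s i≤j)     = *-monoˡ ½ 0≤½ (½↑-anti i≤j)

  2↑-shift : ∀ i j → 2ℚ ↑ i * ½ ↑ (i ℕ.+ j) ≡ ½ ↑ j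
  2↑-shift i j = trans (cong (2ℚ ↑ i *_) (↑-+ ½ i j)) (trans (lem (2ℚ ↑ i) (½ ↑ i) (½ ↑ j)) (trans (cong (_* ½ ↑ j) (½↑-2↑ i)) (*-identityˡ (½ ↑ j))))
    where lem : ∀ a b c → a * (b * c) ≡ b * a * c
          lem = solve-∀ ℚ-ring

  module Phases {n} (G : Graph n) (S : Fin n → Bool) (ℓ : ℚ) (1≤ℓ : 1ℚ ≤ ℓ) (m : ℕ) (ℓ8≤ : ℓ ↑ 8 ≤ 2ℚ ↑ m)
                  {r} (B₀ : Mat n r) (gram₀ : ∀ x y → (B₀ · (B₀ ᵀ)) x y ≡ OnGraph.a G S x y + ℓ * δ x y) where
    open OnGraph G
    open Extremal G
    open Factored G S ℓ 1≤ℓ m ℓ8≤ B₀ gram₀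

    error : ℚ → ℚ → ℚ
    error q u = 3ℚ * ℓ * (2ℚ * inv (q * u)) + ℓ ↑ 3 * ((2ℚ * inv (q * u)) * (2ℚ * inv (q * u))) + ℓ * inv u

    module Phase₁ (U : Fin n → Bool) (ext : IsExtremal 1 S U) (u-large : 8ℚ * ℓ ↑ 19 ≤ sz U) (u-large′ : ι 6 ≤ sz U)
                  (T η : ℚ) (1≤T : 1ℚ ≤ T) (m₁ : ℕ) (2T≤ : 2ℚ * T ≤ 2ℚ ↑ m₁) (1≤2Tq : 1ℚ ≤ 2ℚ * T * density U)
                  (error≤ : error (density U) (sz U) ≤ η) (η≤ : η ≤ 1/16ℚ) (Tη≤ : 2ℚ ↑ 12 * T * η ≤ 1/16ℚ) (0≤η : 0ℚ ≤ η) where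

      open Piece 0 S U (λ _ e → e) ext u-large u-large′ using (q; u; q>0; key)

      -- With J = 7 + j, this says that the truncation at 2^(8J) loses at most 1/4 at density q. The
      -- least such j is wanted because its minimality bounds q from above in terms of J.
      P : ℕ → Set
      P j = 2ℚ ↑ 9 * ½ ↑ (7 ℕ.* (7 ℕ.+ j)) ≤ q

      P? : ∀ j → Dec (P j)
      P? j = (2ℚ ↑ 9 * ½ ↑ (7 ℕ.* (7 ℕ.+ j))) ≤? q

      0≤T : 0ℚ ≤ T
      0≤T = ≤-trans 0≤1 1≤T

      index≡ : ∀ i → 7 ℕ.* (7 ℕ.+ i) ≡ 9 ℕ.+ (40 ℕ.+ 7 ℕ.* i)
      index≡ i = ℕₚ.*-distribˡ-+ 7 7 i

      P-eventually : P m₁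
      P-eventually = ≤-trans (≤-reflexive (trans (cong (λ z → 2ℚ ↑ 9 * ½ ↑ z) (index≡ m₁)) (2↑-shift 9 (40 ℕ.+ 7 ℕ.* m₁))))
        (≤-trans (½↑-anti {m₁} (ℕₚ.≤-trans (ℕₚ.m≤n*m m₁ 7) (ℕₚ.m≤n+m (7 ℕ.* m₁) 40)))
          (cancel-≤ (2ℚ ↑ m₁) (0<↑ m₁ 0<2) (≤-trans (≤-reflexive (trans (*-comm (2ℚ ↑ m₁) (½ ↑ m₁)) (½↑-2↑ m₁)))
            (≤-trans 1≤2Tq (*-monoʳ q (<⇒≤ q>0) 2T≤)))))

      module At-scale (q< : q < ½ ↑ 31) (j : ℕ) (Pj : P j) (¬P : ∀ i → j ≡ suc i → ¬ P i) where
        J : ℕ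
        J = 7 ℕ.+ j

        -- Chosen so that 2^(5+J) τ = 1/8, below the target L² = 1/4.
        τ : ℚ
        τ = ½ ↑ (8 ℕ.+ J)

        q<previous : ∀ i → j ≡ suc i → q < ½ ↑ (40 ℕ.+ 7 ℕ.* i)
        q<previous i e = subst (q <_) (trans (cong (λ z → 2ℚ ↑ 9 * ½ ↑ z) (index≡ i)) (2↑-shift 9 (40 ℕ.+ 7 ℕ.* i))) (≰⇒> (¬P i e))

        -- This is 2q ≤ τ², the condition on the neighbourhoods for K = 2. For j = 0 it reads q ≤
        -- 2^(-31), and 31 = 17 + 2 · 7 is the source of that constant. For j = i + 1 minimality
        -- gives the stronger q < 2^(-(40 + 7i)).
        q-upper : ∀ j′ → j ≡ j′ → q ≤ ½ ↑ (17 ℕ.+ ((7 ℕ.+ j′) ℕ.+ (7 ℕ.+ j′)))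
        q-upper zero    e = <⇒≤ q<
        q-upper (suc i) e = ≤-trans (<⇒≤ (q<previous i e)) (½↑-anti {17 ℕ.+ ((8 ℕ.+ i) ℕ.+ (8 ℕ.+ i))} {40 ℕ.+ 7 ℕ.* i} le)
          where
            le : 17 ℕ.+ ((8 ℕ.+ i) ℕ.+ (8 ℕ.+ i)) ℕ.≤ 40 ℕ.+ 7 ℕ.* i
            le = subst (ℕ._≤ 40 ℕ.+ 7 ℕ.* i) (eq i) (ℕₚ.+-mono-≤ {33} {40} (ℕₚ.m≤m+n 33 7) (ℕₚ.*-monoˡ-≤ i {2} {7} (ℕ.s≤s (ℕ.s≤s ℕ.z≤n))))
              where
                eq : ∀ i → 33 ℕ.+ 2 ℕ.* i ≡ 17 ℕ.+ ((8 ℕ.+ i) ℕ.+ (8 ℕ.+ i))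
                eq = ℕ-solve-∀

        -- Minimality makes 1/q exceed 2^(40 + 7i), while 1/q ≤ 2T. So the scale stays below a
        -- multiple of T, and the error η, amplified by 2^(5+J), remains small.
        2↑J≤ : ∀ j′ → j ≡ j′ → 2ℚ ↑ (7 ℕ.+ j′) ≤ 2ℚ ↑ 7 * T
        2↑J≤ zero    e = subst (_≤ 2ℚ ↑ 7 * T) (*-identityʳ (2ℚ ↑ 7)) (*-monoˡ (2ℚ ↑ 7) (0≤↑ 7 0≤2) 1≤T)
        2↑J≤ (suc i) e = ≤-trans (↑-mono-exp {2ℚ} {8 ℕ.+ i} {X} 1≤2 (ℕₚ.+-mono-≤ {8} {40} (ℕₚ.m≤m+n 8 32) (ℕₚ.m≤n*m i 7)))
            (≤-trans (cancel-≤ (½ ↑ X) (0<↑ X 0<½) (subst₂ _≤_ (sym (½↑-2↑ X)) (*-comm (2ℚ * T) (½ ↑ X))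
              (≤-trans 1≤2Tq (*-monoˡ (2ℚ * T) (0≤* 0≤2 0≤T) (<⇒≤ (q<previous i e))))))
              (*-monoʳ T 0≤T (≤ᵇ⇒≤ {2ℚ} {2ℚ ↑ 7} tt)))
          where X : ℕ
                X = 40 ℕ.+ 7 ℕ.* i

        τ²≡ : τ ↑ 2 ≡ ½ ↑ (16 ℕ.+ (J ℕ.+ J))
        τ²≡ = trans (↑-↑ ½ (8 ℕ.+ J) 2) (cong (½ ↑_) (eq J))
          where eq : ∀ J → 2 ℕ.* (8 ℕ.+ J) ≡ 16 ℕ.+ (J ℕ.+ J)
                eq = ℕ-solve-∀

        τ-condition : 2ℚ * q ↑ 2 ≤ τ ↑ 2 * q
        τ-condition = subst₂ _≤_ (lem q) (cong (_* q) (sym τ²≡)) (*-monoʳ q (<⇒≤ q>0)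
            (subst (2ℚ * q ≤_) (2↑-shift 1 (16 ℕ.+ (J ℕ.+ J))) (*-monoˡ 2ℚ 0≤2 (q-upper j refl))))
          where lem : ∀ q → 2ℚ * q * q ≡ 2ℚ * (q * (q * 1ℚ))
                lem = solve-∀ ℚ-ring

        V′≡ : τ - q + 2ℚ * q * inv (ι 2) + η ≡ τ + η
        V′≡ = trans (cong (λ z → τ - q + 2ℚ * q * z + η) (inv-unique {ι 2} {½} (0<ι {2} (ℕ.s≤s ℕ.z≤n)) refl)) (lem τ q η)
          where lem : ∀ t q h → t - q + 2ℚ * q * ½ + h ≡ t + h
                lem = solve-∀ ℚ-ring

        0≤τ : 0ℚ ≤ τ
        0≤τ = 0≤↑ (8 ℕ.+ J) 0≤½

        scale-loss : 4ℚ * inv q * (2ℚ ↑ 5 * ½ ↑ (7 ℕ.* J)) ≤ ¼ℚ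
        scale-loss = subst₂ _≤_ (lem (inv q) (½ ↑ (7 ℕ.* J))) (trans (cong (¼ℚ *_) (trans (*-comm (inv q) q) (inv-* q>0))) (*-identityʳ ¼ℚ))
            (*-monoˡ ¼ℚ (nonNegative⁻¹ ¼ℚ) (*-monoˡ (inv q) (0≤inv q) Pj))
          where lem : ∀ i z → ¼ℚ * (i * (2ℚ ↑ 9 * z)) ≡ 4ℚ * i * (2ℚ ↑ 5 * z)
                lem = solve-∀ ℚ-ring

        L-condition : ½ ≤ 1ℚ - q - η - 4ℚ * inv q * (2ℚ ↑ 5 * ½ ↑ (7 ℕ.* J))
        L-condition = ≤-trans (≤ᵇ⇒≤ {½} {1ℚ - 1/16ℚ - 1/16ℚ - ¼ℚ} tt)
          (+-mono-≤ (+-mono-≤ (+-monoʳ-≤ 1ℚ (neg-antimono-≤ q≤)) (neg-antimono-≤ η≤)) (neg-antimono-≤ scale-loss))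
          where q≤ : q ≤ 1/16ℚ
                q≤ = ≤-trans (<⇒≤ q<) (½↑-anti {4} {31} (ℕₚ.m≤m+n 4 27))

        2τ≡ : 2ℚ ↑ (5 ℕ.+ J) * τ ≡ ½ ↑ 3
        2τ≡ = trans (cong (λ z → 2ℚ ↑ (5 ℕ.+ J) * ½ ↑ z) (eq J)) (2↑-shift (5 ℕ.+ J) 3)
          where eq : ∀ J → 8 ℕ.+ J ≡ 5 ℕ.+ J ℕ.+ 3
                eq = ℕ-solve-∀

        2η≤ : 2ℚ ↑ (5 ℕ.+ J) * η ≤ 1/16ℚ
        2η≤ = ≤-trans (*-monoʳ η 0≤η (subst₂ _≤_ (sym (↑-+ 2ℚ 5 J)) (trans (sym (*-assoc (2ℚ ↑ 5) (2ℚ ↑ 7) T)) (cong (_* T) (sym (↑-+ 2ℚ 5 7)))) (*-monoˡ (2ℚ ↑ 5) (0≤↑ 5 0≤2) (2↑J≤ j refl)))) Tη≤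

        -- With L = 1/2, `key` would give 1/4 ≤ 1/8 + 1/16.
        impossible : ⊥
        impossible = <⇒¬≤ (<ᵇ⇒<′ {½ ↑ 3 + 1/16ℚ} {½ * ½}) (≤-trans (key (6 ℕ.+ j) {τ} {½} {η} 0≤τ τ-condition error≤ 0≤½ L-condition
            (subst (0ℚ ≤_) (sym V′≡) (0≤+ 0≤τ 0≤η)))
          (≤-trans (≤-reflexive (trans (cong (2ℚ ↑ (5 ℕ.+ J) *_) V′≡) (*-distribˡ-+ (2ℚ ↑ (5 ℕ.+ J)) τ η)))
            (+-mono-≤ (≤-reflexive 2τ≡) 2η≤)))
          where
            <ᵇ⇒<′ : ∀ {a b} {{_ : Data.Rational.Positive (b - a)}} → a < b
            <ᵇ⇒<′ {a} {b} {{p}} = subst₂ _<_ (+-identityʳ a) (lem a b) (+-monoʳ-< a (positive⁻¹ (b - a) {{p}}))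
              where lem : ∀ a b → a + (b - a) ≡ b
                    lem = solve-∀ ℚ-ring

      density-lower : ½ ↑ 31 ≤ q
      density-lower = ≮⇒≥ (λ q< → refute q< (least P? m₁ P-eventually))
        where refute : q < ½ ↑ 31 → ∃[ j ] (P j × (∀ i → j ≡ suc i → ¬ P i)) → ⊥
              refute q< (j , Pj , ¬P) = At-scale.impossible q< j Pj ¬P

    module Phase₂ (k′ : ℕ) (S′ U : Fin n → Bool) (S′⊑S : S′ ⊑ S) (ext : IsExtremal (suc k′) S′ U)
                  (u-large : 8ℚ * ℓ ↑ 19 ≤ sz U) (u-large′ : ι (2 ℕ.* suc k′ ℕ.* suc (2 ℕ.* suc k′)) ≤ sz U)
                  (ε η : ℚ) (0<ε : 0ℚ < ε) (0≤η : 0ℚ ≤ η) (j Λ : ℕ) (Λ>0 : 0 ℕ.< Λ) (k-large : 32 ℕ.* Λ ℕ.≤ suc (suc k′))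
                  (error≤ : error (density U) (sz U) ≤ η) (q≥ : ½ ↑ 31 ≤ density U)
                  (j-large : 4ℚ * 2ℚ ↑ 31 * (2ℚ ↑ 5 * ½ ↑ (7 ℕ.* suc j)) ≤ ¼ℚ * ε) (η≤ : η ≤ ¼ℚ * ε)
                  (Λ-large : 2ℚ ↑ (5 ℕ.+ suc j) * (2ℚ * inv (ι Λ)) ≤ 1/16ℚ * (ε * ε)) (η≤′ : 2ℚ ↑ (5 ℕ.+ suc j) * η ≤ 1/16ℚ * (ε * ε)) where

      open Piece k′ S′ U S′⊑S ext u-large u-large′ using (q; u; u>0; q>0; key)

      private
        K : ℕ
        K = suc (suc k′)
        i τ : ℚ
        i = inv (ι Λ)
        -- Neighbourhoods are allowed to be denser than U by the factor 1 + 1/Λ only. Its Λ-th power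
        -- is at least 2, and K ≥ 32Λ, so its K-th power is at least 2^32 ≥ 2/q.
        τ = q * (1ℚ + i)
        b : ℚ
        b = 2ℚ ↑ (5 ℕ.+ suc j)

      0<Λ : 0ℚ < ι Λ
      0<Λ = 0<ι Λ>0

      0≤i : 0ℚ ≤ i
      0≤i = 0≤inv (ι Λ)

      power-large : 2ℚ ↑ 32 ≤ (1ℚ + i) ↑ K
      power-large = ≤-trans (↑-mono 32 0≤2 two≤) (≤-trans (≤-reflexive (↑-↑ (1ℚ + i) Λ 32)) (↑-mono-exp {1ℚ + i} {32 ℕ.* Λ} {K} (≤-by i refl 0≤i) k-large))
        where two≤ : 2ℚ ≤ (1ℚ + i) ↑ Λ
              two≤ = ≤-trans (≤-reflexive (cong (1ℚ +_) (sym (inv-* 0<Λ)))) (bernoulli⁺ Λ 0≤i)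

      τ-condition : 2ℚ * q ↑ K ≤ τ ↑ K * q
      τ-condition = subst₂ _≤_ (*-comm (q ↑ K) 2ℚ) (trans (sym (*-assoc (q ↑ K) ((1ℚ + i) ↑ K) q)) (cong (_* q) (sym (↑-*-dist q (1ℚ + i) K))))
        (*-monoˡ (q ↑ K) (0≤↑ K (<⇒≤ q>0)) (subst (_≤ (1ℚ + i) ↑ K * q) (trans (*-comm (2ℚ ↑ 32) (½ ↑ 31)) (trans (lem (½ ↑ 31) (2ℚ ↑ 31)) (cong (2ℚ *_) (½↑-2↑ 31))))
          (*-mono (0≤↑ 31 0≤½) (≤-trans (0≤↑ 32 0≤2) power-large) power-large q≥)))
        where lem : ∀ x y → x * (2ℚ * y) ≡ 2ℚ * (x * y)
              lem = solve-∀ ℚ-ring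

      0<K : 0ℚ < ι K
      0<K = 0<ι {K} (ℕ.s≤s ℕ.z≤n)

      2/K≤i : 2ℚ * inv (ι K) ≤ i
      2/K≤i = cancel-≤ (ι K) 0<K (cancel-≤ (ι Λ) 0<Λ (subst₂ _≤_ (sym (trans (lem (ι K) (ι Λ) (inv (ι K))) (trans (cong (2ℚ * ι Λ *_) (inv-* 0<K)) (*-identityʳ (2ℚ * ι Λ)))))
                (sym (trans (lem₂ (ι K) (ι Λ) i) (trans (cong (ι K *_) (inv-* 0<Λ)) (*-identityʳ (ι K))))) 2Λ≤K))
        where lem : ∀ k l i → l * (k * (2ℚ * i)) ≡ 2ℚ * l * (k * i)
              lem = solve-∀ ℚ-ring
              lem₂ : ∀ k l i → l * (k * i) ≡ k * (l * i)
              lem₂ = solve-∀ ℚ-ring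
              2Λ≤K : 2ℚ * ι Λ ≤ ι K
              2Λ≤K = subst (_≤ ι K) (ι-* 2 Λ) (ι-mono (ℕₚ.≤-trans (ℕₚ.*-monoˡ-≤ Λ {2} {32} (ℕₚ.m≤m+n 2 30)) k-large))

      q≤1 : q ≤ 1ℚ
      q≤1 = density≤1 U u>0

      V′ : ℚ
      V′ = τ - q + 2ℚ * q * inv (ι K) + η

      V′≡ : V′ ≡ q * (i + 2ℚ * inv (ι K)) + η
      V′≡ = lem q i (inv (ι K)) η
        where lem : ∀ q i k h → q * (1ℚ + i) - q + 2ℚ * q * k + h ≡ q * (i + 2ℚ * k) + h
              lem = solve-∀ ℚ-ring

      0≤i+ : 0ℚ ≤ i + 2ℚ * inv (ι K)
      0≤i+ = 0≤+ 0≤i (0≤* 0≤2 (0≤inv (ι K)))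

      V′≤ : V′ ≤ 2ℚ * i + η
      V′≤ = subst (_≤ 2ℚ * i + η) (sym V′≡) (+-monoˡ-≤ η (≤-trans (*-monoʳ (i + 2ℚ * inv (ι K)) 0≤i+ q≤1)
              (≤-trans (≤-reflexive (*-identityˡ (i + 2ℚ * inv (ι K)))) (≤-trans (+-monoʳ-≤ i 2/K≤i) (≤-reflexive (lem i))))))
        where lem : ∀ i → i + i ≡ 2ℚ * i
              lem = solve-∀ ℚ-ring

      0≤V′ : 0ℚ ≤ V′
      0≤V′ = subst (0ℚ ≤_) (sym V′≡) (0≤+ (0≤* (<⇒≤ q>0) 0≤i+) 0≤η)

      inv-q≤ : inv q ≤ 2ℚ ↑ 31
      inv-q≤ = subst (inv q ≤_) (inv-unique (0<↑ 31 0<½) (½↑-2↑ 31)) (inv-anti (0<↑ 31 0<½) q≥)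

      -- If q were below 1 - ε, then L = ε/2 would be admissible in `key`, and the norm bound V′ ≤
      -- 2/Λ + η would give ε²/4 ≤ ε²/16 + ε²/16.
      density-high : 1ℚ - ε ≤ q
      density-high = ≮⇒≥ (λ q< → <⇒¬≤ strict (≤-trans (key j {τ} {½ * ε} {η} (0≤* (<⇒≤ q>0) (0≤+ 0≤1 0≤i)) τ-condition error≤ (0≤* 0≤½ (<⇒≤ 0<ε)) (L-condition q<) 0≤V′)
              (≤-trans (*-monoˡ b (0≤↑ (5 ℕ.+ suc j) 0≤2) V′≤) (≤-trans (≤-reflexive (*-distribˡ-+ b (2ℚ * i) η)) (+-mono-≤ Λ-large η≤′)))))
        where
          Z : ℚ
          Z = 2ℚ ↑ 5 * ½ ↑ (7 ℕ.* suc j)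
          0≤Z : 0ℚ ≤ Z
          0≤Z = 0≤* (0≤↑ 5 0≤2) (0≤↑ (7 ℕ.* suc j) 0≤½)
          loss : 4ℚ * inv q * Z ≤ ¼ℚ * ε
          loss = ≤-trans (*-monoʳ Z 0≤Z (*-monoˡ 4ℚ (nonNegative⁻¹ 4ℚ) inv-q≤)) j-large
          L-condition : q < 1ℚ - ε → ½ * ε ≤ 1ℚ - q - η - 4ℚ * inv q * Z
          L-condition q< = ≤-by ((1ℚ - ε - q) + (¼ℚ * ε - η) + (¼ℚ * ε - 4ℚ * inv q * Z)) (lem ε q η (4ℚ * inv q * Z))
                          (0≤+ (0≤+ (0≤-diff (<⇒≤ q<)) (0≤-diff η≤)) (0≤-diff loss))
            where lem : ∀ e q h z → ½ * e + ((1ℚ - e - q) + (¼ℚ * e - h) + (¼ℚ * e - z)) ≡ 1ℚ - q - h - z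
                  lem = solve-∀ ℚ-ring
          strict : 1/16ℚ * (ε * ε) + 1/16ℚ * (ε * ε) < ½ * ε * (½ * ε)
          strict = subst₂ _<_ (trans (+-identityʳ (1/16ℚ * (ε * ε) + 1/16ℚ * (ε * ε))) refl) (lem ε) (+-monoʳ-< (1/16ℚ * (ε * ε) + 1/16ℚ * (ε * ε)) (0<* (positive⁻¹ 1/8ℚ) (0<* 0<ε 0<ε)))
            where lem : ∀ e → 1/16ℚ * (e * e) + 1/16ℚ * (e * e) + 1/8ℚ * (e * e) ≡ ½ * e * (½ * e)
                  lem = solve-∀ ℚ-ring

  -- From small surplus to a quadratic form bounded below on the cube

  sgn : Bool → ℚ
  sgn true  = 1ℚ
  sgn false = -1ℚ

  -- With zero diagonal the form is affine in each coordinate, so its value at y is the average,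
  -- with weights (1 ± y₀)/2, of the values at first coordinate ±1. Fixing a coordinate creates
  -- constant and linear terms, which is why the statement carries `c` and `l`.
  affine-on-cube : ∀ {n} (A : Mat n n) → Sym A → (∀ x → A x x ≡ 0ℚ) → ∀ (c : ℚ) (l : Vec n) →
    (∀ (s : Fin n → Bool) → 0ℚ ≤ c + dot l (λ x → sgn (s x)) + qf A (λ x → sgn (s x))) →
    ∀ y → (∀ x → - 1ℚ ≤ y x) → (∀ x → y x ≤ 1ℚ) → 0ℚ ≤ c + dot l y + qf A y
  affine-on-cube {zero}  A sA dA c l h y lo hi = h (λ ())
  affine-on-cube {suc n} A sA dA c l h y lo hi =
    subst (0ℚ ≤_) (sym eq) (0≤+ (0≤* (0≤* 0≤½ (subst (0ℚ ≤_) (lem₀ y₀) (0≤-diff (lo zero)))) (ih true)) (0≤* (0≤* 0≤½ (0≤-diff (hi zero))) (ih false)))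
    where
      y₀ : ℚ
      y₀ = y zero
      y′ r l′ : Vec n
      y′ = y ∘ suc
      r  = A zero ∘ suc
      l′ = l ∘ suc
      A₁ : Mat n n
      A₁ i j = A (suc i) (suc j)
      lem₀ : ∀ y → y - - 1ℚ ≡ 1ℚ + y
      lem₀ = solve-∀ ℚ-ring
      value : ∀ t z → (c + t * l zero) + dot (lin 1ℚ l′ (2ℚ * t) r) z + qf A₁ z ≡ c + (l zero * t + dot l′ z) + (0ℚ * (t * t) + 2ℚ * (t * dot r z) + qf A₁ z)
      value t z = trans (cong (λ d → c + t * l zero + d + qf A₁ z) (dot-linˡ 1ℚ l′ (2ℚ * t) r z)) (lem c t (l zero) (dot l′ z) (dot r z) (qf A₁ z))
        where lem : ∀ c t l a b q → c + t * l + (1ℚ * a + 2ℚ * t * b) + q ≡ c + (l * t + a) + (0ℚ * (t * t) + 2ℚ * (t * b) + q)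
              lem = solve-∀ ℚ-ring
      full : ∀ v → c + dot l v + qf A v ≡ (c + v zero * l zero) + dot (lin 1ℚ l′ (2ℚ * v zero) r) (v ∘ suc) + qf A₁ (v ∘ suc)
      full v = trans (cong (c + dot l v +_) (trans (qf-suc A sA v) (cong (λ z → z * (v zero * v zero) + 2ℚ * (v zero * dot r (v ∘ suc)) + qf A₁ (v ∘ suc)) (dA zero)))) (sym (value (v zero) (v ∘ suc)))
      ih : ∀ b → 0ℚ ≤ (c + sgn b * l zero) + dot (lin 1ℚ l′ (2ℚ * sgn b) r) y′ + qf A₁ y′
      ih b = affine-on-cube A₁ (λ i j → sA (suc i) (suc j)) (λ i → dA (suc i)) (c + sgn b * l zero) (lin 1ℚ l′ (2ℚ * sgn b) r)
               (λ s → subst (0ℚ ≤_) (full (λ x → sgn ((b VF.∷ s) x))) (h (b VF.∷ s))) y′ (λ x → lo (suc x)) (λ x → hi (suc x))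
      eq : c + dot l y + qf A y ≡ ½ * (1ℚ + y₀) * ((c + 1ℚ * l zero) + dot (lin 1ℚ l′ (2ℚ * 1ℚ) r) y′ + qf A₁ y′)
                                + ½ * (1ℚ - y₀) * ((c + -1ℚ * l zero) + dot (lin 1ℚ l′ (2ℚ * -1ℚ) r) y′ + qf A₁ y′)
      eq = trans (full y) (trans (value y₀ y′) (trans (lem c y₀ (l zero) (dot l′ y′) (dot r y′) (qf A₁ y′))
             (sym (cong₂ (λ p q → ½ * (1ℚ + y₀) * p + ½ * (1ℚ - y₀) * q) (value 1ℚ y′) (value -1ℚ y′)))))
        where lem : ∀ c t l a b q → c + (l * t + a) + (0ℚ * (t * t) + 2ℚ * (t * b) + q)
                      ≡ ½ * (1ℚ + t) * (c + (l * 1ℚ + a) + (0ℚ * (1ℚ * 1ℚ) + 2ℚ * (1ℚ * b) + q)) + ½ * (1ℚ - t) * (c + (l * -1ℚ + a) + (0ℚ * (-1ℚ * -1ℚ) + 2ℚ * (-1ℚ * b) + q))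
              lem = solve-∀ ℚ-ring

  module Cuts {n} (G : Graph n) where
    open OnGraph G

    all : Fin n → Bool
    all _ = true

    A≡a : ∀ x y → a all x y ≡ A x y
    A≡a x y = trans (*-identityˡ (1ℚ * A x y)) (*-identityˡ (A x y))

    cut-cong : ∀ {c c′} → c ≗ c′ → cut G c ≡ cut G c′
    cut-cong h = sumFin-cong (λ i → sumFin-cong (λ j → cong₂ (λ p q → if does (i Fin.<? j) ∧ adj G i j ∧ (p xor q) then 1 else 0) (h i) (h j)))
      where
        sumFin-cong : ∀ {k} {f g : Fin k → ℕ} → f ≗ g → sumFin f ≡ sumFin g
        sumFin-cong {zero}  h = refl
        sumFin-cong {suc k} h = cong₂ ℕ._+_ (h zero) (sumFin-cong (λ i → h (suc i)))

    cut≤mc : ∀ c → cut G c ℕ.≤ mc G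
    cut≤mc c with colouring-complete c
    ... | c′ , c′∈ , eq = subst (ℕ._≤ mc G) (sym (cut-cong eq)) (go (colourings n) c′∈)
      where
        go : ∀ cs → c′ Mem.∈ cs → cut G c′ ℕ.≤ foldr ℕ._⊔_ 0 (map (cut G) cs)
        go (d ∷ cs) (here refl) = ℕₚ.m≤m⊔n (cut G d) _
        go (d ∷ cs) (there p)   = ℕₚ.≤-trans (go cs p) (ℕₚ.m≤n⊔m (cut G d) _)

    sgn-xor : ∀ b c → sgn b * sgn c ≡ 1ℚ - 2ℚ * 𝟙 (b xor c)
    sgn-xor true  true  = refl
    sgn-xor true  false = refl
    sgn-xor false true  = refl
    sgn-xor false false = refl

    qf-sgn : ∀ c → qf A (λ x → sgn (c x)) ≡ 2ℚ * ι (edges G) - 4ℚ * ι (cut G c)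
    qf-sgn c = trans (∑-cong (λ x → trans (sym (∑-*ˡ (sgn (c x)) (λ y → A x y * sgn (c y))))
                 (trans (∑-cong (λ y → trans (lem (sgn (c x)) (A x y) (sgn (c y))) (trans (cong (A x y *_) (sgn-xor (c x) (c y))) (lem₂ (A x y) (𝟙 (c x xor c y))))))
                        (trans (∑-- (A x) (λ y → 2ℚ * X x y)) (cong (_-_ (∑ (A x))) (∑-*ˡ 2ℚ (X x)))))))
      (trans (∑-- (λ x → ∑ (A x)) (λ x → 2ℚ * ∑ (X x)))
      (cong₂ _-_ (trans (∑-cong (λ x → ∑-cong (λ y → sym (A≡a x y)))) (e₂-edges all))
        (trans (∑-*ˡ 2ℚ (λ x → ∑ (X x))) (trans (cong (2ℚ *_) (trans (∑∑-halves X X-sym X-diag) (cong (2ℚ *_) (sym cut≡)))) (lem₃ (ι (cut G c)))))))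
      where
        X : Mat n n
        X x y = A x y * 𝟙 (c x xor c y)
        lem : ∀ s a t → s * (a * t) ≡ a * (s * t)
        lem = solve-∀ ℚ-ring
        lem₂ : ∀ a z → a * (1ℚ - 2ℚ * z) ≡ a - 2ℚ * (a * z)
        lem₂ = solve-∀ ℚ-ring
        lem₃ : ∀ z → 2ℚ * (2ℚ * z) ≡ 4ℚ * z
        lem₃ = solve-∀ ℚ-ring
        X-sym : Sym X
        X-sym x y = cong₂ _*_ (A-sym x y) (cong 𝟙 (Boolₚ.xor-comm (c x) (c y)))
        X-diag : ∀ x → X x x ≡ 0ℚ
        X-diag x = trans (cong (_* 𝟙 (c x xor c x)) (A-diag x)) (*-zeroˡ (𝟙 (c x xor c x)))
        cell : Fin n → Fin n → ℕ
        cell i j = if does (i Fin.<? j) ∧ adj G i j ∧ (c i xor c j) then 1 else 0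
        row : Fin n → ℕ
        row i = sumFin (cell i)
        cut≡ : ι (cut G c) ≡ ∑ (λ i → ∑ (λ j → lt i j * X i j))
        cut≡ = trans (ι-sumFin row) (∑-cong (λ i → trans (ι-sumFin (cell i)) (∑-cong (λ j → trans (ι-if (does (i Fin.<? j) ∧ adj G i j ∧ (c i xor c j)))
                 (trans (𝟙-∧ (does (i Fin.<? j)) (adj G i j ∧ (c i xor c j))) (cong (lt i j *_) (𝟙-∧ (adj G i j) (c i xor c j))))))))

    -- Twice the surplus. The truncated subtraction is harmless: only 2 mc ≤ edges + `surplus₂` is
    -- used.
    surplus₂ : ℚ
    surplus₂ = ι (2 ℕ.* mc G ℕ.∸ edges G)

    sign-bound : ∀ c → 0ℚ ≤ 2ℚ * surplus₂ + qf A (λ x → sgn (c x))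
    sign-bound c = subst (0ℚ ≤_) (trans (lem (ι (edges G)) surplus₂ (ι (cut G c))) (cong (2ℚ * surplus₂ +_) (sym (qf-sgn c)))) (0≤* 0≤2 (0≤-diff le))
      where
        lem : ∀ e s c → 2ℚ * (e + s - 2ℚ * c) ≡ 2ℚ * s + (2ℚ * e - 4ℚ * c)
        lem = solve-∀ ℚ-ring
        le : 2ℚ * ι (cut G c) ≤ ι (edges G) + surplus₂
        le = subst₂ _≤_ (ι-* 2 (cut G c)) (ι-+ (edges G) (2 ℕ.* mc G ℕ.∸ edges G))
               (ι-mono (ℕₚ.≤-trans (ℕₚ.*-monoʳ-≤ 2 (cut≤mc c)) (ℕₚ.m≤n+m∸n (2 ℕ.* mc G) (edges G))))

    cube-bound : ∀ {T} → 0ℚ < T → ∀ y → (∀ x → y x * y x ≤ T * T) → 0ℚ ≤ 2ℚ * surplus₂ * (T * T) + qf A y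
    cube-bound {T} T>0 y hy = subst (0ℚ ≤_) eq (0≤* (0≤sq T) (affine-on-cube A A-sym A-diag (2ℚ * surplus₂) (λ _ → 0ℚ)
        (λ s → subst (0ℚ ≤_) (cong (_+ qf A (λ x → sgn (s x))) (sym (trans (cong (2ℚ * surplus₂ +_) (zero-dot (λ x → sgn (s x)))) (+-identityʳ (2ℚ * surplus₂))))) (sign-bound s))
        z lo hi))
      where
        i : ℚ
        i = inv T
        z : Vec n
        z x = i * y x
        zero-dot : ∀ (v : Vec n) → dot (λ _ → 0ℚ) v ≡ 0ℚ
        zero-dot v = ∑-zero (λ x → *-zeroˡ (v x))
        z²≤1 : ∀ x → z x * z x ≤ 1ℚ * 1ℚ
        z²≤1 x = subst₂ _≤_ (lem i (y x)) (trans (lem₂ i T) (cong₂ _*_ (inv-* T>0) (inv-* T>0))) (*-monoˡ (i * i) (0≤sq i) (hy x))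
          where lem : ∀ i y → i * i * (y * y) ≡ i * y * (i * y)
                lem = solve-∀ ℚ-ring
                lem₂ : ∀ i t → i * i * (t * t) ≡ t * i * (t * i)
                lem₂ = solve-∀ ℚ-ring
        hi : ∀ x → z x ≤ 1ℚ
        hi x = ≤-sq 0≤1 (z²≤1 x)
        lo : ∀ x → - 1ℚ ≤ z x
        lo x = subst (- 1ℚ ≤_) (lem (z x)) (neg-antimono-≤ (≤-sq { - z x } 0≤1 (subst (_≤ 1ℚ * 1ℚ) (lem₂ (z x)) (z²≤1 x))))
          where lem : ∀ z → - (- z) ≡ z
                lem = solve-∀ ℚ-ring
                lem₂ : ∀ z → z * z ≡ - z * - z
                lem₂ = solve-∀ ℚ-ring
        qz : qf A z ≡ i * i * qf A y
        qz = qf-scale A i y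
        eq : T * T * (2ℚ * surplus₂ + dot (λ _ → 0ℚ) z + qf A z) ≡ 2ℚ * surplus₂ * (T * T) + qf A y
        eq = trans (cong₂ (λ p q → T * T * (2ℚ * surplus₂ + p + q)) (zero-dot z) qz) (trans (lem T surplus₂ i (qf A y))
               (trans (cong (λ w → 2ℚ * surplus₂ * (T * T) + w * w * qf A y) (inv-* T>0)) (lem₂ (2ℚ * surplus₂ * (T * T)) (qf A y))))
          where lem : ∀ t s i q → t * t * (2ℚ * s + 0ℚ + i * i * q) ≡ 2ℚ * s * (t * t) + t * i * (t * i) * q
                lem = solve-∀ ℚ-ring
                lem₂ : ∀ p q → p + 1ℚ * 1ℚ * q ≡ p + q
                lem₂ = solve-∀ ℚ-ring

  -- Random signs

  -- The expectation of f at a sum of the given vectors with independent random signs, unfolded one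
  -- sign at a time; it stays exact and rational.
  avg : ∀ {n} → List (Vec n) → (Vec n → ℚ) → ℚ
  avg []       f = f (λ _ → 0ℚ)
  avg (x ∷ xs) f = ½ * (avg xs (λ y → f (λ i → y i + x i)) + avg xs (λ y → f (λ i → y i + - x i)))

  avg-cong : ∀ {n} (xs : List (Vec n)) {f g : Vec n → ℚ} → (∀ y → f y ≡ g y) → avg xs f ≡ avg xs g
  avg-cong []       h = h _
  avg-cong (x ∷ xs) h = cong (½ *_) (cong₂ _+_ (avg-cong xs (λ y → h _)) (avg-cong xs (λ y → h _)))

  avg-mono : ∀ {n} (xs : List (Vec n)) {f g : Vec n → ℚ} → (∀ y → f y ≤ g y) → avg xs f ≤ avg xs g
  avg-mono []       h = h _
  avg-mono (x ∷ xs) h = *-monoˡ ½ 0≤½ (+-mono-≤ (avg-mono xs (λ y → h _)) (avg-mono xs (λ y → h _)))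

  avg-+ : ∀ {n} (xs : List (Vec n)) (f g : Vec n → ℚ) → avg xs (λ y → f y + g y) ≡ avg xs f + avg xs g
  avg-+ []       f g = refl
  avg-+ (x ∷ xs) f g = trans (cong (½ *_) (cong₂ _+_ (avg-+ xs (λ y → f (λ i → y i + x i)) (λ y → g (λ i → y i + x i))) (avg-+ xs (λ y → f (λ i → y i + - x i)) (λ y → g (λ i → y i + - x i)))))
    (lem (avg xs (λ y → f (λ i → y i + x i))) (avg xs (λ y → g (λ i → y i + x i))) (avg xs (λ y → f (λ i → y i + - x i))) (avg xs (λ y → g (λ i → y i + - x i))))
    where lem : ∀ a b c d → ½ * (a + b + (c + d)) ≡ ½ * (a + c) + ½ * (b + d)
          lem = solve-∀ ℚ-ring

  avg-*ˡ : ∀ {n} (xs : List (Vec n)) c (f : Vec n → ℚ) → avg xs (λ y → c * f y) ≡ c * avg xs f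
  avg-*ˡ []       c f = refl
  avg-*ˡ (x ∷ xs) c f = trans (cong (½ *_) (cong₂ _+_ (avg-*ˡ xs c (λ y → f (λ i → y i + x i))) (avg-*ˡ xs c (λ y → f (λ i → y i + - x i)))))
    (lem c (avg xs (λ y → f (λ i → y i + x i))) (avg xs (λ y → f (λ i → y i + - x i))))
    where lem : ∀ c a b → ½ * (c * a + c * b) ≡ c * (½ * (a + b))
          lem = solve-∀ ℚ-ring

  avg-const : ∀ {n} (xs : List (Vec n)) c → avg xs (λ _ → c) ≡ c
  avg-const []       c = refl
  avg-const (x ∷ xs) c = trans (cong (½ *_) (cong₂ _+_ (avg-const xs c) (avg-const xs c))) (lem c)
    where lem : ∀ c → ½ * (c + c) ≡ c
          lem = solve-∀ ℚ-ring

  avg-∑ : ∀ {n m} (xs : List (Vec n)) (f : Fin m → Vec n → ℚ) → avg xs (λ y → ∑ (λ v → f v y)) ≡ ∑ (λ v → avg xs (f v))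
  avg-∑ {m = zero}  xs f = avg-const xs 0ℚ
  avg-∑ {m = suc m} xs f = trans (avg-+ xs (f zero) (λ y → ∑ (λ v → f (suc v) y))) (cong (avg xs (f zero) +_) (avg-∑ xs (λ v → f (suc v))))

  sum-qf : ∀ {n} → Mat n n → List (Vec n) → ℚ
  sum-qf A []       = 0ℚ
  sum-qf A (x ∷ xs) = qf A x + sum-qf A xs

  -- Cross terms cancel between opposite signs. The offset `z` holds the part of the sum whose signs
  -- are already fixed.
  avg-qf : ∀ {n} {A : Mat n n} → Sym A → ∀ xs z → avg xs (λ y → qf A (lin 1ℚ z 1ℚ y)) ≡ qf A z + sum-qf A xs
  avg-qf {A = A} sA []       z = trans (qf-lin sA 1ℚ z 1ℚ (λ _ → 0ℚ)) (trans (cong₂ (λ p q → 1ℚ * 1ℚ * qf A z + 2ℚ * (1ℚ * 1ℚ * p) + 1ℚ * 1ℚ * q) z₁ z₂) (lem (qf A z)))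
    where
      lem : ∀ q → 1ℚ * 1ℚ * q + 2ℚ * (1ℚ * 1ℚ * 0ℚ) + 1ℚ * 1ℚ * 0ℚ ≡ q + 0ℚ
      lem = solve-∀ ℚ-ring
      A0 : ∀ x → (A ∙ (λ _ → 0ℚ)) x ≡ 0ℚ
      A0 x = ∑-zero (λ y → *-zeroʳ (A x y))
      z₁ : dot z (A ∙ (λ _ → 0ℚ)) ≡ 0ℚ
      z₁ = ∑-zero (λ x → trans (cong (z x *_) (A0 x)) (*-zeroʳ (z x)))
      z₂ : qf A (λ _ → 0ℚ) ≡ 0ℚ
      z₂ = ∑-zero (λ x → *-zeroˡ ((A ∙ (λ _ → 0ℚ)) x))
  avg-qf {A = A} sA (x ∷ xs) z = trans (cong (½ *_) (cong₂ _+_ (shift 1ℚ x (λ i → pos-like i)) (shift -1ℚ (λ i → - x i) (λ i → neg-like i))))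
      (trans (cong₂ (λ p q → ½ * (p + sum-qf A xs + (q + sum-qf A xs))) (qf-lin sA 1ℚ z 1ℚ x) (qf-lin sA 1ℚ z -1ℚ x)) (lem (qf A z) (dot z (A ∙ x)) (qf A x) (sum-qf A xs)))
    where
      lem : ∀ a b c s → ½ * (1ℚ * 1ℚ * a + 2ℚ * (1ℚ * 1ℚ * b) + 1ℚ * 1ℚ * c + s + (1ℚ * 1ℚ * a + 2ℚ * (1ℚ * -1ℚ * b) + -1ℚ * -1ℚ * c + s)) ≡ a + (c + s)
      lem = solve-∀ ℚ-ring
      pos-like : ∀ i → x i ≡ 1ℚ * x i
      pos-like i = sym (*-identityˡ (x i))
      neg-like : ∀ i → - x i ≡ -1ℚ * x i
      neg-like i = lem₃ (x i)
        where lem₃ : ∀ a → - a ≡ -1ℚ * a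
              lem₃ = solve-∀ ℚ-ring
      shift : ∀ t (x′ : Vec _) → (∀ i → x′ i ≡ t * x i) → avg xs (λ y → qf A (lin 1ℚ z 1ℚ (λ i → y i + x′ i))) ≡ qf A (lin 1ℚ z t x) + sum-qf A xs
      shift t x′ h = trans (avg-cong xs (λ y → dot-cong (pt y) (∙-cong A (pt y)))) (avg-qf sA xs (lin 1ℚ z t x))
        where
          lem₂ : ∀ z y x → 1ℚ * z + 1ℚ * (y + x) ≡ 1ℚ * (1ℚ * z + x) + 1ℚ * y
          lem₂ = solve-∀ ℚ-ring
          pt : ∀ y i → lin 1ℚ z 1ℚ (λ i → y i + x′ i) i ≡ lin 1ℚ (lin 1ℚ z t x) 1ℚ y i
          pt y i = trans (lem₂ (z i) (y i) (x′ i)) (cong (λ w → 1ℚ * (1ℚ * z i + w) + 1ℚ * y i) (h i))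

  -- Even moments of random sign sums

  even odd : ℕ → ℚ → ℚ
  even k a = (a * a) ↑ k
  odd  k a = a * even k a

  0≤even : ∀ k a → 0ℚ ≤ even k a
  0≤even k a = 0≤↑ k (0≤sq a)

  mixed-power : ∀ k {p r} → 0ℚ ≤ p → 0ℚ ≤ r → p * r ↑ k ≤ p ↑ suc k + r ↑ suc k
  mixed-power k {p} {r} 0≤p 0≤r with ≤-total p r
  ... | inj₁ p≤r = ≤-trans (*-monoʳ (r ↑ k) (0≤↑ k 0≤r) p≤r) (≤-by (p ↑ suc k) (+-comm (r ↑ suc k) (p ↑ suc k)) (0≤↑ (suc k) 0≤p))
  ... | inj₂ r≤p = ≤-trans (*-monoˡ p 0≤p (↑-mono k 0≤r r≤p)) (≤-by (r ↑ suc k) refl (0≤↑ (suc k) 0≤r))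

  slope : ℕ → ℚ
  slope zero    = 1ℚ
  slope (suc k) = 2ℚ * slope k + 3ℚ

  0≤slope : ∀ k → 0ℚ ≤ slope k
  0≤slope zero    = 0≤1
  0≤slope (suc k) = 0≤+ (0≤* 0≤2 (0≤slope k)) (nonNegative⁻¹ 3ℚ)

  -- An algebraic mean value theorem for the power 2k + 1, whose derivative is a multiple of the
  -- power 2k. The constant is generous, which is harmless: k is fixed, and a lower bound on T will
  -- absorb it.
  odd-slope : ∀ k a b → (a - b) * (odd k a - odd k b) ≤ slope k * ((a - b) * (a - b)) * (even k a + even k b)
  odd-slope zero    a b = ≤-by ((a - b) * (a - b)) (lem a b) (0≤sq (a - b))
    where lem : ∀ a b → (a - b) * (a * 1ℚ - b * 1ℚ) + (a - b) * (a - b) ≡ 1ℚ * ((a - b) * (a - b)) * (1ℚ + 1ℚ)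
          lem = solve-∀ ℚ-ring
  odd-slope (suc k) a b = ≤-by
      (a * a * (c * d² * (P + Q) - (a - b) * (a * P - b * Q))
        + (c * d² * (a * a * P + b * b * Q - a * a * Q) + d² * rest))
      (lem a b P Q c)
      (0≤+ (0≤* (0≤sq a) (0≤-diff (odd-slope k a b)))
      (0≤+ (0≤* (0≤* (0≤slope k) (0≤sq (a - b))) (0≤-diff mix)) (0≤* (0≤sq (a - b)) 0≤rest)))
    where
      P Q c d² rest : ℚ
      P = even k a
      Q = even k b
      c = slope k
      d² = (a - b) * (a - b)
      rest = c * (b * b * Q) + ½ * ((a * a + b * b - (a * b + a * b)) * Q) + ½ * (a * a * P + b * b * Q - a * a * Q) + (2ℚ + ½) * (a * a * P) + b * b * Q
      mix : a * a * Q ≤ a * a * P + b * b * Q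
      mix = mixed-power k (0≤sq a) (0≤sq b)
      0≤rest : 0ℚ ≤ rest
      0≤rest = 0≤+ (0≤+ (0≤+ (0≤+ (0≤* (0≤slope k) (0≤* (0≤sq b) (0≤even k b))) (0≤* 0≤½ (0≤* (0≤-diff (2ab≤ a b)) (0≤even k b)))) (0≤* 0≤½ (0≤-diff mix)))
                    (0≤* (nonNegative⁻¹ (2ℚ + ½)) (0≤* (0≤sq a) (0≤even k a)))) (0≤* (0≤sq b) (0≤even k b))
      lem : ∀ a b P Q c → (a - b) * (a * (a * a * P) - b * (b * b * Q))
        + (a * a * (c * ((a - b) * (a - b)) * (P + Q) - (a - b) * (a * P - b * Q))
        + (c * ((a - b) * (a - b)) * (a * a * P + b * b * Q - a * a * Q)
        + (a - b) * (a - b) * (c * (b * b * Q) + ½ * ((a * a + b * b - (a * b + a * b)) * Q) + ½ * (a * a * P + b * b * Q - a * a * Q) + (2ℚ + ½) * (a * a * P) + b * b * Q)))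
        ≡ (2ℚ * c + 3ℚ) * ((a - b) * (a - b)) * (a * a * P + b * b * Q)
      lem = solve-∀ ℚ-ring

  -- A discrete integration by parts. Averaging over the sign of x yields X times the difference of
  -- odd powers at z + X + y and z - X + y, which are 2X apart, so `odd-slope` applies; the x summed
  -- over give the variance `gram xs v v`.
  moment-step : ∀ {n} k (xs : List (Vec n)) v z →
    avg xs (λ y → y v * odd k (z + y v)) ≤ 2ℚ * slope k * gram xs v v * avg xs (λ y → even k (z + y v))
  moment-step k []       v z = ≤-reflexive (lem (slope k) (odd k (z + 0ℚ)) (even k (z + 0ℚ)))
    where lem : ∀ s o e → 0ℚ * o ≡ 2ℚ * s * 0ℚ * e
          lem = solve-∀ ℚ-ring
  moment-step {n} k (x ∷ xs) v z = subst₂ _≤_ (sym lhs) rhs (*-monoˡ ½ 0≤½ (≤-trans (avg-mono xs pointwise) bound))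
    where
      X s Γ : ℚ
      X = x v
      s = slope k
      Γ = gram xs v v
      T₁ T₂ E₁ E₂ : Vec n → ℚ
      T₁ y = y v * odd k (z + X + y v)
      T₂ y = y v * odd k (z + - X + y v)
      E₁ y = even k (z + X + y v)
      E₂ y = even k (z + - X + y v)
      assoc : ∀ z y x → z + (y + x) ≡ z + x + y
      assoc = solve-∀ ℚ-ring
      lhs : avg (x ∷ xs) (λ y → y v * odd k (z + y v)) ≡ ½ * avg xs (λ y → (T₁ y + X * odd k (z + X + y v)) + (T₂ y + - X * odd k (z + - X + y v)))
      lhs = cong (½ *_) (trans (cong₂ _+_ (avg-cong xs (λ y → trans (cong (λ w → (y v + X) * odd k w) (assoc z (y v) X)) (*-distribʳ-+ (odd k (z + X + y v)) (y v) X)))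
                                          (avg-cong xs (λ y → trans (cong (λ w → (y v + - X) * odd k w) (assoc z (y v) (- X))) (*-distribʳ-+ (odd k (z + - X + y v)) (y v) (- X)))))
              (sym (avg-+ xs (λ y → T₁ y + X * odd k (z + X + y v)) (λ y → T₂ y + - X * odd k (z + - X + y v)))))
      pointwise : ∀ y → (T₁ y + X * odd k (z + X + y v)) + (T₂ y + - X * odd k (z + - X + y v)) ≤ (T₁ y + T₂ y) + 2ℚ * s * (X * X) * (E₁ y + E₂ y)
      pointwise y = subst (_≤ (T₁ y + T₂ y) + 2ℚ * s * (X * X) * (E₁ y + E₂ y)) (lem₁ (T₁ y) (T₂ y) X z (y v) (odd k (z + X + y v)) (odd k (z + - X + y v)))
          (subst (T₁ y + T₂ y + ½ * ((α - β) * (odd k α - odd k β)) ≤_) (cong (T₁ y + T₂ y +_) (lem₂ z X (y v) s (E₁ y + E₂ y))) (+-monoʳ-≤ (T₁ y + T₂ y) (*-monoˡ ½ 0≤½ (odd-slope k α β))))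
        where
          α β : ℚ
          α = z + X + y v
          β = z + - X + y v
          lem₁ : ∀ t₁ t₂ x z y o₁ o₂ → t₁ + t₂ + ½ * ((z + x + y - (z + - x + y)) * (o₁ - o₂)) ≡ (t₁ + x * o₁) + (t₂ + - x * o₂)
          lem₁ = solve-∀ ℚ-ring
          lem₂ : ∀ z x y s e → ½ * (s * ((z + x + y - (z + - x + y)) * (z + x + y - (z + - x + y))) * e) ≡ 2ℚ * s * (x * x) * e
          lem₂ = solve-∀ ℚ-ring
      bound : avg xs (λ y → (T₁ y + T₂ y) + 2ℚ * s * (X * X) * (E₁ y + E₂ y)) ≤ 2ℚ * s * (X * X + Γ) * (avg xs E₁ + avg xs E₂)
      bound = subst (_≤ 2ℚ * s * (X * X + Γ) * (avg xs E₁ + avg xs E₂))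
          (sym (trans (avg-+ xs (λ y → T₁ y + T₂ y) (λ y → 2ℚ * s * (X * X) * (E₁ y + E₂ y)))
                      (cong₂ _+_ (avg-+ xs T₁ T₂) (trans (avg-*ˡ xs (2ℚ * s * (X * X)) (λ y → E₁ y + E₂ y)) (cong (2ℚ * s * (X * X) *_) (avg-+ xs E₁ E₂))))))
          (subst (avg xs T₁ + avg xs T₂ + 2ℚ * s * (X * X) * (avg xs E₁ + avg xs E₂) ≤_) (lem s Γ (X * X) (avg xs E₁) (avg xs E₂))
            (+-monoˡ-≤ (2ℚ * s * (X * X) * (avg xs E₁ + avg xs E₂)) (+-mono-≤ (moment-step k xs v (z + X)) (moment-step k xs v (z + - X)))))
        where lem : ∀ s g x a b → 2ℚ * s * g * a + 2ℚ * s * g * b + 2ℚ * s * x * (a + b) ≡ 2ℚ * s * (x + g) * (a + b)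
              lem = solve-∀ ℚ-ring
      rhs : ½ * (2ℚ * s * (X * X + Γ) * (avg xs E₁ + avg xs E₂)) ≡ 2ℚ * s * (X * X + Γ) * avg (x ∷ xs) (λ y → even k (z + y v))
      rhs = trans (lem (2ℚ * s * (X * X + Γ)) (avg xs E₁ + avg xs E₂))
              (cong (λ w → 2ℚ * s * (X * X + Γ) * (½ * w)) (cong₂ _+_ (avg-cong xs (λ y → cong (even k) (sym (assoc z (y v) X)))) (avg-cong xs (λ y → cong (even k) (sym (assoc z (y v) (- X)))))))
        where lem : ∀ a b → ½ * (a * b) ≡ a * (½ * b)
              lem = solve-∀ ℚ-ring

  momentBound : ℕ → ℚ
  momentBound zero    = 1ℚ
  momentBound (suc k) = 4ℚ * slope k * momentBound k

  0≤momentBound : ∀ k → 0ℚ ≤ momentBound k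
  0≤momentBound zero    = 0≤1
  0≤momentBound (suc k) = 0≤* (0≤* (nonNegative⁻¹ 4ℚ) (0≤slope k)) (0≤momentBound k)

  moment-bound : ∀ {n} k (xs : List (Vec n)) v → gram xs v v ≤ 2ℚ → avg xs (λ y → even k (y v)) ≤ momentBound k
  moment-bound zero    xs v h = ≤-reflexive (avg-const xs 1ℚ)
  moment-bound (suc k) xs v h = ≤-trans (≤-reflexive (avg-cong xs (λ y → eq (y v)))) (≤-trans (moment-step k xs v 0ℚ)
      (≤-trans (*-monoʳ (avg xs (λ y → even k (0ℚ + y v))) 0≤avg (*-monoˡ (2ℚ * slope k) 0≤2s h))
      (subst₂ _≤_ (cong (2ℚ * slope k * 2ℚ *_) (avg-cong xs (λ y → cong (even k) (sym (+-identityˡ (y v)))))) (lem (slope k) (momentBound k))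
        (*-monoˡ (2ℚ * slope k * 2ℚ) (0≤* 0≤2s 0≤2) (moment-bound k xs v h)))))
    where
      0≤2s : 0ℚ ≤ 2ℚ * slope k
      0≤2s = 0≤* 0≤2 (0≤slope k)
      0≤avg : 0ℚ ≤ avg xs (λ y → even k (0ℚ + y v))
      0≤avg = subst (_≤ avg xs (λ y → even k (0ℚ + y v))) (avg-const xs 0ℚ) (avg-mono xs (λ y → 0≤even k (0ℚ + y v)))
      eq : ∀ a → even (suc k) a ≡ a * odd k (0ℚ + a)
      eq a = trans (*-assoc a a (even k a)) (cong (λ w → a * odd k w) (sym (+-identityˡ a)))
      lem : ∀ s m → 2ℚ * s * 2ℚ * m ≡ 4ℚ * s * m
      lem = solve-∀ ℚ-ring

  -- Values outside [-T, T] become 0 instead of ±T, so a truncated product is either unchanged or 0.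
  -- The comparison is an argument of `keep`, so that proofs can split on it.
  truncate : ℚ → ℚ → ℚ
  truncate T a = keep (≤⊎> (a * a) (T * T))
    module Truncate where
      keep : (a * a ≤ T * T) ⊎ (T * T < a * a) → ℚ
      keep (inj₁ _) = a
      keep (inj₂ _) = 0ℚ

  truncate-bound : ∀ T a → truncate T a * truncate T a ≤ T * T
  truncate-bound T a = go (≤⊎> (a * a) (T * T))
    where
      open Truncate T a
      go : ∀ d → keep d * keep d ≤ T * T
      go (inj₁ h) = h
      go (inj₂ _) = ≤-trans (≤-reflexive (*-zeroˡ 0ℚ)) (0≤sq T)

  large-power : ∀ k {p t} → 0ℚ < t → t ≤ p → p ≤ p ↑ suc k * inv t ↑ k
  large-power k {p} {t} t>0 t≤p = subst (p ≤_) (trans (cong (p *_) (↑-*-dist p (inv t) k)) (sym (*-assoc p (p ↑ k) (inv t ↑ k))))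
      (subst (_≤ p * (p * inv t) ↑ k) (*-identityʳ p) (*-monoˡ p (≤-trans (<⇒≤ t>0) t≤p) (1≤↑ k (subst (_≤ p * inv t) (inv-* t>0) (*-monoʳ (inv t) (0≤inv t) t≤p)))))

  half-sum≤ : ∀ k {p r t} → 0ℚ ≤ p → 0ℚ ≤ r → 0ℚ < t → (t < p) ⊎ (t < r) → ½ * (p + r) ≤ (p ↑ suc k + r ↑ suc k) * inv t ↑ k
  half-sum≤ k {p} {r} {t} 0≤p 0≤r t>0 h = by (≤-total p r) h
    where
      θ : ℚ
      θ = inv t ↑ k
      0≤θ : 0ℚ ≤ θ
      0≤θ = 0≤↑ k (0≤inv t)
      half : ∀ {a b} → a ≤ b → ½ * (a + b) ≤ b
      half {a} {b} a≤b = ≤-by (½ * (b - a)) (lem a b) (0≤* 0≤½ (0≤-diff a≤b))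
        where lem : ∀ a b → ½ * (a + b) + ½ * (b - a) ≡ b
              lem = solve-∀ ℚ-ring
      by : (p ≤ r) ⊎ (r ≤ p) → (t < p) ⊎ (t < r) → ½ * (p + r) ≤ (p ↑ suc k + r ↑ suc k) * θ
      by (inj₁ p≤r) h = ≤-trans (half p≤r) (≤-trans (large-power k t>0 (t≤r h))
                          (*-monoʳ {r ↑ suc k} {p ↑ suc k + r ↑ suc k} θ 0≤θ (≤-by (p ↑ suc k) (+-comm (r ↑ suc k) (p ↑ suc k)) (0≤↑ (suc k) 0≤p))))
        where t≤r : (t < p) ⊎ (t < r) → t ≤ r
              t≤r (inj₁ q) = ≤-trans (<⇒≤ q) p≤r
              t≤r (inj₂ q) = <⇒≤ q
      by (inj₂ r≤p) h = ≤-trans (subst (_≤ p) (cong (½ *_) (+-comm r p)) (half r≤p)) (≤-trans (large-power k t>0 (t≤p h))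
                          (*-monoʳ {p ↑ suc k} {p ↑ suc k + r ↑ suc k} θ 0≤θ (≤-by (r ↑ suc k) refl (0≤↑ (suc k) 0≤r))))
        where t≤p : (t < p) ⊎ (t < r) → t ≤ p
              t≤p (inj₁ q) = <⇒≤ q
              t≤p (inj₂ q) = ≤-trans (<⇒≤ q) r≤p

  -- -ab is at most (a² + b²)/2, hence at most the larger square; that one exceeds T², so its k
  -- extra factors compensate T^(-2k). A one-sided bound is enough, because the entries of A are
  -- nonnegative.
  negligible : ∀ k {T} → 0ℚ < T → ∀ a b → (T * T < a * a) ⊎ (T * T < b * b) → 0ℚ ≤ a * b + (even (suc k) a + even (suc k) b) * inv (T * T) ↑ k
  negligible k {T} T>0 a b h = ≤-trans (subst (0ℚ ≤_) (lem a b) (0≤* 0≤½ (0≤sq (a + b)))) (+-monoʳ-≤ (a * b) (half-sum≤ k (0≤sq a) (0≤sq b) (0<* T>0 T>0) h))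
    where lem : ∀ a b → ½ * ((a + b) * (a + b)) ≡ a * b + ½ * (a * a + b * b)
          lem = solve-∀ ℚ-ring

  truncate-pair : ∀ k {T} → 0ℚ < T → ∀ a b →
    truncate T a * truncate T b ≤ a * b + (even (suc k) a + even (suc k) b) * inv (T * T) ↑ k
  truncate-pair k {T} T>0 a b = go (≤⊎> (a * a) (T * T)) (≤⊎> (b * b) (T * T))
    where
      go : ∀ d d′ → Truncate.keep T a d * Truncate.keep T b d′ ≤ a * b + (even (suc k) a + even (suc k) b) * inv (T * T) ↑ k
      go (inj₁ _)  (inj₁ _)  = ≤-by ((even (suc k) a + even (suc k) b) * inv (T * T) ↑ k) refl (0≤* (0≤+ (0≤even (suc k) a) (0≤even (suc k) b)) (0≤↑ k (0≤inv (T * T))))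
      go (inj₂ ha) d′        = subst (_≤ a * b + (even (suc k) a + even (suc k) b) * inv (T * T) ↑ k) (sym (*-zeroˡ (Truncate.keep T b d′))) (negligible k T>0 a b (inj₁ ha))
      go (inj₁ _)  (inj₂ hb) = subst (_≤ a * b + (even (suc k) a + even (suc k) b) * inv (T * T) ↑ k) (sym (*-zeroʳ a)) (negligible k T>0 a b (inj₂ hb))

  module Exhaustion {n} (G : Graph n) where
    open OnGraph G
    open Cuts G

    N : ℚ
    N = ι n

    -- Rounding the random sign combination of the vectors xs to the cube.
    sum-qf-bound : ∀ k {T} → 0ℚ < T → ∀ xs → (∀ v → gram xs v v ≤ 2ℚ) →
      0ℚ ≤ sum-qf A xs + (2ℚ * surplus₂ * (T * T) + 2ℚ * (N * N) * (momentBound (suc k) * inv (T * T) ↑ k))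
    sum-qf-bound k {T} T>0 xs budget = ≤-trans (subst (_≤ avg xs (λ y → qf A (lin 1ℚ z 1ℚ y) + err y)) (avg-const xs 0ℚ) (avg-mono xs pointwise)) (subst (_≤ total) (sym eq) bound)
      where
        z : Vec n
        z _ = 0ℚ
        θ C c₀ total : ℚ
        θ = inv (T * T) ↑ k
        C = momentBound (suc k)
        c₀ = 2ℚ * surplus₂ * (T * T)
        total = sum-qf A xs + (c₀ + 2ℚ * (N * N) * (C * θ))
        0≤θ : 0ℚ ≤ θ
        0≤θ = 0≤↑ k (0≤inv (T * T))
        ev : Vec n → Fin n → ℚ
        ev y v = even (suc k) (y v)
        err : Vec n → ℚ
        err y = c₀ + 2ℚ * N * θ * ∑ (ev y)
        lem₀ : ∀ y → 1ℚ * 0ℚ + 1ℚ * y ≡ y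
        lem₀ = solve-∀ ℚ-ring
        pointwise : ∀ y → 0ℚ ≤ qf A (lin 1ℚ z 1ℚ y) + err y
        pointwise y = subst (λ q → 0ℚ ≤ q + err y) (sym (dot-cong (λ i → lem₀ (y i)) (∙-cong A (λ i → lem₀ (y i)))))
            (≤-trans (cube-bound T>0 t (λ x → truncate-bound T (y x))) (≤-trans (+-monoʳ-≤ c₀ qt≤) (≤-reflexive (lem c₀ (qf A y) (2ℚ * N * θ * ∑ (ev y))))))
          where
            t : Vec n
            t x = truncate T (y x)
            lem : ∀ c q r → c + (q + r) ≡ q + (c + r)
            lem = solve-∀ ℚ-ring
            qf-double : ∀ v → qf A v ≡ ∑ (λ x → ∑ (λ w → A x w * (v x * v w)))
            qf-double v = ∑-cong (λ x → trans (sym (∑-*ˡ (v x) (λ w → A x w * v w))) (∑-cong (λ w → lem′ (v x) (A x w) (v w))))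
              where lem′ : ∀ p a q → p * (a * q) ≡ a * (p * q)
                    lem′ = solve-∀ ℚ-ring
            0≤ee : ∀ x w → 0ℚ ≤ (ev y x + ev y w) * θ
            0≤ee x w = 0≤* (0≤+ (0≤even (suc k) (y x)) (0≤even (suc k) (y w))) 0≤θ
            cell : ∀ x w → A x w * (t x * t w) ≤ A x w * (y x * y w) + (ev y x + ev y w) * θ
            cell x w = ≤-trans (*-monoˡ (A x w) (0≤𝟙 (adj G x w)) (truncate-pair k T>0 (y x) (y w)))
              (≤-trans (≤-reflexive (*-distribˡ-+ (A x w) (y x * y w) ((ev y x + ev y w) * θ)))
                (+-monoʳ-≤ (A x w * (y x * y w)) (subst (A x w * ((ev y x + ev y w) * θ) ≤_) (*-identityˡ ((ev y x + ev y w) * θ)) (*-monoʳ ((ev y x + ev y w) * θ) (0≤ee x w) (𝟙≤1 (adj G x w))))))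
            sum-ee : ∑ (λ x → ∑ (λ w → (ev y x + ev y w) * θ)) ≡ 2ℚ * N * θ * ∑ (ev y)
            sum-ee = trans (∑-cong (λ x → trans (∑-*ʳ θ (λ w → ev y x + ev y w)) (cong (_* θ) (trans (∑-+ (λ _ → ev y x) (ev y)) (cong (_+ ∑ (ev y)) (∑-const n (ev y x)))))))
              (trans (∑-*ʳ θ (λ x → N * ev y x + ∑ (ev y))) (trans (cong (_* θ) (trans (∑-+ (λ x → N * ev y x) (λ _ → ∑ (ev y))) (cong₂ _+_ (∑-*ˡ N (ev y)) (∑-const n (∑ (ev y)))))) (lem′ N (∑ (ev y)) θ)))
              where lem′ : ∀ n e t → (n * e + n * e) * t ≡ 2ℚ * n * t * e
                    lem′ = solve-∀ ℚ-ring
            qt≤ : qf A t ≤ qf A y + 2ℚ * N * θ * ∑ (ev y)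
            qt≤ = subst₂ _≤_ (sym (qf-double t)) (trans (∑-cong (λ x → ∑-+ (λ w → A x w * (y x * y w)) (λ w → (ev y x + ev y w) * θ)))
                      (trans (∑-+ (λ x → ∑ (λ w → A x w * (y x * y w))) (λ x → ∑ (λ w → (ev y x + ev y w) * θ))) (cong₂ _+_ (sym (qf-double y)) sum-ee)))
                    (∑-mono (λ x → ∑-mono (λ w → cell x w)))
        qz : qf A z ≡ 0ℚ
        qz = ∑-zero (λ x → *-zeroˡ ((A ∙ z) x))
        eq : avg xs (λ y → qf A (lin 1ℚ z 1ℚ y) + err y) ≡ sum-qf A xs + (c₀ + 2ℚ * N * θ * ∑ (λ v → avg xs (λ y → ev y v)))
        eq = trans (avg-+ xs (λ y → qf A (lin 1ℚ z 1ℚ y)) err) (cong₂ _+_ (trans (avg-qf A-sym xs z) (trans (cong (_+ sum-qf A xs) qz) (+-identityˡ (sum-qf A xs))))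
               (trans (avg-+ xs (λ _ → c₀) (λ y → 2ℚ * N * θ * ∑ (ev y))) (cong₂ _+_ (avg-const xs c₀) (trans (avg-*ˡ xs (2ℚ * N * θ) (λ y → ∑ (ev y))) (cong (2ℚ * N * θ *_) (avg-∑ xs (λ v y → ev y v)))))))
        bound : sum-qf A xs + (c₀ + 2ℚ * N * θ * ∑ (λ v → avg xs (λ y → ev y v))) ≤ total
        bound = +-monoʳ-≤ (sum-qf A xs) (+-monoʳ-≤ c₀ (≤-trans (*-monoˡ (2ℚ * N * θ) (0≤* (0≤* 0≤2 (0≤ι n)) 0≤θ) (∑-mono (λ v → moment-bound (suc k) xs v (budget v))))
                  (≤-reflexive (trans (cong (2ℚ * N * θ *_) (∑-const n C)) (lem N θ C)))))
          where lem : ∀ n t c → 2ℚ * n * t * (n * c) ≡ 2ℚ * (n * n) * (c * t)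
                lem = solve-∀ ℚ-ring

  -- Peeling off negative directions

  sq≤0⇒≡0 : ∀ {a} → a * a ≤ 0ℚ → a ≡ 0ℚ
  sq≤0⇒≡0 {a} h with a ≟ 0ℚ
  ... | yes p = p
  ... | no ¬p = ⊥-elim (<⇒¬≤ (0<sq a ¬p) h)

  largest-entry : ∀ {n} (x : Vec n) → (∀ u → x u ≡ 0ℚ) ⊎ (∃[ v ] (0ℚ < x v * x v × (∀ u → x u * x u ≤ x v * x v)))
  largest-entry {zero}  x = inj₁ λ ()
  largest-entry {suc n} x with largest-entry (x ∘ suc)
  largest-entry {suc n} x | inj₁ z with ≤⊎> (x zero * x zero) 0ℚ
  ... | inj₁ h = inj₁ λ { zero → sq≤0⇒≡0 h ; (suc u) → z u }
  ... | inj₂ h = inj₂ (zero , h , λ { zero → ≤-refl ; (suc u) → ≤-trans (≤-reflexive (trans (cong₂ _*_ (z u) (z u)) (*-zeroˡ 0ℚ))) (<⇒≤ h) })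
  largest-entry {suc n} x | inj₂ (v , pos , mx) with ≤⊎> (x zero * x zero) (x (suc v) * x (suc v))
  ... | inj₁ h = inj₂ (suc v , pos , λ { zero → h ; (suc u) → mx u })
  ... | inj₂ h = inj₂ (zero , <-trans pos h , λ { zero → ≤-refl ; (suc u) → ≤-trans (mx u) (<⇒≤ h) })

  dot-scale : ∀ {n} c (v : Vec n) → dot (λ x → c * v x) (λ x → c * v x) ≡ c * c * dot v v
  dot-scale c v = trans (∑-cong (λ x → lem c (v x))) (∑-*ˡ (c * c) (λ x → v x * v x))
    where lem : ∀ i y → i * y * (i * y) ≡ i * i * (y * y)
          lem = solve-∀ ℚ-ring

  does-true : ∀ {P : Set} (d : Dec P) → does d ≡ true → P
  does-true (yes p) _ = p

  does-false : ∀ {P : Set} (d : Dec P) → does d ≡ false → ¬ P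
  does-false (no ¬p) _ = ¬p

  module Peeling {n} (G : Graph n) (ℓ : ℚ) (0≤ℓ : 0ℚ ≤ ℓ) where
    open OnGraph G
    open Extremal G using (sz-mono)

    -- A new vector is supported on vertices of weight below 1 and adds at most 1 to each, so no
    -- weight exceeds 2; each dead vertex in turn accounts for weight at least 1 in `total`.
    alive : List (Vec n) → Fin n → Bool
    alive xs v = does (gram xs v v <? 1ℚ)

    alive-< : ∀ xs v → alive xs v ≡ true → gram xs v v < 1ℚ
    alive-< xs v = does-true (gram xs v v <? 1ℚ)

    dead-≥ : ∀ xs v → alive xs v ≡ false → 1ℚ ≤ gram xs v v
    dead-≥ xs v h = ≮⇒≥ (does-false (gram xs v v <? 1ℚ) h)

    total : List (Vec n) → ℚ
    total xs = ∑ (λ v → gram xs v v)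

    -- The shift is applied on all vertices. Off S the form is then just ℓ times the square, so a
    -- negative vector remains negative when restricted to S.
    shifted : (Fin n → Bool) → Mat n n
    shifted S x y = a S x y + ℓ * δ x y

    record Peeled : Set where
      field
        xs     : List (Vec n)
        energy : sum-qf A xs + ℓ * total xs ≤ 0ℚ
        budget : ∀ v → gram xs v v ≤ 2ℚ
        L      : List (Vec n)
        factor : ∀ x y → gram L x y ≡ shifted (alive xs) x y

    shifted-sym : ∀ S → Sym (shifted S)
    shifted-sym S x y = cong₂ (λ p q → p + ℓ * q) (a-sym S x y) (δ-sym x y)

    qf-shifted : ∀ S w → qf (shifted S) w ≡ qf A (λ y → 𝟙 (S y) * w y) + ℓ * dot w w
    qf-shifted S w = trans (∑-cong (λ x → trans (cong (w x *_) (trans (∑-cong (λ y → lem (𝟙 (S x)) (𝟙 (S y)) (A x y) ℓ (δ x y) (w y)))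
          (trans (∑-+ (λ y → 𝟙 (S x) * (A x y * (𝟙 (S y) * w y))) (λ y → ℓ * (δ x y * w y)))
            (cong₂ _+_ (∑-*ˡ (𝟙 (S x)) (λ y → A x y * (𝟙 (S y) * w y))) (trans (∑-*ˡ ℓ (λ y → δ x y * w y)) (cong (ℓ *_) (∑-δ x w)))))))
          (lem₂ (w x) (𝟙 (S x)) ((A ∙ (λ y → 𝟙 (S y) * w y)) x) ℓ)))
        (trans (∑-+ (λ x → 𝟙 (S x) * w x * (A ∙ (λ y → 𝟙 (S y) * w y)) x) (λ x → ℓ * (w x * w x))) (cong (qf A (λ y → 𝟙 (S y) * w y) +_) (∑-*ˡ ℓ (λ x → w x * w x))))
      where lem : ∀ p q a l d w → (p * (q * a) + l * d) * w ≡ p * (a * (q * w)) + l * (d * w)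
            lem = solve-∀ ℚ-ring
            lem₂ : ∀ w p b l → w * (p * b + l * w) ≡ p * w * b + l * (w * w)
            lem₂ = solve-∀ ℚ-ring

    module PeelStep (xs : List (Vec n)) (energy : sum-qf A xs + ℓ * total xs ≤ 0ℚ) (budget : ∀ v → gram xs v v ≤ 2ℚ)
                (w : Vec n) (negative : qf (shifted (alive xs)) w < 0ℚ) where
      S : Fin n → Bool
      S = alive xs

      x : Vec n
      x y = 𝟙 (S y) * w y

      neg-x : qf A x + ℓ * dot x x < 0ℚ
      neg-x = ≤-<-trans (+-monoʳ-≤ (qf A x) (*-monoˡ ℓ 0≤ℓ (∑-mono (λ y → le (S y) (w y))))) (subst (_< 0ℚ) (qf-shifted S w) negative)
        where le : ∀ b w → 𝟙 b * w * (𝟙 b * w) ≤ w * w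
              le true  w = ≤-reflexive (cong₂ _*_ (*-identityˡ w) (*-identityˡ w))
              le false w = ≤-trans (≤-reflexive (lem w)) (0≤sq w)
                where lem : ∀ w → 0ℚ * w * (0ℚ * w) ≡ 0ℚ
                      lem = solve-∀ ℚ-ring

      nonzero : ¬ (∀ u → x u ≡ 0ℚ)
      nonzero z = <⇒¬≤ neg-x (≤-reflexive (sym (trans (cong₂ (λ p q → p + ℓ * q) q0 d0) (trans (+-identityˡ (ℓ * 0ℚ)) (*-zeroʳ ℓ)))))
        where q0 : qf A x ≡ 0ℚ
              q0 = ∑-zero (λ u → trans (cong (_* (A ∙ x) u) (z u)) (*-zeroˡ ((A ∙ x) u)))
              d0 : dot x x ≡ 0ℚ
              d0 = ∑-zero (λ u → trans (cong (_* x u) (z u)) (*-zeroˡ (x u)))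

      module Scaled (v₀ : Fin n) (pos : 0ℚ < x v₀ * x v₀) (mx : ∀ u → x u * x u ≤ x v₀ * x v₀) where
        Y s : ℚ
        Y = x v₀ * x v₀
        -- This is 1/(x v₀), written with a positive denominator because `inv` is 0 on negative
        -- numbers. Scaled by it, x has all entries in [-1, 1] and entry 1 at `v₀`, so `v₀` dies and
        -- the process terminates.
        s = x v₀ * inv Y

        s² : s * s ≡ inv Y
        s² = trans (lem (x v₀) (inv Y)) (trans (cong (_* inv Y) (inv-* pos)) (*-identityˡ (inv Y)))
          where lem : ∀ c i → c * i * (c * i) ≡ c * c * i * i
                lem = solve-∀ ℚ-ring

        x′ : Vec n
        x′ u = s * x u

        x′² : ∀ u → x′ u * x′ u ≡ inv Y * (x u * x u)
        x′² u = trans (lem s (x u)) (cong (_* (x u * x u)) s²)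
          where lem : ∀ i y → i * y * (i * y) ≡ i * i * (y * y)
                lem = solve-∀ ℚ-ring

        x′²≤1 : ∀ u → x′ u * x′ u ≤ 1ℚ
        x′²≤1 u = subst₂ _≤_ (sym (x′² u)) (trans (*-comm (inv Y) Y) (inv-* pos)) (*-monoˡ (inv Y) (0≤inv Y) (mx u))

        x′v₀ : x′ v₀ * x′ v₀ ≡ 1ℚ
        x′v₀ = trans (x′² v₀) (trans (*-comm (inv Y) Y) (inv-* pos))

        xs′ : List (Vec n)
        xs′ = x′ ∷ xs

        energy′ : sum-qf A xs′ + ℓ * total xs′ ≤ 0ℚ
        energy′ = ≤-trans (≤-reflexive (trans (cong (λ z → qf A x′ + sum-qf A xs + ℓ * z) (∑-+ (λ v → x′ v * x′ v) (λ v → gram xs v v))) (lem (qf A x′) (sum-qf A xs) ℓ (dot x′ x′) (total xs))))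
            (≤-trans (+-mono-≤ new energy) (≤-reflexive (+-identityˡ 0ℚ)))
          where
            lem : ∀ q p l d t → q + p + l * (d + t) ≡ (q + l * d) + (p + l * t)
            lem = solve-∀ ℚ-ring
            lem₂ : ∀ s q l d → s * (q + l * d) ≡ s * q + l * (s * d)
            lem₂ = solve-∀ ℚ-ring
            new : qf A x′ + ℓ * dot x′ x′ ≤ 0ℚ
            new = subst₂ _≤_ (trans (lem₂ (s * s) (qf A x) ℓ (dot x x)) (cong₂ (λ p q → p + ℓ * q) (sym (qf-scale A s x)) (sym (dot-scale s x)))) (*-zeroʳ (s * s))
                    (*-monoˡ (s * s) (0≤sq s) (<⇒≤ neg-x))

        budget′ : ∀ v → gram xs′ v v ≤ 2ℚ
        budget′ v = go (S v) refl
          where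
            go : ∀ b → S v ≡ b → x′ v * x′ v + gram xs v v ≤ 2ℚ
            go true  e = +-mono-≤ (x′²≤1 v) (<⇒≤ (alive-< xs v e))
            go false e = ≤-trans (≤-reflexive (trans (cong (_+ gram xs v v) (trans (cong (λ z → s * z * (s * z)) (trans (cong (λ b → 𝟙 b * w v) e) (*-zeroˡ (w v)))) (lem s))) (+-identityˡ (gram xs v v)))) (budget v)
              where lem : ∀ s → s * 0ℚ * (s * 0ℚ) ≡ 0ℚ
                    lem = solve-∀ ℚ-ring

        alive′⊑ : alive xs′ ⊑ remove v₀ S
        alive′⊑ v h = combine (S v) refl (v₀ Finₚ.≟ v)
          where
            lt′ : x′ v * x′ v + gram xs v v < 1ℚ
            lt′ = alive-< xs′ v h
            combine : ∀ b → S v ≡ b → (d : Dec (v₀ ≡ v)) → S v ∧ not (does d) ≡ true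
            combine true  e (no _)     = trans (cong (_∧ true) e) refl
            combine b     e (yes refl) = ⊥-elim (<⇒¬≤ lt′ (≤-trans (≤-reflexive (sym x′v₀)) (≤-by (gram xs v v) refl (gram-diag xs v))))
            combine false e (no _)     = ⊥-elim (<⇒¬≤ lt′ (≤-trans (dead-≥ xs v e) (≤-by (x′ v * x′ v) (+-comm (gram xs v v) (x′ v * x′ v)) (0≤sq (x′ v)))))

        Sv₀ : S v₀ ≡ true
        Sv₀ = go (S v₀) refl
          where go : ∀ b → S v₀ ≡ b → S v₀ ≡ true
                go true  e = e
                go false e = ⊥-elim (<⇒¬≤ pos (≤-reflexive (trans (cong (λ b → 𝟙 b * w v₀ * (𝟙 b * w v₀)) e) (lem (w v₀)))))
                  where lem : ∀ w → 0ℚ * w * (0ℚ * w) ≡ 0ℚ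
                        lem = solve-∀ ℚ-ring

        decreases : size (alive xs′) ℕ.< size S
        decreases = ι-cancel-≤ (subst₂ _≤_ (cong (1ℚ +_) (sym (sz-size (alive xs′)))) (sym (sz-size S))
          (≤-trans (+-monoʳ-≤ 1ℚ (≤-trans (sz-mono alive′⊑) (≤-reflexive (sz-remove v₀ S Sv₀)))) (≤-reflexive (lem (sz S)))))
          where lem : ∀ z → 1ℚ + (z - 1ℚ) ≡ z
                lem = solve-∀ ℚ-ring

    peel-from : ∀ fuel xs → sum-qf A xs + ℓ * total xs ≤ 0ℚ → (∀ v → gram xs v v ≤ 2ℚ) → size (alive xs) ℕ.< fuel → Peeled
    peel-from (suc fuel) xs energy budget h = continue (gram-or-negative (shifted (alive xs)) (shifted-sym (alive xs)))
      where
        continue : GramOrNegative (shifted (alive xs)) → Peeled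
        continue (inj₁ (L , eq)) = record { xs = xs ; energy = energy ; budget = budget ; L = L ; factor = eq }
        continue (inj₂ (w , neg)) = go (largest-entry x)
          where
            open PeelStep xs energy budget w neg
            go : (∀ u → x u ≡ 0ℚ) ⊎ (∃[ v ] (0ℚ < x v * x v × (∀ u → x u * x u ≤ x v * x v))) → Peeled
            go (inj₁ z)               = ⊥-elim (nonzero z)
            go (inj₂ (v , pos , mx)) = peel-from fuel xs′ energy′ budget′ (ℕₚ.<-≤-trans decreases (ℕ.s≤s⁻¹ h))
              where open Scaled v pos mx

    peel : Peeled
    peel = peel-from (suc (size (alive []))) [] (≤-reflexive (trans (+-identityˡ (ℓ * total [])) (trans (cong (ℓ *_) (∑-0 n)) (*-zeroʳ ℓ)))) (λ _ → 0≤2) ℕₚ.≤-refl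

  lookup-gram : ∀ {n} (L : List (Vec n)) x y → (let B = λ x k → lookup L k x in (B · (B ᵀ)) x y) ≡ gram L x y
  lookup-gram []      x y = refl
  lookup-gram (l ∷ L) x y = cong (l x * l y +_) (lookup-gram L x y)

  -- Choice of parameters

  ι≤2↑ : ∀ t → ι t ≤ 2ℚ ↑ t
  ι≤2↑ zero    = 0≤1
  ι≤2↑ (suc t) = ≤-trans (+-mono-≤ (1≤↑ t 1≤2) (ι≤2↑ t)) (≤-reflexive (lem (2ℚ ↑ t)))
    where lem : ∀ z → z + z ≡ 2ℚ * z
          lem = solve-∀ ℚ-ring

  1≤ι : ∀ {N} → 0ℚ < ι N → 1ℚ ≤ ι N
  1≤ι {zero}  h = ⊥-elim (<-irrefl refl h)
  1≤ι {suc N} h = ≤-by (ι N) refl (0≤ι N)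

  archimedes : ∀ b → ∃[ m ] (b ≤ ι m)
  archimedes b with ≤⊎> b 0ℚ
  ... | inj₁ h = 0 , h
  ... | inj₂ h with positive-fraction b h
  ...   | N , D , D>0 , eq = N , subst (b ≤_) eq (subst (_≤ ι D * b) (*-identityˡ b) (*-monoʳ b (<⇒≤ h) (1≤ι {D} D>0)))

  inverse-below : ∀ c → 0ℚ < c → ∃[ D ] (0 ℕ.< D × inv (ι D) ≤ c)
  inverse-below c h with archimedes (inv c)
  ... | zero  , le = ⊥-elim (<⇒¬≤ (0<inv h) le)
  ... | suc m , le = suc m , ℕ.s≤s ℕ.z≤n , subst (inv (ι (suc m)) ≤_) (inv-unique (0<inv h) (trans (*-comm (inv c) c) (inv-* h))) (inv-anti (0<inv h) le)

  half-power-below : ∀ c → 0ℚ < c → ∃[ j ] (½ ↑ j ≤ c)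
  half-power-below c h with inverse-below c h
  ... | D , D>0 , le = D , ≤-trans (≤-trans (≤-reflexive (sym (inv-2↑ D))) (inv-anti (0<ι D>0) (ι≤2↑ D))) le

  module Thresholds (r : ℕ) (ε : ℚ) (0<ε : 0ℚ < ε) where

    -- The order of choice matters: the scale j depends on ε, Λ on j, and K on Λ. T comes last and
    -- must be large in terms of all of them.
    c₁ c₂ : ℚ
    c₁ = ¼ℚ * ε * inv (4ℚ * 2ℚ ↑ 31 * 2ℚ ↑ 5)

    0<denominator : 0ℚ < 4ℚ * 2ℚ ↑ 31 * 2ℚ ↑ 5
    0<denominator = 0<* {4ℚ * 2ℚ ↑ 31} {2ℚ ↑ 5} (0<* {4ℚ} {2ℚ ↑ 31} (positive⁻¹ 4ℚ) (0<↑ {2ℚ} 31 0<2)) (0<↑ {2ℚ} 5 0<2)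

    0<¼ε : 0ℚ < ¼ℚ * ε
    0<¼ε = 0<* (positive⁻¹ ¼ℚ) 0<ε

    choose-j : ∃[ j ] (½ ↑ j ≤ c₁)
    choose-j = half-power-below c₁ (0<* 0<¼ε (0<inv 0<denominator))

    j : ℕ
    j = proj₁ choose-j

    j-large : 4ℚ * 2ℚ ↑ 31 * (2ℚ ↑ 5 * ½ ↑ (7 ℕ.* suc j)) ≤ ¼ℚ * ε
    j-large = subst₂ _≤_ (*-assoc (4ℚ * 2ℚ ↑ 31) (2ℚ ↑ 5) (½ ↑ (7 ℕ.* suc j)))
        (trans (lem (4ℚ * 2ℚ ↑ 31 * 2ℚ ↑ 5) (¼ℚ * ε) (inv (4ℚ * 2ℚ ↑ 31 * 2ℚ ↑ 5))) (trans (cong (¼ℚ * ε *_) (inv-* 0<denominator)) (*-identityʳ (¼ℚ * ε))))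
        (*-monoˡ (4ℚ * 2ℚ ↑ 31 * 2ℚ ↑ 5) (<⇒≤ 0<denominator) (≤-trans (½↑-anti {j} {7 ℕ.* suc j} (ℕₚ.≤-trans (ℕₚ.n≤1+n j) (ℕₚ.m≤n*m (suc j) 7))) (proj₂ choose-j)))
      where lem : ∀ d e i → d * (e * i) ≡ e * (d * i)
            lem = solve-∀ ℚ-ring

    b : ℚ
    b = 2ℚ ↑ (5 ℕ.+ suc j)

    0<b : 0ℚ < b
    0<b = 0<↑ (5 ℕ.+ suc j) 0<2

    ε²/16 : ℚ
    ε²/16 = 1/16ℚ * (ε * ε)

    0<ε²/16 : 0ℚ < ε²/16
    0<ε²/16 = 0<* (positive⁻¹ 1/16ℚ) (0<* 0<ε 0<ε)

    c₂ = ½ * (ε²/16 * inv b)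

    choose-Λ : ∃[ Λ ] (0 ℕ.< Λ × inv (ι Λ) ≤ c₂)
    choose-Λ = inverse-below c₂ (0<* 0<½ (0<* 0<ε²/16 (0<inv 0<b)))

    Λ : ℕ
    Λ = proj₁ choose-Λ

    Λ>0 : 0 ℕ.< Λ
    Λ>0 = proj₁ (proj₂ choose-Λ)

    Λ-large : b * (2ℚ * inv (ι Λ)) ≤ ε²/16
    Λ-large = subst (b * (2ℚ * inv (ι Λ)) ≤_) (trans (lem b ε²/16 (inv b)) (trans (cong (ε²/16 *_) (inv-* 0<b)) (*-identityʳ ε²/16)))
        (*-monoˡ b (<⇒≤ 0<b) (*-monoˡ 2ℚ 0≤2 (proj₂ (proj₂ choose-Λ))))
      where lem : ∀ b e i → b * (2ℚ * (½ * (e * i))) ≡ e * (b * i)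
            lem = solve-∀ ℚ-ring

    k′ K : ℕ
    k′ = 32 ℕ.* Λ
    K  = suc (suc k′)

    k-large : 32 ℕ.* Λ ℕ.≤ K
    k-large = ℕₚ.≤-trans (ℕₚ.n≤1+n k′) (ℕₚ.n≤1+n (suc k′))

    -- `t₁` absorbs numerical constants and `t₂` the tail of the cube rounding; `t₃` and `t₄` make
    -- the error 1/T² small against ε/4 and ε²/(16b); `t₅` is the size needed for the minimum
    -- degree, and `t₆` pays for the shrinkage in the second round.
    t₁ t₂ t₃ t₄ t₅ t₆ : ℚ
    t₁ = 2ℚ ↑ 16
    t₂ = 2ℚ * momentBound (suc r) * 2ℚ ↑ r
    t₃ = inv (¼ℚ * ε)
    t₄ = b * inv ε²/16
    t₅ = ι (2 ℕ.* suc k′ ℕ.* suc (2 ℕ.* suc k′))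
    t₆ = 4ℚ * 2ℚ ↑ 31 * (2ℚ ↑ 31) ↑ K

    Large : ℚ → Set
    Large T = (t₁ ≤ T × t₂ ≤ T) × (t₃ ≤ T × t₄ ≤ T) × (t₅ ≤ T × t₆ ≤ T)

    threshold : ∃[ t₀ ] (∀ t → t₀ ℕ.≤ t → Large (ι t))
    threshold = proj₁ arch , λ t h → large (ι t) (≤-trans (proj₂ arch) (ι-mono h))
      where
        0≤t₁ : 0ℚ ≤ t₁
        0≤t₁ = 0≤↑ {2ℚ} 16 0≤2
        0≤t₂ : 0ℚ ≤ t₂
        0≤t₂ = 0≤* {2ℚ * momentBound (suc r)} {2ℚ ↑ r} (0≤* {2ℚ} {momentBound (suc r)} 0≤2 (0≤momentBound (suc r))) (0≤↑ {2ℚ} r 0≤2)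
        0≤t₃ : 0ℚ ≤ t₃
        0≤t₃ = 0≤inv (¼ℚ * ε)
        0≤t₄ : 0ℚ ≤ t₄
        0≤t₄ = 0≤* {b} {inv ε²/16} (<⇒≤ 0<b) (0≤inv ε²/16)
        0≤t₅ : 0ℚ ≤ t₅
        0≤t₅ = 0≤ι (2 ℕ.* suc k′ ℕ.* suc (2 ℕ.* suc k′))
        0≤t₆ : 0ℚ ≤ t₆
        0≤t₆ = 0≤* {4ℚ * 2ℚ ↑ 31} {(2ℚ ↑ 31) ↑ K} (0≤* {4ℚ} {2ℚ ↑ 31} (nonNegative⁻¹ 4ℚ) (0≤↑ {2ℚ} 31 0≤2)) (0≤↑ {2ℚ ↑ 31} K (0≤↑ {2ℚ} 31 0≤2))
        arch : ∃[ t₀ ] (t₁ + (t₂ + (t₃ + (t₄ + (t₅ + t₆)))) ≤ ι t₀)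
        arch = archimedes (t₁ + (t₂ + (t₃ + (t₄ + (t₅ + t₆)))))
        six : ∀ {a b c d e f T} → 0ℚ ≤ a → 0ℚ ≤ b → 0ℚ ≤ c → 0ℚ ≤ d → 0ℚ ≤ e → 0ℚ ≤ f → a + (b + (c + (d + (e + f)))) ≤ T →
              (a ≤ T × b ≤ T) × (c ≤ T × d ≤ T) × (e ≤ T × f ≤ T)
        six {a} {b} {c} {d} {e} {f} {T} ha hb hc hd he hf h =
            (≤-trans (≤-by (b + (c + (d + (e + f)))) refl (0≤+ hb (0≤+ hc (0≤+ hd (0≤+ he hf))))) h
            , ≤-trans (≤-by (a + (c + (d + (e + f)))) (lb a b (c + (d + (e + f)))) (0≤+ ha (0≤+ hc (0≤+ hd (0≤+ he hf))))) h)
          , (≤-trans (≤-by (a + b + (d + (e + f))) (lc a b c (d + (e + f))) (0≤+ (0≤+ ha hb) (0≤+ hd (0≤+ he hf)))) h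
            , ≤-trans (≤-by (a + b + c + (e + f)) (ld a b c d (e + f)) (0≤+ (0≤+ (0≤+ ha hb) hc) (0≤+ he hf))) h)
          , (≤-trans (≤-by (a + b + c + d + f) (le a b c d e f) (0≤+ (0≤+ (0≤+ (0≤+ ha hb) hc) hd) hf)) h
            , ≤-trans (≤-by (a + b + c + d + e) (lf a b c d e f) (0≤+ (0≤+ (0≤+ (0≤+ ha hb) hc) hd) he)) h)
          where
            lb : ∀ a b r → b + (a + r) ≡ a + (b + r)
            lb = solve-∀ ℚ-ring
            lc : ∀ a b c r → c + (a + b + r) ≡ a + (b + (c + r))
            lc = solve-∀ ℚ-ring
            ld : ∀ a b c d r → d + (a + b + c + r) ≡ a + (b + (c + (d + r)))
            ld = solve-∀ ℚ-ring
            le : ∀ a b c d e f → e + (a + b + c + d + f) ≡ a + (b + (c + (d + (e + f))))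
            le = solve-∀ ℚ-ring
            lf : ∀ a b c d e f → f + (a + b + c + d + e) ≡ a + (b + (c + (d + (e + f))))
            lf = solve-∀ ℚ-ring
        large : ∀ T → t₁ + (t₂ + (t₃ + (t₄ + (t₅ + t₆)))) ≤ T → Large T
        large T h = six {t₁} {t₂} {t₃} {t₄} {t₅} {t₆} {T} 0≤t₁ 0≤t₂ 0≤t₃ 0≤t₄ 0≤t₅ 0≤t₆ h

  -- With ν = 1/N: the error terms are O(T^9 ν + T^23 ν²), far below T^-2.
  module ErrorBound (N T : ℚ) (T>0 : 0ℚ < T) (11≤T : ℤ.+ 11 / 1 ≤ T) (N-lo : T ↑ 26 ≤ N) (q u : ℚ) (u>0 : 0ℚ < u) (qu>0 : 0ℚ < q * u)
      (hq : N ≤ T ↑ 4 * (q * u)) (hu : N ≤ T ↑ 4 * u) where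
    private
      ν i j ℓ : ℚ
      ν = inv N
      i = inv (q * u)
      j = inv u
      ℓ = T ↑ 5
      0≤T : 0ℚ ≤ T
      0≤T = <⇒≤ T>0
      N>0 : 0ℚ < N
      N>0 = 0<-≤ (0<↑ 26 T>0) N-lo
      0≤ν : 0ℚ ≤ ν
      0≤ν = 0≤inv N
      1≤T : 1ℚ ≤ T
      1≤T = ≤-trans (≤ᵇ⇒≤ {1ℚ} {ℤ.+ 11 / 1} tt) 11≤T
      below : ∀ {z} → 0ℚ < z → N ≤ T ↑ 4 * z → inv z ≤ T ↑ 4 * ν
      below {z} z>0 h = subst₂ _≤_ (trans (lem₁ N ν (inv z)) (trans (cong (_* inv z) (inv-* N>0)) (*-identityˡ (inv z))))
          (trans (lem₂ (T ↑ 4) z ν (inv z)) (trans (cong (T ↑ 4 * ν *_) (inv-* z>0)) (*-identityʳ (T ↑ 4 * ν))))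
          (*-monoʳ (ν * inv z) (0≤* 0≤ν (0≤inv z)) h)
        where lem₁ : ∀ n v i → n * (v * i) ≡ n * v * i
              lem₁ = solve-∀ ℚ-ring
              lem₂ : ∀ t z v i → t * z * (v * i) ≡ t * v * (z * i)
              lem₂ = solve-∀ ℚ-ring
      i≤ : i ≤ T ↑ 4 * ν
      i≤ = below qu>0 hq
      j≤ : j ≤ T ↑ 4 * ν
      j≤ = below u>0 hu
      Tν≤1 : T ↑ 26 * ν ≤ 1ℚ
      Tν≤1 = subst (T ↑ 26 * ν ≤_) (inv-* N>0) (*-monoʳ ν 0≤ν N-lo)
      0≤ℓ : 0ℚ ≤ ℓ
      0≤ℓ = 0≤↑ 5 0≤T
      0≤κ : 0ℚ ≤ T ↑ 4 * ν
      0≤κ = 0≤* (0≤↑ 4 0≤T) 0≤ν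
      err : ℚ
      err = 3ℚ * ℓ * (2ℚ * i) + ℓ ↑ 3 * ((2ℚ * i) * (2ℚ * i)) + ℓ * j
      7ℚ 11ℚ : ℚ
      7ℚ = ℤ.+ 7 / 1
      11ℚ = ℤ.+ 11 / 1
      err≤ : err ≤ 3ℚ * ℓ * (2ℚ * (T ↑ 4 * ν)) + ℓ ↑ 3 * ((2ℚ * (T ↑ 4 * ν)) * (2ℚ * (T ↑ 4 * ν))) + ℓ * (T ↑ 4 * ν)
      err≤ = +-mono-≤ (+-mono-≤ (*-monoˡ (3ℚ * ℓ) (0≤* (nonNegative⁻¹ 3ℚ) 0≤ℓ) 2i≤)
               (*-monoˡ (ℓ ↑ 3) (0≤↑ 3 0≤ℓ) (*-mono (0≤* 0≤2 (0≤inv (q * u))) (0≤* 0≤2 0≤κ) 2i≤ 2i≤))) (*-monoˡ ℓ 0≤ℓ j≤)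
        where 2i≤ : 2ℚ * i ≤ 2ℚ * (T ↑ 4 * ν)
              2i≤ = *-monoˡ 2ℚ 0≤2 i≤
      ν≤1 : ν ≤ 1ℚ
      ν≤1 = ≤-trans (subst (_≤ T ↑ 26 * ν) (*-identityˡ ν) (*-monoʳ ν 0≤ν (1≤↑ 26 1≤T))) Tν≤1
      e : ℚ
      e = 7ℚ * (T ↑ 11 * ν) + 4ℚ * (T ↑ 25 * (ν * ν))
      collect : T * T * (3ℚ * ℓ * (2ℚ * (T ↑ 4 * ν)) + ℓ ↑ 3 * ((2ℚ * (T ↑ 4 * ν)) * (2ℚ * (T ↑ 4 * ν))) + ℓ * (T ↑ 4 * ν)) ≡ e
      collect = trans (cong (λ z → T * T * (3ℚ * ℓ * (2ℚ * (T ↑ 4 * ν)) + z * ((2ℚ * (T ↑ 4 * ν)) * (2ℚ * (T ↑ 4 * ν))) + ℓ * (T ↑ 4 * ν))) (↑-↑ T 5 3))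
          (trans (lem T (T ↑ 5) (T ↑ 15) (T ↑ 4) ν) (cong₂ (λ p s → 7ℚ * (p * ν) + 4ℚ * (s * (ν * ν))) p₁ p₂))
        where
          lem : ∀ t a b c v → t * t * (3ℚ * a * (2ℚ * (c * v)) + b * ((2ℚ * (c * v)) * (2ℚ * (c * v))) + a * (c * v)) ≡ 7ℚ * (t * (t * (a * c)) * v) + 4ℚ * (t * (t * (b * (c * c))) * (v * v))
          lem = solve-∀ ℚ-ring
          p₁ : T * (T * (T ↑ 5 * T ↑ 4)) ≡ T ↑ 11
          p₁ = cong (λ z → T * (T * z)) (sym (↑-+ T 5 4))
          p₂ : T * (T * (T ↑ 15 * (T ↑ 4 * T ↑ 4))) ≡ T ↑ 25
          p₂ = cong (λ z → T * (T * z)) (trans (cong (T ↑ 15 *_) (sym (↑-+ T 4 4))) (sym (↑-+ T 15 8)))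
      Te≤ : T * e ≤ T * 1ℚ
      Te≤ = ≤-trans (≤-reflexive (lem T (T ↑ 11) (T ↑ 25) ν))
            (≤-trans (+-mono-≤ (*-monoˡ 7ℚ (nonNegative⁻¹ 7ℚ) (≤-trans (*-monoʳ ν 0≤ν (↑-mono-exp {T} {12} {26} 1≤T (ℕₚ.m≤m+n 12 14))) Tν≤1))
                               (*-monoˡ 4ℚ (nonNegative⁻¹ 4ℚ) (*-mono 0≤ν 0≤1 Tν≤1 ν≤1)))
            (≤-trans (≤ᵇ⇒≤ {7ℚ * 1ℚ + 4ℚ * (1ℚ * 1ℚ)} {11ℚ} tt) (≤-trans 11≤T (≤-reflexive (sym (*-identityʳ T))))))
        where lem : ∀ t a b v → t * (7ℚ * (a * v) + 4ℚ * (b * (v * v))) ≡ 7ℚ * (t * a * v) + 4ℚ * (t * b * v * v)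
              lem = solve-∀ ℚ-ring

    error≤ : 3ℚ * T ↑ 5 * (2ℚ * inv (q * u)) + (T ↑ 5) ↑ 3 * ((2ℚ * inv (q * u)) * (2ℚ * inv (q * u))) + T ↑ 5 * inv u ≤ inv (T * T)
    error≤ = cancel-≤ (T * T) T²>0 (subst (T * T * err ≤_) (sym (inv-* T²>0))
        (≤-trans (*-monoˡ (T * T) (<⇒≤ T²>0) err≤) (≤-trans (≤-reflexive collect) (cancel-≤ T T>0 Te≤))))
      where T²>0 : 0ℚ < T * T
            T²>0 = 0<* T>0 T>0

  -- The complete argument for one graph at scale T

  module Assembly {n} (G : Graph n) (r′ : ℕ) (ε : ℚ) (0<ε : 0ℚ < ε) (t : ℕ)
      (large : Thresholds.Large (suc r′) ε 0<ε (ι t))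
      (N-lo : ι t ↑ 100 ≤ ι n) (N-hi : ι n ≤ (2ℚ * ι t) ↑ suc r′)
      (dense : ι n * ι n ≤ 2ℚ * ι t * ι (edges G)) (few : Cuts.surplus₂ G ≤ 4ℚ * (ι n * ι t)) where
    open OnGraph G
    open Extremal G
    open Cuts G using (surplus₂; all; A≡a)
    open Thresholds (suc r′) ε 0<ε

    T N ℓ η : ℚ
    T = ι t
    N = ι n
    ℓ = T ↑ 5
    η = inv (T * T)

    T-large : 2ℚ ↑ 16 ≤ T
    T-large = proj₁ (proj₁ large)

    above : ∀ {c} → c ≤ 2ℚ ↑ 16 → c ≤ T
    above h = ≤-trans h T-large

    1≤T : 1ℚ ≤ T
    1≤T = above (1≤↑ {2ℚ} 16 1≤2)

    T>0 : 0ℚ < T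
    T>0 = 0<-≤ 0<1 1≤T

    0≤T : 0ℚ ≤ T
    0≤T = <⇒≤ T>0

    N>0 : 0ℚ < N
    N>0 = 0<-≤ (0<↑ 100 T>0) N-lo

    0≤N : 0ℚ ≤ N
    0≤N = <⇒≤ N>0

    1≤ℓ : 1ℚ ≤ ℓ
    1≤ℓ = 1≤↑ 5 1≤T

    open Peeling G ℓ (≤-trans 0≤1 1≤ℓ) using (peel; alive; dead-≥; total; module Peeled)
    open Peeled peel

    S : Fin n → Bool
    S = alive xs

    sz≤N : ∀ W → sz W ≤ N
    sz≤N W = subst (sz W ≤_) (trans (∑-const n 1ℚ) (*-identityʳ N)) (∑-mono (λ x → 𝟙≤1 (W x)))

    dead : ℚ
    dead = N - sz S

    0≤dead : 0ℚ ≤ dead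
    0≤dead = 0≤-diff (sz≤N S)

    dead≤total : dead ≤ total xs
    dead≤total = subst (_≤ total xs) (trans (∑-- (λ _ → 1ℚ) (λ v → 𝟙 (S v))) (cong (_- sz S) (trans (∑-const n 1ℚ) (*-identityʳ N))))
        (∑-mono (λ v → go v (S v) refl))
      where
        go : ∀ v b → S v ≡ b → 1ℚ - 𝟙 (S v) ≤ gram xs v v
        go v true  e = subst (λ b → 1ℚ - 𝟙 b ≤ gram xs v v) (sym e) (gram-diag xs v)
        go v false e = subst (λ b → 1ℚ - 𝟙 b ≤ gram xs v v) (sym e) (dead-≥ xs v e)

    θ C : ℚ
    θ = inv (T * T) ↑ suc r′
    C = momentBound (suc (suc r′))

    -- One factor N ≤ (2T)^r is set against T^(-2r), where r = `suc r′`; a factor T^(-r) ≤ 1/T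
    -- survives and beats the moment constant by `t₂`.
    tail-small : 2ℚ * (N * N) * (C * θ) ≤ N
    tail-small = ≤-trans (subst₂ _≤_ (lem₁ N C θ) (lem₂ N C (2ℚ ↑ suc r′) (T ↑ suc r′) θ) (*-monoˡ (2ℚ * (N * (C * θ))) (0≤* 0≤2 (0≤* 0≤N (0≤* (0≤momentBound (suc (suc r′))) 0≤θ)))
          (subst (N ≤_) (↑-*-dist 2ℚ T (suc r′)) N-hi)))
        (subst (N * (2ℚ * C * 2ℚ ↑ suc r′ * (T ↑ suc r′ * θ)) ≤_) (*-identityʳ N) (*-monoˡ N 0≤N
          (≤-trans (*-monoˡ (2ℚ * C * 2ℚ ↑ suc r′) (0≤* {2ℚ * C} {2ℚ ↑ suc r′} (0≤* {2ℚ} {C} 0≤2 (0≤momentBound (suc (suc r′)))) (0≤↑ {2ℚ} (suc r′) 0≤2)) Tθ≤)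
            (subst (2ℚ * C * 2ℚ ↑ suc r′ * inv T ≤_) (inv-* T>0) (*-monoʳ (inv T) (0≤inv T) (proj₂ (proj₁ large)))))))
      where
        0≤θ : 0ℚ ≤ θ
        0≤θ = 0≤↑ (suc r′) (0≤inv (T * T))
        lem₁ : ∀ n c t → 2ℚ * (n * (c * t)) * n ≡ 2ℚ * (n * n) * (c * t)
        lem₁ = solve-∀ ℚ-ring
        lem₂ : ∀ n c p s t → 2ℚ * (n * (c * t)) * (p * s) ≡ n * (2ℚ * c * p * (s * t))
        lem₂ = solve-∀ ℚ-ring
        invT≤1 : inv T ≤ 1ℚ
        invT≤1 = subst (inv T ≤_) (inv-unique 0<1 (*-identityˡ 1ℚ)) (inv-anti 0<1 1≤T)
        T·η : T * inv (T * T) ≡ inv T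
        T·η = sym (inv-unique T>0 (trans (sym (*-assoc T T (inv (T * T)))) (inv-* (0<* T>0 T>0))))
        Tθ≤ : T ↑ suc r′ * θ ≤ inv T
        Tθ≤ = subst (_≤ inv T) (trans (cong (_↑ suc r′) (sym T·η)) (↑-*-dist T (inv (T * T)) (suc r′)))
                (subst (inv T ↑ suc r′ ≤_) (*-identityʳ (inv T)) (*-monoˡ (inv T) (0≤inv T) (↑≤1 r′ (0≤inv T) invT≤1)))

    9ℚ 36ℚ : ℚ
    9ℚ  = ℤ.+ 9 / 1
    36ℚ = ℤ.+ 36 / 1

    -- 8 is 2 · 4 from twice `surplus₂` ≤ 4NT at height T, and the ninth unit is the tail of the
    -- rounding.
    ℓdead≤ : ℓ * dead ≤ 9ℚ * (N * T ↑ 3)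
    ℓdead≤ = ≤-trans (*-monoˡ ℓ (≤-trans 0≤1 1≤ℓ) dead≤total)
        (≤-trans (≤-from-diff (subst (0ℚ ≤_) (lem (sum-qf A xs) (2ℚ * surplus₂ * (T * T) + 2ℚ * (N * N) * (C * θ)) (ℓ * total xs))
                   (0≤+ (Exhaustion.sum-qf-bound G (suc r′) T>0 xs budget) (0≤-diff energy))))
        (≤-trans (+-mono-≤ (≤-trans (*-monoʳ (T * T) (0≤sq T) (*-monoˡ 2ℚ 0≤2 few)) (≤-reflexive (lem₂ N T)))
                           (≤-trans tail-small (subst (_≤ N * T ↑ 3) (*-identityʳ N) (*-monoˡ N 0≤N (1≤↑ 3 1≤T)))))
                 (≤-reflexive (lem₃ (N * T ↑ 3)))))
      where
        lem : ∀ s c e → (s + c) + (0ℚ - (s + e)) ≡ c - e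
        lem = solve-∀ ℚ-ring
        lem₂ : ∀ n t → 2ℚ * (4ℚ * (n * t)) * (t * t) ≡ 8ℚ * (n * (t * (t * (t * 1ℚ))))
        lem₂ = solve-∀ ℚ-ring
        lem₃ : ∀ z → 8ℚ * z + z ≡ 9ℚ * z
        lem₃ = solve-∀ ℚ-ring

    T²dead≤ : T * (T * dead) ≤ 9ℚ * N
    T²dead≤ = cancel-≤ (T ↑ 3) (0<↑ 3 T>0) (subst₂ _≤_ (lem T dead) (lem₂ N (T ↑ 3)) ℓdead≤)
      where lem : ∀ t d → t * (t * (t * (t * (t * 1ℚ)))) * d ≡ t * (t * (t * 1ℚ)) * (t * (t * d))
            lem = solve-∀ ℚ-ring
            lem₂ : ∀ n z → 9ℚ * (n * z) ≡ z * (9ℚ * n)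
            lem₂ = solve-∀ ℚ-ring

    lost-edges : e₂ all ≤ e₂ S + 2ℚ * N * dead
    lost-edges = ≤-trans (∑-mono (λ x → ∑-mono (λ y → cell x y))) (≤-reflexive (trans (∑-cong (λ x → trans (∑-+ (a S x) (λ y → D x + D y))
          (cong (∑ (a S x) +_) (trans (∑-+ (λ _ → D x) D) (cong₂ _+_ (∑-const n (D x)) refl)))))
        (trans (∑-+ (λ x → ∑ (a S x)) (λ x → N * D x + ∑ D)) (cong (e₂ S +_) (trans (∑-+ (λ x → N * D x) (λ _ → ∑ D))
          (trans (cong₂ _+_ (∑-*ˡ N D) (∑-const n (∑ D))) (trans (cong (λ z → N * z + N * z) D≡) (lem N dead))))))))
      where
        D : Vec n
        D x = 1ℚ - 𝟙 (S x)
        D≡ : ∑ D ≡ dead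
        D≡ = trans (∑-- (λ _ → 1ℚ) (λ v → 𝟙 (S v))) (cong (_- sz S) (trans (∑-const n 1ℚ) (*-identityʳ N)))
        lem : ∀ n d → n * d + n * d ≡ 2ℚ * n * d
        lem = solve-∀ ℚ-ring
        0≤D : ∀ b → 0ℚ ≤ 1ℚ - 𝟙 b
        0≤D b = 0≤-diff (𝟙≤1 b)
        cell : ∀ x y → a all x y ≤ a S x y + (D x + D y)
        cell x y = ≤-trans (≤-reflexive (A≡a x y)) (go (S x) (S y))
          where
            go : ∀ b c → A x y ≤ 𝟙 b * (𝟙 c * A x y) + ((1ℚ - 𝟙 b) + (1ℚ - 𝟙 c))
            go true  true  = ≤-reflexive (lem₁ (A x y))
              where lem₁ : ∀ z → z ≡ 1ℚ * (1ℚ * z) + ((1ℚ - 1ℚ) + (1ℚ - 1ℚ))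
                    lem₁ = solve-∀ ℚ-ring
            go true  false = ≤-trans (𝟙≤1 (adj G x y)) (≤-reflexive (lem₁ (A x y)))
              where lem₁ : ∀ z → 1ℚ ≡ 1ℚ * (0ℚ * z) + ((1ℚ - 1ℚ) + (1ℚ - 0ℚ))
                    lem₁ = solve-∀ ℚ-ring
            go false c     = ≤-trans (𝟙≤1 (adj G x y)) (≤-by (1ℚ - 𝟙 c) (lem₁ (𝟙 c) (A x y)) (0≤D c))
              where lem₁ : ∀ c z → 1ℚ + (1ℚ - c) ≡ 0ℚ * (c * z) + ((1ℚ - 0ℚ) + (1ℚ - c))
                    lem₁ = solve-∀ ℚ-ring

    -- 4T `dead` ≤ N, so the deleted vertices carry at most half of the edge weight N²/T.
    dense-S : N * N ≤ 2ℚ * T * e₂ S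
    dense-S = ≤-by (2ℚ * (T * (e₂ S + 2ℚ * N * dead) - N * N) + (N * N - 4ℚ * (N * (T * dead)))) (lem N T (e₂ S) dead)
        (0≤+ (0≤* 0≤2 (0≤-diff d₁)) (0≤-diff d₂))
      where
        lem : ∀ n t e d → n * n + (2ℚ * (t * (e + 2ℚ * n * d) - n * n) + (n * n - 4ℚ * (n * (t * d)))) ≡ 2ℚ * t * e
        lem = solve-∀ ℚ-ring
        lem₂ : ∀ t e → 2ℚ * t * e ≡ t * (2ℚ * e)
        lem₂ = solve-∀ ℚ-ring
        d₁ : N * N ≤ T * (e₂ S + 2ℚ * N * dead)
        d₁ = ≤-trans dense (≤-trans (≤-reflexive (trans (lem₂ T (ι (edges G))) (cong (T *_) (sym (e₂-edges all))))) (*-monoˡ T 0≤T lost-edges))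
        lem₃ : ∀ n z → 36ℚ * (4ℚ * (n * z)) ≡ 4ℚ * n * (36ℚ * z)
        lem₃ = solve-∀ ℚ-ring
        lem₄ : ∀ n → 4ℚ * n * (9ℚ * n) ≡ 36ℚ * (n * n)
        lem₄ = solve-∀ ℚ-ring
        d₂ : 4ℚ * (N * (T * dead)) ≤ N * N
        d₂ = cancel-≤ 36ℚ (positive⁻¹ 36ℚ) (≤-trans (≤-reflexive (lem₃ N (T * dead)))
               (≤-trans (*-monoˡ (4ℚ * N) (0≤* (nonNegative⁻¹ 4ℚ) 0≤N) (≤-trans (*-monoʳ (T * dead) (0≤* 0≤T 0≤dead) (above (≤ᵇ⇒≤ {36ℚ} {2ℚ ↑ 16} tt))) T²dead≤)) (≤-reflexive (lem₄ N))))

    e₂S>0 : 0ℚ < e₂ S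
    e₂S>0 = ≰⇒> (λ h → <⇒¬≤ (0<* N>0 N>0) (≤-trans dense-S (≤-trans (*-monoˡ (2ℚ * T) (0≤* 0≤2 0≤T) h) (≤-reflexive (*-zeroʳ (2ℚ * T))))))

    U₁ : Fin n → Bool
    U₁ = proj₁ (extremal-exists 1 S e₂S>0)

    ext₁ : IsExtremal 1 S U₁
    ext₁ = proj₂ (extremal-exists 1 S e₂S>0)

    u₁ q₁ : ℚ
    u₁ = sz U₁
    q₁ = density U₁

    u₁>0 : 0ℚ < u₁
    u₁>0 = sz-pos U₁ (IsExtremal.e>0 ext₁)

    0≤q₁ : 0ℚ ≤ q₁
    0≤q₁ = 0≤density U₁

    q₁≤1 : q₁ ≤ 1ℚ
    q₁≤1 = density≤1 U₁ u₁>0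

    -- Comparison with S itself, whose potential for K = 2 is e₂²/s³ with s ≤ N. This one bound
    -- yields both q₁ ≥ 1/(2T) and the size of U₁.
    ψ-large : N ≤ 4ℚ * (T * T) * (q₁ * (q₁ * u₁))
    ψ-large = ≤-trans (cancel-≤ (s ↑ 3) (0<↑ 3 s>0) chain) (≤-trans (*-monoˡ (4ℚ * (T * T)) (0≤* (nonNegative⁻¹ 4ℚ) (0≤sq T)) (IsExtremal.best ext₁ S (λ _ e → e)))
        (≤-reflexive (cong (4ℚ * (T * T) *_) (lem q₁ u₁))))
      where
        s : ℚ
        s = sz S
        s>0 : 0ℚ < s
        s>0 = sz-pos S e₂S>0
        lem : ∀ q u → q * (q * 1ℚ) * u ≡ q * (q * u)
        lem = solve-∀ ℚ-ring
        lem₂ : ∀ t p z → z * (4ℚ * (t * t) * p) ≡ 4ℚ * (t * t) * (p * z)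
        lem₂ = solve-∀ ℚ-ring
        lem₃ : ∀ n → n * (n * (n * 1ℚ)) * n ≡ n * n * (n * n)
        lem₃ = solve-∀ ℚ-ring
        lem₄ : ∀ t e → 2ℚ * t * e * (2ℚ * t * e) ≡ 4ℚ * (t * t) * (e * (e * 1ℚ))
        lem₄ = solve-∀ ℚ-ring
        chain : s ↑ 3 * N ≤ s ↑ 3 * (4ℚ * (T * T) * ψ 1 S)
        chain = ≤-trans (*-monoʳ N 0≤N (↑-mono 3 (<⇒≤ s>0) (sz≤N S))) (≤-trans (≤-reflexive (lem₃ N))
          (≤-trans (*-mono (0≤* 0≤N 0≤N) (≤-trans (0≤* 0≤N 0≤N) dense-S) dense-S dense-S)
          (≤-reflexive (trans (lem₄ T (e₂ S)) (trans (cong (4ℚ * (T * T) *_) (sym (ψ-pow 1 S s>0))) (sym (lem₂ T (ψ 1 S) (s ↑ 3))))))))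

    N≤qu₁ : N ≤ 4ℚ * (T * T) * (q₁ * u₁)
    N≤qu₁ = ≤-trans ψ-large (*-monoˡ (4ℚ * (T * T)) (0≤* (nonNegative⁻¹ 4ℚ) (0≤sq T))
              (subst (q₁ * (q₁ * u₁) ≤_) (*-identityˡ (q₁ * u₁)) (*-monoʳ (q₁ * u₁) (0≤* 0≤q₁ (<⇒≤ u₁>0)) q₁≤1)))

    1≤2Tq : 1ℚ ≤ 2ℚ * T * q₁
    1≤2Tq = ≤-sq (0≤* (0≤* 0≤2 0≤T) 0≤q₁) (cancel-≤ N N>0 (subst₂ _≤_ (sym (trans (cong (N *_) (*-identityˡ 1ℚ)) (*-identityʳ N))) (lem T q₁ N)
        (≤-trans ψ-large (*-monoˡ (4ℚ * (T * T)) (0≤* (nonNegative⁻¹ 4ℚ) (0≤sq T)) (*-monoˡ q₁ 0≤q₁ (*-monoˡ q₁ 0≤q₁ (sz≤N U₁)))))))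
      where lem : ∀ t q n → 4ℚ * (t * t) * (q * (q * n)) ≡ n * (2ℚ * t * q * (2ℚ * t * q))
            lem = solve-∀ ℚ-ring

    4T²≤T⁴ : 4ℚ * (T * T) ≤ T ↑ 4
    4T²≤T⁴ = subst (4ℚ * (T * T) ≤_) (lem T) (*-monoʳ (T * T) (0≤sq T) (≤-trans (above (≤ᵇ⇒≤ {4ℚ} {2ℚ ↑ 16} tt)) (subst (_≤ T * T) (*-identityʳ T) (*-monoˡ T 0≤T 1≤T))))
      where lem : ∀ t → t * t * (t * t) ≡ t * (t * (t * (t * 1ℚ)))
            lem = solve-∀ ℚ-ring

    qu≤u : ∀ W → 0ℚ < sz W → density W * sz W ≤ sz W
    qu≤u W h = subst (density W * sz W ≤_) (*-identityˡ (sz W)) (*-monoʳ (sz W) (<⇒≤ h) (density≤1 W h))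

    T⁹⁶≤ : ∀ W → 0ℚ < sz W → N ≤ T ↑ 4 * (density W * sz W) → T ↑ 96 ≤ sz W
    T⁹⁶≤ W w>0 h = cancel-≤ (T ↑ 4) (0<↑ 4 T>0) (≤-trans (≤-reflexive (sym (↑-+ T 4 96))) (≤-trans N-lo (≤-trans h (*-monoˡ (T ↑ 4) (0≤↑ 4 0≤T) (qu≤u W w>0)))))

    -- ℓ^19 = T^95, while T^100 ≤ N ≤ T^4 |W| leaves |W| ≥ T^96.
    ℓ-bound : ∀ W → 0ℚ < sz W → N ≤ T ↑ 4 * (density W * sz W) → 8ℚ * ℓ ↑ 19 ≤ sz W
    ℓ-bound W w>0 h = ≤-trans (≤-trans (≤-reflexive (cong (8ℚ *_) (↑-↑ T 5 19))) (*-monoʳ (T ↑ 95) (0≤↑ 95 0≤T) (above (≤ᵇ⇒≤ {8ℚ} {2ℚ ↑ 16} tt)))) (T⁹⁶≤ W w>0 h)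

    T≤sz : ∀ W → 0ℚ < sz W → N ≤ T ↑ 4 * (density W * sz W) → T ≤ sz W
    T≤sz W w>0 h = ≤-trans (subst (_≤ T ↑ 96) (*-identityʳ T) (*-monoˡ T 0≤T (1≤↑ 95 1≤T))) (T⁹⁶≤ W w>0 h)

    m : ℕ
    m = 40 ℕ.* t

    ℓ8≤ : ℓ ↑ 8 ≤ 2ℚ ↑ m
    ℓ8≤ = ≤-trans (≤-reflexive (↑-↑ T 5 8)) (≤-trans (↑-mono 40 0≤T (ι≤2↑ t)) (≤-reflexive (↑-↑ 2ℚ t 40)))

    B₀ : Mat n (length L)
    B₀ x k = lookup L k x

    open Phases G S ℓ 1≤ℓ m ℓ8≤ B₀ (λ x y → trans (lookup-gram L x y) (factor x y)) using (error; module Phase₁; module Phase₂)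

    error-bound : ∀ W → 0ℚ < e₂ W → N ≤ T ↑ 4 * (density W * sz W) → error (density W) (sz W) ≤ η
    error-bound W e>0 h = ErrorBound.error≤ N T T>0 (above (≤ᵇ⇒≤ {ℤ.+ 11 / 1} {2ℚ ↑ 16} tt)) (≤-trans (↑-mono-exp {T} {26} {100} 1≤T (ℕₚ.m≤m+n 26 74)) N-lo) (density W) (sz W) w>0
        (0<* (0<* e>0 (0<* (0<inv w>0) (0<inv w>0))) w>0) h (≤-trans h (*-monoˡ (T ↑ 4) (0≤↑ 4 0≤T) (qu≤u W w>0)))
      where w>0 : 0ℚ < sz W
            w>0 = sz-pos W e>0

    0≤η : 0ℚ ≤ η
    0≤η = 0≤inv (T * T)

    Tη≡ : T * η ≡ inv T
    Tη≡ = sym (inv-unique T>0 (trans (sym (*-assoc T T (inv (T * T)))) (inv-* (0<* T>0 T>0))))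

    η≤invT : η ≤ inv T
    η≤invT = inv-anti T>0 (subst (_≤ T * T) (*-identityʳ T) (*-monoˡ T 0≤T 1≤T))

    invT≤ : ∀ {c} → 0ℚ < c → inv c ≤ T → inv T ≤ c
    invT≤ {c} c>0 h = subst (inv T ≤_) (inv-unique (0<inv c>0) (trans (*-comm (inv c) c) (inv-* c>0))) (inv-anti (0<inv c>0) h)

    N≤₁ : N ≤ T ↑ 4 * (density U₁ * sz U₁)
    N≤₁ = ≤-trans N≤qu₁ (*-monoʳ (q₁ * u₁) (0≤* 0≤q₁ (<⇒≤ u₁>0)) 4T²≤T⁴)

    q₁≥ : ½ ↑ 31 ≤ q₁
    q₁≥ = Phase₁.density-lower U₁ ext₁ (ℓ-bound U₁ u₁>0 N≤₁) (≤-trans (above (≤ᵇ⇒≤ {ι 6} {2ℚ ↑ 16} tt)) (T≤sz U₁ u₁>0 N≤₁)) T η 1≤T (suc t) (*-monoˡ 2ℚ 0≤2 (ι≤2↑ t)) 1≤2Tq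
        (error-bound U₁ (IsExtremal.e>0 ext₁) N≤₁) (≤-trans η≤invT (invT≤ {1/16ℚ} (positive⁻¹ 1/16ℚ) (above (≤ᵇ⇒≤ {inv 1/16ℚ} {2ℚ ↑ 16} tt)))) Tη≤ 0≤η
      where
        Tη≤ : 2ℚ ↑ 12 * T * η ≤ 1/16ℚ
        Tη≤ = ≤-trans (≤-reflexive (trans (*-assoc (2ℚ ↑ 12) T η) (cong (2ℚ ↑ 12 *_) Tη≡)))
                (cancel-≤ T T>0 (≤-trans (≤-reflexive (trans (lem T (2ℚ ↑ 12) (inv T)) (trans (cong (2ℚ ↑ 12 *_) (inv-* T>0)) (*-identityʳ (2ℚ ↑ 12)))))
                  (≤-trans (≤ᵇ⇒≤ {2ℚ ↑ 12} {2ℚ ↑ 16 * 1/16ℚ} tt) (*-monoʳ 1/16ℚ (nonNegative⁻¹ 1/16ℚ) T-large))))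
          where lem : ∀ t c i → t * (c * i) ≡ c * (t * i)
                lem = solve-∀ ℚ-ring

    U₂ : Fin n → Bool
    U₂ = proj₁ (extremal-exists (suc k′) U₁ (IsExtremal.e>0 ext₁))

    ext₂ : IsExtremal (suc k′) U₁ U₂
    ext₂ = proj₂ (extremal-exists (suc k′) U₁ (IsExtremal.e>0 ext₁))

    u₂ q₂ : ℚ
    u₂ = sz U₂
    q₂ = density U₂

    u₂>0 : 0ℚ < u₂
    u₂>0 = sz-pos U₂ (IsExtremal.e>0 ext₂)

    ψ₁≤ψ₂ : q₁ ↑ K * u₁ ≤ q₂ ↑ K * u₂
    ψ₁≤ψ₂ = IsExtremal.best ext₂ U₁ (λ _ e → e)

    0≤q₂ : 0ℚ ≤ q₂
    0≤q₂ = 0≤density U₂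

    -- U₂ lies inside U₁, so its potential can be at least that of U₁ only through the density.
    q₁≤q₂ : q₁ ≤ q₂
    q₁≤q₂ = ↑-cancel-≤ {q₁} {q₂} (suc k′) 0≤q₂ (cancel-≤ u₁ u₁>0 (subst₂ _≤_ (*-comm (q₁ ↑ K) u₁) (*-comm (q₂ ↑ K) u₁)
              (≤-trans ψ₁≤ψ₂ (*-monoˡ (q₂ ↑ K) (0≤↑ K 0≤q₂) (sz-mono (IsExtremal.U⊑S ext₂))))))

    q₂≥ : ½ ↑ 31 ≤ q₂
    q₂≥ = ≤-trans q₁≥ q₁≤q₂

    h g : ℚ
    h = ½ ↑ 31
    g = 2ℚ ↑ 31

    hg : h * g ≡ 1ℚ
    hg = ½↑-2↑ 31

    -- Since q₁ ≥ 2^(-31), the second round shrinks the set by at most 2^(31K), a constant.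
    u₁≤ : u₁ ≤ g ↑ K * u₂
    u₁≤ = subst₂ _≤_ eq refl (*-monoˡ (g ↑ K) 0≤gK (≤-trans (*-monoʳ u₁ (<⇒≤ u₁>0) (↑-mono {h} {q₁} K 0≤h q₁≥)) (≤-trans ψ₁≤ψ₂
            (subst (q₂ ↑ K * u₂ ≤_) (*-identityˡ u₂) (*-monoʳ u₂ (<⇒≤ u₂>0) (↑≤1 {q₂} K 0≤q₂ (density≤1 U₂ u₂>0)))))))
      where
        0≤h : 0ℚ ≤ h
        0≤h = 0≤↑ {½} 31 0≤½
        0≤gK : 0ℚ ≤ g ↑ K
        0≤gK = 0≤↑ {g} K (0≤↑ {2ℚ} 31 0≤2)
        lem : ∀ x y z → x * (y * z) ≡ y * x * z
        lem = solve-∀ ℚ-ring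
        eq : g ↑ K * (h ↑ K * u₁) ≡ u₁
        eq = trans (lem (g ↑ K) (h ↑ K) u₁) (trans (cong (_* u₁) (trans (sym (↑-*-dist h g K)) (trans (cong (_↑ K) hg) (1↑ K)))) (*-identityˡ u₁))

    u₂≤ : u₂ ≤ g * (q₂ * u₂)
    u₂≤ = subst (_≤ g * (q₂ * u₂)) eq (*-monoˡ g (0≤↑ {2ℚ} 31 0≤2) (*-monoʳ u₂ (<⇒≤ u₂>0) q₂≥))
      where
        lem : ∀ x y z → x * (y * z) ≡ y * x * z
        lem = solve-∀ ℚ-ring
        eq : g * (h * u₂) ≡ u₂
        eq = trans (lem g h u₂) (trans (cong (_* u₂) hg) (*-identityˡ u₂))

    N≤₂ : N ≤ T ↑ 4 * (density U₂ * sz U₂)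
    N≤₂ = ≤-trans N≤qu₁ (≤-trans (*-monoˡ (4ℚ * (T * T)) 0≤4T² (≤-trans (qu≤u U₁ u₁>0) (≤-trans u₁≤ (*-monoˡ (g ↑ K) 0≤gK u₂≤))))
        (≤-trans (≤-reflexive (lem T g (g ↑ K) (q₂ * u₂))) (*-monoʳ (q₂ * u₂) (0≤* 0≤q₂ (<⇒≤ u₂>0))
          (≤-trans (*-monoˡ (T * T) (0≤sq T) (≤-trans (proj₂ (proj₂ (proj₂ large))) (subst (_≤ T * T) (*-identityʳ T) (*-monoˡ T 0≤T 1≤T)))) (≤-reflexive (lem₂ T))))))
      where
        0≤4T² : 0ℚ ≤ 4ℚ * (T * T)
        0≤4T² = 0≤* (nonNegative⁻¹ 4ℚ) (0≤sq T)
        0≤gK : 0ℚ ≤ g ↑ K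
        0≤gK = 0≤↑ {g} K (0≤↑ {2ℚ} 31 0≤2)
        lem : ∀ t g k z → 4ℚ * (t * t) * (k * (g * z)) ≡ t * t * (4ℚ * g * k) * z
        lem = solve-∀ ℚ-ring
        lem₂ : ∀ t → t * t * (t * t) ≡ t * (t * (t * (t * 1ℚ)))
        lem₂ = solve-∀ ℚ-ring

    q₂-high : 1ℚ - ε ≤ q₂
    q₂-high = Phase₂.density-high k′ U₁ U₂ (IsExtremal.U⊑S ext₁) ext₂ (ℓ-bound U₂ u₂>0 N≤₂) (≤-trans (proj₁ (proj₂ (proj₂ large))) (T≤sz U₂ u₂>0 N≤₂)) ε η 0<ε 0≤η j Λ Λ>0 k-large
        (error-bound U₂ (IsExtremal.e>0 ext₂) N≤₂) q₂≥ j-large (≤-trans η≤invT (invT≤ {¼ℚ * ε} 0<¼ε (proj₁ (proj₁ (proj₂ large))))) Λ-large bη≤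
      where
        b≤ : b ≤ T * ε²/16
        b≤ = subst₂ _≤_ (trans (*-assoc b (inv ε²/16) ε²/16) (trans (cong (b *_) (trans (*-comm (inv ε²/16) ε²/16) (inv-* 0<ε²/16))) (*-identityʳ b))) refl
               (*-monoʳ ε²/16 (<⇒≤ 0<ε²/16) (proj₂ (proj₁ (proj₂ large))))
        bη≤ : b * η ≤ ε²/16
        bη≤ = ≤-trans (*-monoˡ b (<⇒≤ 0<b) η≤invT) (subst (b * inv T ≤_) (trans (lem₂ T ε²/16 (inv T)) (trans (cong (ε²/16 *_) (inv-* T>0)) (*-identityʳ ε²/16))) (*-monoʳ (inv T) (0≤inv T) b≤))
          where lem₂ : ∀ t e i → t * e * i ≡ e * (t * i)
                lem₂ = solve-∀ ℚ-ring

    conclusion : ∃[ U ] (N ≤ T ↑ 4 * sz U × (1ℚ - ε) * (sz U * sz U) ≤ e₂ U)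
    conclusion = U₂ , ≤-trans N≤₂ (*-monoˡ (T ↑ 4) (0≤↑ 4 0≤T) (qu≤u U₂ u₂>0)) ,
      subst ((1ℚ - ε) * (u₂ * u₂) ≤_) (density-sz U₂ u₂>0) (*-monoʳ (u₂ * u₂) (0≤sq u₂) q₂-high)

  -- Integer roots and the return to natural numbers

  root : ∀ r n → ∃[ t ] (t ℕ.^ suc r ℕ.≤ n × n ℕ.< suc t ℕ.^ suc r)
  root r zero    = 0 , ℕ.z≤n , ℕₚ.m^n>0 1 (suc r)
  root r (suc n) with root r n
  ... | t , lo , hi with suc t ℕ.^ suc r ℕ.≤? suc n
  ...   | yes p = suc t , p , ℕₚ.≤-<-trans hi (ℕₚ.^-monoˡ-< (suc r) (ℕₚ.n<1+n (suc t)))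
  ...   | no ¬p = t , ℕₚ.m≤n⇒m≤1+n lo , ℕₚ.≰⇒> ¬p

  ^-cancelˡ-≤ : ∀ r {a b} → a ℕ.^ suc r ℕ.≤ b ℕ.^ suc r → a ℕ.≤ b
  ^-cancelˡ-≤ r {a} {b} h with a ℕ.≤? b
  ... | yes p = p
  ... | no ¬p = ⊥-elim (ℕₚ.<⇒≱ (ℕₚ.^-monoˡ-< (suc r) (ℕₚ.≰⇒> ¬p)) h)

  ^-*-dist : ∀ a b r → (a ℕ.* b) ℕ.^ r ≡ a ℕ.^ r ℕ.* b ℕ.^ r
  ^-*-dist a b zero    = refl
  ^-*-dist a b (suc r) = trans (cong (a ℕ.* b ℕ.*_) (^-*-dist a b r)) (lem a b (a ℕ.^ r) (b ℕ.^ r))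
    where lem : ∀ a b x y → a ℕ.* b ℕ.* (x ℕ.* y) ≡ a ℕ.* x ℕ.* (b ℕ.* y)
          lem = ℕ-solve-∀

  -- The theorem with 1/1000 replaced by 1/(4+s); t is the integer part of n^(1/(4+s)).
  module Main (s : ℕ) (r-large : 100 ℕ.≤ 4 ℕ.+ s) (ε : ℚ) (0<ε : 0ℚ < ε) where

    r r′ : ℕ
    r  = 4 ℕ.+ s
    r′ = 3 ℕ.+ s

    t₀ : ℕ
    -- The successor guarantees t ≥ 1, so that t + 1 ≤ 2t.
    t₀ = suc (proj₁ (Thresholds.threshold (suc r′) ε 0<ε))

    n₀ : ℕ
    n₀ = t₀ ℕ.^ r

    module _ (n : ℕ) (n-large : n₀ ℕ.≤ n) (G : Graph n)
             (dense : n ℕ.^ (r ℕ.+ r′) ℕ.≤ edges G ℕ.^ r)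
             (few : (2 ℕ.* mc G ℕ.∸ edges G) ℕ.^ r ℕ.≤ 2 ℕ.^ r ℕ.* n ℕ.^ suc r) where

      private
        t : ℕ
        t = proj₁ (root r′ n)
        lo : t ℕ.^ r ℕ.≤ n
        lo = proj₁ (proj₂ (root r′ n))
        hi : n ℕ.< suc t ℕ.^ r
        hi = proj₂ (proj₂ (root r′ n))

      t-large : t₀ ℕ.≤ t
      t-large = ℕₚ.≮⇒≥ (λ t<t₀ → ℕₚ.<⇒≱ hi (ℕₚ.≤-trans (ℕₚ.^-monoˡ-≤ r t<t₀) n-large))

      1≤t : 1 ℕ.≤ t
      1≤t = ℕₚ.≤-trans (ℕ.s≤s ℕ.z≤n) t-large

      n≤2t^r : n ℕ.≤ (2 ℕ.* t) ℕ.^ r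
      n≤2t^r = ℕₚ.≤-trans (ℕₚ.<⇒≤ hi) (ℕₚ.^-monoˡ-≤ r (subst (suc t ℕ.≤_) (cong (t ℕ.+_) (sym (ℕₚ.+-identityʳ t))) (ℕₚ.+-monoˡ-≤ t 1≤t)))

      n>0 : 0 ℕ.< n
      n>0 = ℕₚ.<-≤-trans (ℕₚ.m^n>0 t {{ℕ.>-nonZero 1≤t}} r) lo

      -- Multiply n^(2r-1) ≤ e^r by n ≤ (2t)^r and take r-th roots; `few′` is obtained likewise.
      dense′ : n ℕ.* n ℕ.≤ edges G ℕ.* (2 ℕ.* t)
      dense′ = ^-cancelˡ-≤ r′ (ℕₚ.≤-trans (ℕₚ.≤-reflexive eq) (ℕₚ.≤-trans (ℕₚ.*-mono-≤ dense n≤2t^r) (ℕₚ.≤-reflexive (sym (^-*-dist (edges G) (2 ℕ.* t) r)))))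
        where
          eq : (n ℕ.* n) ℕ.^ r ≡ n ℕ.^ (r ℕ.+ r′) ℕ.* n
          eq = trans (^-*-dist n n r) (trans (sym (ℕₚ.^-distribˡ-+-* n r r)) (trans (cong (n ℕ.^_) (ℕₚ.+-suc r r′)) (ℕₚ.*-comm n (n ℕ.^ (r ℕ.+ r′)))))

      few′ : 2 ℕ.* mc G ℕ.∸ edges G ℕ.≤ 2 ℕ.* n ℕ.* (2 ℕ.* t)
      few′ = ^-cancelˡ-≤ r′ (ℕₚ.≤-trans few (ℕₚ.≤-trans (ℕₚ.*-monoʳ-≤ (2 ℕ.^ r) (ℕₚ.*-monoˡ-≤ (n ℕ.^ r) n≤2t^r)) (ℕₚ.≤-reflexive eq)))
        where
          lem : ∀ a b c → a ℕ.* (b ℕ.* c) ≡ a ℕ.* c ℕ.* b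
          lem = ℕ-solve-∀
          eq : 2 ℕ.^ r ℕ.* ((2 ℕ.* t) ℕ.^ r ℕ.* n ℕ.^ r) ≡ (2 ℕ.* n ℕ.* (2 ℕ.* t)) ℕ.^ r
          eq = trans (lem (2 ℕ.^ r) ((2 ℕ.* t) ℕ.^ r) (n ℕ.^ r)) (sym (trans (^-*-dist (2 ℕ.* n) (2 ℕ.* t) r) (cong (ℕ._* (2 ℕ.* t) ℕ.^ r) (^-*-dist 2 n r))))

      ι2t : ι (2 ℕ.* t) ≡ 2ℚ * ι t
      ι2t = ι-* 2 t

      found : ∃[ U ] (ι n ≤ ι t ↑ 4 * OnGraph.sz G U × (1ℚ - ε) * (OnGraph.sz G U * OnGraph.sz G U) ≤ OnGraph.e₂ G U)
      found = Assembly.conclusion G r′ ε 0<ε t (proj₂ (Thresholds.threshold (suc r′) ε 0<ε) t (ℕₚ.≤-trans (ℕₚ.n≤1+n (proj₁ (Thresholds.threshold (suc r′) ε 0<ε))) t-large))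
        (subst (_≤ ι n) (ι-^ t 100) (ι-mono (ℕₚ.≤-trans (ℕₚ.^-monoʳ-≤ t {{ℕ.>-nonZero 1≤t}} r-large) lo)))
        (subst (ι n ≤_) (trans (ι-^ (2 ℕ.* t) r) (cong (_↑ r) ι2t)) (ι-mono n≤2t^r))
        (subst₂ _≤_ (ι-* n n) (trans (ι-* (edges G) (2 ℕ.* t)) (trans (*-comm (ι (edges G)) (ι (2 ℕ.* t))) (cong (_* ι (edges G)) ι2t))) (ι-mono dense′))
        (subst (Cuts.surplus₂ G ≤_) (trans (ι-* (2 ℕ.* n) (2 ℕ.* t)) (trans (cong₂ _*_ (ι-* 2 n) ι2t) (lem (ι n) (ι t)))) (ι-mono few′))
        where lem : ∀ n t → 2ℚ * n * (2ℚ * t) ≡ 4ℚ * (n * t)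
              lem = solve-∀ ℚ-ring

      U : Fin n → Bool
      U = proj₁ found

      n≤ : n ℕ.≤ t ℕ.^ 4 ℕ.* size U
      n≤ = ι-cancel-≤ (subst (ι n ≤_) (sym (trans (ι-* (t ℕ.^ 4) (size U)) (cong₂ _*_ (ι-^ t 4) (OnGraph.sz-size G U)))) (proj₁ (proj₂ found)))

      -- From n^r ≤ t^(4r) |U|^r ≤ n^4 |U|^r the factor n^4 cancels, as r = 4 + s. The loss of t^4
      -- is thus the 4ρ of the theorem.
      size-bound : n ℕ.^ s ℕ.≤ size U ℕ.^ r
      size-bound = ℕₚ.*-cancelˡ-≤ (n ℕ.^ 4) {{ℕ.>-nonZero (ℕₚ.m^n>0 n {{ℕ.>-nonZero n>0}} 4)}}
        (ℕₚ.≤-trans (ℕₚ.≤-reflexive (sym (ℕₚ.^-distribˡ-+-* n 4 s))) (ℕₚ.≤-trans (ℕₚ.^-monoˡ-≤ r n≤)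
          (ℕₚ.≤-trans (ℕₚ.≤-reflexive (^-*-dist (t ℕ.^ 4) (size U) r)) (ℕₚ.*-monoˡ-≤ (size U ℕ.^ r)
            (ℕₚ.≤-trans (ℕₚ.≤-reflexive (trans (ℕₚ.^-*-assoc t 4 r) (trans (cong (t ℕ.^_) (ℕₚ.*-comm 4 r)) (sym (ℕₚ.^-*-assoc t r 4))))) (ℕₚ.^-monoˡ-≤ 4 lo))))))

      density-bound : (1ℚ - ε) * (ℤ.+ (size U ℕ.^ 2) / 1) ≤ ℤ.+ (2 ℕ.* edgesIn G U) / 1
      density-bound = subst₂ (λ p q → (1ℚ - ε) * p ≤ q)
        (trans (cong₂ _*_ (sym (OnGraph.sz-size G U)) (trans (sym (OnGraph.sz-size G U)) (sym (*-identityʳ (ι (size U)))))) (trans (sym (ι-^ (size U) 2)) (ι≡/1 (size U ℕ.^ 2))))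
        (trans (OnGraph.e₂-edges G U) (trans (sym (ι-* 2 (edgesIn G U))) (ι≡/1 (2 ℕ.* edgesIn G U))))
        (proj₂ (proj₂ found))

      result : ∃[ U ] (n ℕ.^ s ℕ.≤ size U ℕ.^ r × (1ℚ - ε) * (ℤ.+ (size U ℕ.^ 2) / 1) ≤ ℤ.+ (2 ℕ.* edgesIn G U) / 1)
      result = U , size-bound , density-bound

open import Defs
open import Data.Nat using (ℕ; _+_; _*_; _∸_; _^_; _≤_)
open import Data.Rational using (ℚ; 0ℚ; 1ℚ; _-_; _<_) renaming (_*_ to _*ℚ_)
open import Data.Rational using (_/_)
open import Data.Integer using (+_)
open import Data.Fin using (Fin)
open import Data.Bool using (Bool)
open import Data.Product using (∃-syntax; _×_; _,_)
open import Data.Nat.Properties using (m≤m+n)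

theorem1p7 : (ε : ℚ) → 0ℚ < ε →
    ∃[ n₀ ] ((n : ℕ) → n₀ Data.Nat.≤ n → (G : Graph n) →
    n ^ 1999 Data.Nat.≤ edges G ^ 1000 →
    (2 * mc G ∸ edges G) ^ 1000 Data.Nat.≤ 2 ^ 1000 * n ^ 1001 →
    ∃[ S ] (n ^ 996 Data.Nat.≤ size S ^ 1000 ×
    (1ℚ - ε) *ℚ (+ (size S ^ 2) / 1) Data.Rational.≤ (+ (2 * edgesIn G S) / 1)))
-- s = 996 makes r = 1000, and 1000 = 100 + 900 leaves room for T^100 ≤ n.
theorem1p7 ε 0<ε = Proof.Main.n₀ 996 (m≤m+n 100 900) ε 0<ε , Proof.Main.result 996 (m≤m+n 100 900) ε 0<ε
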